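{- Let $(G,\mathcal{B},\mathcal{L},\mathcal{F})$ be a quasi-biased graph such that $\mathrm{si}(G)$ is obtained from a complete graph by deleting the edges of a path with at most two edges, and $|V(G)|>3$, and suppose $M=M(G,\mathcal{B},\mathcal{L},\mathcal{F})$ is connected. Then $M$ is not unbreakable if and only if one of the following holds: (i) $V(G)$ has a partition $(V_1,V_2,V_3)$ such that $G[V_i]$ is connected for $i=1,2,3$, there are no edges between $V_1$ and $V_2$, and either $G[V_i]$ contains a cycle in $\mathcal{L}$ for some $i$, or every cycle of $G$ is balanced; (ii) $V(G)$ has a partition $(V_1,V_2)$ such that $G[V_1]$ and $G[V_2]$ are connected and $E[V_1,V_2]$ has a partition into two balancing sets; (iii) $V(G)$ has a partition $(V_1,V_2)$ and there is a balancing set $X\subseteq E(G[V_1])$ such that $G[V_1]\setminus X$ and $G[V_2]$ are both connected; (iii)$'$ $V(G)$ has a partition $(V_1,V_2,V_3)$ and there is a balancing set $X\subseteq E(G[V_1\cup V_3])$ such that $G[V_1]\setminus X$, $G[V_2]$ and $G[V_3]\setminus X$ are connected, $G[V_3]$ contains a cycle in $\mathcal{F}$, and there are no edges between $V_2$ and $V_3$; (iv) $V(G)$ has a partition $(V_1,V_2)$ and there is a balancing set $X\subseteq E(G[V_1])\cup E(G[V_2])$ such that $G[V_i]\setminus X$ is connected for $i=1,2$ and $G[V_i]$ contains a cycle in $\mathcal{L}$ for $i=1,2$; (v) $V(G)$ has a partition $(V_1,V_2,V_3)$ such that $G[V_i]$ is connected for $i=1,2,3$, there are no edges between $V_1$ and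 $V_2$, and $G[V_3]$ contains a cycle in $\mathcal{F}$.
   Context: Graphs are finite with loops and parallel edges allowed; cycles include loops and 2-cycles. A quasi-biased graph $(G,\mathcal{B},\mathcal{L},\mathcal{F})$ is a graph with a partition $(\mathcal{B},\mathcal{L},\mathcal{F})$ of its cycles such that no theta subgraph contains exactly two cycles of $\mathcal{B}$ and every cycle in $\mathcal{L}$ shares a vertex with every cycle in $\mathcal{F}$. Cycles in $\mathcal{B}$ are balanced, others unbalanced. $M(G,\mathcal{B},\mathcal{L},\mathcal{F})$ is the matroid on $E(G)$ whose circuits are: cycles in $\mathcal{B}$; theta subgraphs with no cycle in $\mathcal{B}$; tight handcuffs (two edge-disjoint cycles sharing exactly one vertex) with neither cycle in $\mathcal{B}$; unions of two vertex-disjoint cycles of $\mathcal{L}$; loose handcuffs (two vertex-disjoint cycles plus a minimal path joining them) with both cycles in $\mathcal{F}$. A balancing set is a set $X$ of edges such that $G$ has an unbalanced cycle but $G\setminus X$ has none. $E[V_1,V_2]$ is the set of edges with one end in $V_1$ and the other in $V_2$; $G[W]$ is the induced subgraph; $\mathrm{si}(G)$ is the simplification. A matroid is unbreakable if it is connected and $M/F$ is connected for every flat $F$. -}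

module Defs where

open import Data.Nat as ℕ using (ℕ; zero; suc; _+_; _≤_; _<_; s≤s)
open import Data.Bool using (Bool; true; false; _∧_; _∨_)
open import Data.Fin as Fin using (Fin; zero; suc; toℕ; fromℕ; fromℕ<; inject₁)
open import Data.Fin.Properties using (any?) renaming (_≟_ to _≟ᶠ_)
open import Data.Fin.Subset using (Subset; _∈_; _∉_; _⊆_; _∪_; _∩_; ∁; ⊤; Empty; Nonempty)
open import Data.Vec using (tabulate; lookup)
open import Data.Product using (Σ; ∃; ∃-syntax; _×_; _,_; proj₁; proj₂)
open import Data.Sum using (_⊎_)
open import Relation.Nullary using (¬_; does; yes; no)
open import Relation.Binary.PropositionalEquality using (_≡_; _≢_)
open import Function.Definitions using (Injective)
open import Function.Bundles using (_⇔_)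

-- Graphs: vertex set Fin n, edge set Fin m; each edge has two ends
-- (an unordered pair, stored as an ordered pair whose orientation is
-- irrelevant). Loops (equal ends) and parallel edges are allowed.

Graph : ℕ → ℕ → Set
Graph n m = Fin m → Fin n × Fin n

image : ∀ {k N} → (Fin k → Fin N) → Subset N
image {k} f = tabulate (λ x → does (any? (λ i → f i ≟ᶠ x)))

next : ∀ {k} → Fin (suc k) → Fin (suc k)
next {k} i with toℕ i ℕ.<? k
... | yes p = fromℕ< (s≤s p)
... | no _  = zero

data Kind : Set where
  bal lft frm : Kind

isB : Kind → ℕ
isB bal = 1
isB lft = 0
isB frm = 0

module _ {n m : ℕ} (G : Graph n m) where

  Joins : Fin m → Fin n → Fin n → Set
  Joins e u v = (G e ≡ (u , v)) ⊎ (G e ≡ (v , u))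

  Adj : Fin n → Fin n → Set
  Adj u v = ∃[ e ] Joins e u v

  -- a cycle: v₀ e₀ v₁ e₁ … v_len e_len v₀ with distinct vertices and
  -- distinct edges (length suc len ≥ 1; loops and 2-cycles included)
  record Cycle : Set where
    field
      len     : ℕ
      vtx     : Fin (suc len) → Fin n
      edg     : Fin (suc len) → Fin m
      vtx-inj : Injective _≡_ _≡_ vtx
      edg-inj : Injective _≡_ _≡_ edg
      joins   : ∀ i → Joins (edg i) (vtx i) (vtx (next i))
    E : Subset m
    E = image edg
    V : Subset n
    V = image vtx

  record Path : Set where
    field
      len     : ℕ
      vtx     : Fin (suc len) → Fin n
      edg     : Fin len → Fin m
      vtx-inj : Injective _≡_ _≡_ vtx
      edg-inj : Injective _≡_ _≡_ edg
      joins   : ∀ (i : Fin len) → Joins (edg i) (vtx (inject₁ i)) (vtx (suc i))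
    start end : Fin n
    start = vtx zero
    end   = vtx (fromℕ len)
    E : Subset m
    E = image edg
    V : Subset n
    V = image vtx
    Internal : Fin n → Set
    Internal v = v ∈ V × v ≢ start × v ≢ end

  record Theta : Set where
    field
      u v : Fin n
      u≢v : u ≢ v
      P₁ P₂ P₃ : Path
      st₁ : Path.start P₁ ≡ u
      st₂ : Path.start P₂ ≡ u
      st₃ : Path.start P₃ ≡ u
      en₁ : Path.end P₁ ≡ v
      en₂ : Path.end P₂ ≡ v
      en₃ : Path.end P₃ ≡ v
      edis₁₂ : Empty (Path.E P₁ ∩ Path.E P₂)
      edis₁₃ : Empty (Path.E P₁ ∩ Path.E P₃)
      edis₂₃ : Empty (Path.E P₂ ∩ Path.E P₃)
      int₁ : ∀ w → Path.Internal P₁ w → w ∉ Path.V P₂ × w ∉ Path.V P₃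
      int₂ : ∀ w → Path.Internal P₂ w → w ∉ Path.V P₁ × w ∉ Path.V P₃
      int₃ : ∀ w → Path.Internal P₃ w → w ∉ Path.V P₁ × w ∉ Path.V P₂
    E : Subset m
    E = Path.E P₁ ∪ (Path.E P₂ ∪ Path.E P₃)
    C₁₂ C₁₃ C₂₃ : Subset m
    C₁₂ = Path.E P₁ ∪ Path.E P₂
    C₁₃ = Path.E P₁ ∪ Path.E P₃
    C₂₃ = Path.E P₂ ∪ Path.E P₃

  VDisjoint : Cycle → Cycle → Set
  VDisjoint C D = Empty (Cycle.V C ∩ Cycle.V D)

  -- quasi-biased: cls assigns each cycle (via its edge set) to 𝓑, 𝓛 or 𝓕
  record QuasiBiased (cls : Subset m → Kind) : Set where
    field
      theta-cond : ∀ (T : Theta) →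
        isB (cls (Theta.C₁₂ T)) + isB (cls (Theta.C₁₃ T)) + isB (cls (Theta.C₂₃ T)) ≢ 2
      lf-meet : ∀ (C D : Cycle) → cls (Cycle.E C) ≡ lft → cls (Cycle.E D) ≡ frm →
        Nonempty (Cycle.V C ∩ Cycle.V D)

  data Circuit (cls : Subset m → Kind) (S : Subset m) : Set where
    balanced-cycle : (C : Cycle) → S ≡ Cycle.E C → cls (Cycle.E C) ≡ bal → Circuit cls S
    theta : (T : Theta) → S ≡ Theta.E T →
      cls (Theta.C₁₂ T) ≢ bal → cls (Theta.C₁₃ T) ≢ bal → cls (Theta.C₂₃ T) ≢ bal →
      Circuit cls S
    tight-handcuff : (C D : Cycle) → Empty (Cycle.E C ∩ Cycle.E D) →
      (w : Fin n) → w ∈ Cycle.V C → w ∈ Cycle.V D →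
      (∀ x → x ∈ Cycle.V C → x ∈ Cycle.V D → x ≡ w) →
      S ≡ Cycle.E C ∪ Cycle.E D → cls (Cycle.E C) ≢ bal → cls (Cycle.E D) ≢ bal →
      Circuit cls S
    two-L-cycles : (C D : Cycle) → VDisjoint C D →
      S ≡ Cycle.E C ∪ Cycle.E D → cls (Cycle.E C) ≡ lft → cls (Cycle.E D) ≡ lft →
      Circuit cls S
    loose-handcuff : (C D : Cycle) → VDisjoint C D → (P : Path) →
      Path.start P ∈ Cycle.V C → Path.end P ∈ Cycle.V D →
      (∀ x → x ∈ Path.V P → x ∈ Cycle.V C ⊎ x ∈ Cycle.V D →
         x ≡ Path.start P ⊎ x ≡ Path.end P) →
      S ≡ Cycle.E C ∪ (Cycle.E D ∪ Path.E P) →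
      cls (Cycle.E C) ≡ frm → cls (Cycle.E D) ≡ frm →
      Circuit cls S

  inducedE : Subset n → Subset m
  inducedE W = tabulate (λ e → lookup W (proj₁ (G e)) ∧ lookup W (proj₂ (G e)))

  crossE : Subset n → Subset n → Subset m
  crossE W₁ W₂ = tabulate (λ e →
    (lookup W₁ (proj₁ (G e)) ∧ lookup W₂ (proj₂ (G e))) ∨
    (lookup W₂ (proj₁ (G e)) ∧ lookup W₁ (proj₂ (G e))))

  data Reach (W : Subset n) (A : Subset m) (u : Fin n) : Fin n → Set where
    here : Reach W A u u
    step : ∀ {w x e} → Reach W A u w → e ∈ A → Joins e w x → x ∈ W → Reach W A u x

  ConnectedOn : Subset n → Subset m → Set
  ConnectedOn W A = Nonempty W × (∀ u v → u ∈ W → v ∈ W → Reach W A u v)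

  InducedConnected : Subset n → Set
  InducedConnected W = ConnectedOn W ⊤

  InducedMinusConnected : Subset n → Subset m → Set
  InducedMinusConnected W X = ConnectedOn W (∁ X)

  ContainsCycleOf : (Subset m → Kind) → Kind → Subset n → Set
  ContainsCycleOf cls k W = ∃[ C ] (Cycle.V C ⊆ W × cls (Cycle.E C) ≡ k)

  Balancing : (Subset m → Kind) → Subset m → Set
  Balancing cls X =
    (∃[ C ] cls (Cycle.E C) ≢ bal) ×
    (∀ (C : Cycle) → Empty (Cycle.E C ∩ X) → cls (Cycle.E C) ≡ bal)

  AllBalanced : (Subset m → Kind) → Set
  AllBalanced cls = ∀ (C : Cycle) → cls (Cycle.E C) ≡ bal

  NoEdgesBetween : Subset n → Subset n → Set
  NoEdgesBetween W₁ W₂ = Empty (crossE W₁ W₂)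

record SmallPath (n : ℕ) : Set where
  field
    len   : ℕ
    len≤2 : len ≤ 2
    pv    : Fin (suc len) → Fin n
    pv-inj : Injective _≡_ _≡_ pv

PathPair : ∀ {n} → SmallPath n → Fin n → Fin n → Set
PathPair P u v = ∃[ i ]
  ((u ≡ pv (inject₁ i) × v ≡ pv (suc i)) ⊎ (v ≡ pv (inject₁ i) × u ≡ pv (suc i)))
  where open SmallPath P

SiCompleteMinusPath : ∀ {n m} → Graph n m → Set
SiCompleteMinusPath {n} G = ∃[ P ] (∀ (u v : Fin n) → u ≢ v → (Adj G u v ⇔ (¬ PathPair P u v)))

record Partition (n k : ℕ) : Set where
  field
    part     : Fin n → Fin k
    nonempty : ∀ (i : Fin k) → ∃[ v ] part v ≡ i
  cell : Fin k → Subset n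
  cell i = tabulate (λ v → does (part v ≟ᶠ i))

module Matroid {m : ℕ} (Circ : Subset m → Set) where

  Connected : Set
  Connected = ∀ (e f : Fin m) → e ≢ f → ∃[ C ] (Circ C × e ∈ C × f ∈ C)

  InClosure : Subset m → Fin m → Set
  InClosure X e = e ∈ X ⊎ ∃[ C ] (Circ C × e ∈ C × (∀ f → f ∈ C → f ∈ X ⊎ f ≡ e))

  Flat : Subset m → Set
  Flat X = ∀ e → InClosure X e → e ∈ X

  ContrForm : Subset m → Subset m → Set
  ContrForm F D = ∃[ C ] (Circ C × D ≡ C ∩ ∁ F)

  ContrCircuit : Subset m → Subset m → Set
  ContrCircuit F D = ContrForm F D × Nonempty D ×
    (∀ D' → ContrForm F D' → Nonempty D' → D' ⊆ D → D ⊆ D')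

  ContrConnected : Subset m → Set
  ContrConnected F = ∀ (e f : Fin m) → e ∉ F → f ∉ F → e ≢ f →
    ∃[ D ] (ContrCircuit F D × e ∈ D × f ∈ D)

  Unbreakable : Set
  Unbreakable = Connected × (∀ F → Flat F → ContrConnected F)

module _ {n m : ℕ} (G : Graph n m) (cls : Subset m → Kind) where

  private
    f0 f1 f2 : Fin 3
    f0 = zero
    f1 = suc zero
    f2 = suc (suc zero)
    g0 g1 : Fin 2
    g0 = zero
    g1 = suc zero

  OutcomeI : Set
  OutcomeI = ∃[ p ] (let V = Partition.cell {n} {3} p in
    InducedConnected G (V f0) × InducedConnected G (V f1) × InducedConnected G (V f2) ×
    NoEdgesBetween G (V f0) (V f1) ×
    ((∃[ i ] ContainsCycleOf G cls lft (V i)) ⊎ AllBalanced G cls))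

  OutcomeII : Set
  OutcomeII = ∃[ p ] (let V = Partition.cell {n} {2} p in
    InducedConnected G (V g0) × InducedConnected G (V g1) ×
    ∃[ X₁ ] ∃[ X₂ ] (Empty (X₁ ∩ X₂) × X₁ ∪ X₂ ≡ crossE G (V g0) (V g1) ×
                      Balancing G cls X₁ × Balancing G cls X₂))

  OutcomeIII : Set
  OutcomeIII = ∃[ p ] (let V = Partition.cell {n} {2} p in
    ∃[ X ] (Balancing G cls X × X ⊆ inducedE G (V g0) ×
            InducedMinusConnected G (V g0) X × InducedConnected G (V g1)))

  OutcomeIII' : Set
  OutcomeIII' = ∃[ p ] (let V = Partition.cell {n} {3} p in
    ∃[ X ] (Balancing G cls X × X ⊆ inducedE G (V f0 ∪ V f2) ×
            InducedMinusConnected G (V f0) X × InducedConnected G (V f1) ×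
            InducedMinusConnected G (V f2) X ×
            ContainsCycleOf G cls frm (V f2) × NoEdgesBetween G (V f1) (V f2)))

  OutcomeIV : Set
  OutcomeIV = ∃[ p ] (let V = Partition.cell {n} {2} p in
    ∃[ X ] (Balancing G cls X × X ⊆ (inducedE G (V g0) ∪ inducedE G (V g1)) ×
            InducedMinusConnected G (V g0) X × InducedMinusConnected G (V g1) X ×
            ContainsCycleOf G cls lft (V g0) × ContainsCycleOf G cls lft (V g1)))

  OutcomeV : Set
  OutcomeV = ∃[ p ] (let V = Partition.cell {n} {3} p in
    InducedConnected G (V f0) × InducedConnected G (V f1) × InducedConnected G (V f2) ×
    NoEdgesBetween G (V f0) (V f1) × ContainsCycleOf G cls frm (V f2))

{-# OPTIONS --safe #-}

-- A connected matroid M is not unbreakable iff some flat F has M/F equal to two parallel classes: take F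
-- maximal among the flats avoiding two elements that lie in no common circuit of M/F. Everything is read off
-- an explicit description of the closure operator (Dep): e lies in the closure of X iff e ∈ X, or e closes a
-- balanced cycle with X, or the ends of e are joined in X and X has a lift cycle anywhere or a frame cycle in
-- that component, or both ends of e lie in components of X with frame cycles. The description rests on
-- rerouting: in a balanced set, whether the cycle closed by e is balanced does not depend on the path used,
-- by the theta condition. It makes closure transitive, which is strong circuit elimination. If F leaves two
-- parallel classes, then either F has a lift cycle and three components (i), or F is balanced with three
-- components (i) or two (ii, iii, iv), or F has frame cycles and exactly two balanced components (iii′, v);
-- the short missing path only enters to see that G, and in the last case the union of the unbalanced
-- components, is connected. Conversely each outcome yields two flats with union E(M) whose differences are
-- parallel classes modulo their intersection.
module Submission where

open import Defs
open import Data.Nat as ℕ using (ℕ; zero; suc; _+_; _≤_; _<_; s≤s)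
import Data.Nat.Properties as ℕₚ
open import Data.Bool using (true; false)
open import Data.Bool.Properties using (∨-zeroʳ)
open import Data.Fin using (Fin; zero; suc; toℕ; fromℕ; fromℕ<; inject₁)
open import Data.Fin.Properties using (any?; all?; toℕ<n; toℕ-injective; toℕ-fromℕ<; toℕ-inject₁; toℕ-fromℕ; suc-injective; fromℕ≢inject₁; injective⇒≤) renaming (_≟_ to _≟ᶠ_)
open import Data.Fin.Subset using (Subset; _∈_; _∉_; _⊆_; _∪_; _∩_; ∁; ⊤; Empty; Nonempty; ⁅_⁆; ∣_∣)
open import Data.Fin.Subset.Properties using (x∈p∪q⁻; x∈p∪q⁺; x∈p∩q⁺; x∈p∩q⁻; x∈⁅x⁆; x∈⁅y⁆⇒x≡y; ⊆-antisym; _∈?_; _⊆?_; p⊂q⇒∣p∣<∣q∣; ∣p∣≤n; ∉⊥; ∈⊤; x∈∁p⇒x∉p; x∉p⇒x∈∁p)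
open import Data.Vec using (tabulate; lookup)
open import Data.Vec.Properties using (lookup∘tabulate; []=⇒lookup; lookup⇒[]=)
open import Data.List using (List; []; _∷_; _++_; allFin)
open import Data.List.Properties using (++-assoc)
open import Data.List.Membership.Propositional using (find; lose) renaming (_∈_ to _∈ˡ_; _∉_ to _∉ˡ_)
open import Data.List.Membership.Propositional.Properties using (∈-++⁺ˡ; ∈-++⁺ʳ; ∈-++⁻; ∈-allFin)
open import Data.List.Relation.Unary.Any as Any using (here; there)
open import Data.Product using (Σ; ∃; ∃-syntax; _×_; _,_; proj₁; proj₂)
open import Data.Sum as Sum using (_⊎_; inj₁; inj₂; [_,_]′)
open import Data.Unit using (tt) renaming (⊤ to Unit)
open import Data.Empty using (⊥; ⊥-elim)
open import Function.Base using (_∘_; id)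
open import Function.Bundles using (_⇔_; mk⇔; Equivalence)
open import Relation.Nullary using (¬_; Dec; does; yes; no; contradiction)
open import Relation.Nullary.Decidable using (dec-true; map′; _×-dec_; _⊎-dec_; _→-dec_; ¬?)
open import Relation.Binary.PropositionalEquality using (_≡_; _≢_; refl; sym; trans; cong; subst)

-- The obstacle is that lift and frame cycles may coexist, so a dependence may act across components
-- in one place and only inside a component in another. The condition that every lift cycle meets
-- every frame cycle enters mostly through one remark: vertex-disjoint unbalanced cycles are of the
-- same kind. An unbalanced cycle that avoids a given frame cycle is therefore a frame cycle, and
-- likewise for lift cycles; this settles most cases of transitivity and most verifications that a
-- set is a flat.
--
-- The argument is constructive. A refutation of unbreakability provides no flat by itself, so every
-- flat and every pair of elements is examined, and each gives a circuit or an outcome. For this,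
-- reachability and the existence of cycles with given properties must be decidable.
--
-- The pair of elements at which unbreakability fails is arbitrary, whereas the partitions in the
-- outcomes are read off well-placed edges. Since M/F has just two parallel classes, any two
-- non-parallel elements may replace the given pair.

-- Finite subsets, extremal subsets and finite search

opaque
  comprehension : ∀ {k} {P : Fin k → Set} → (∀ x → Dec (P x)) → Subset k
  comprehension P? = tabulate (λ x → does (P? x))

  -- Stated for the raw `tabulate` because `image` and `Partition.cell` have this form.
  ∈-tabulate⁺ : ∀ {k} {P : Fin k → Set} (P? : ∀ x → Dec (P x)) {x} → P x → x ∈ tabulate (λ x → does (P? x))
  ∈-tabulate⁺ P? {x} px = lookup⇒[]= x _ (trans (lookup∘tabulate _ x) (dec-true (P? x) px))

  ∈-tabulate⁻ : ∀ {k} {P : Fin k → Set} (P? : ∀ x → Dec (P x)) {x} → x ∈ tabulate (λ x → does (P? x)) → P x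
  ∈-tabulate⁻ P? {x} x∈ with P? x | trans (sym (lookup∘tabulate (λ x → does (P? x)) x)) ([]=⇒lookup x∈)
  ... | yes px | _ = px
  ... | no _ | ()

  ∈-comprehension⁺ : ∀ {k} {P : Fin k → Set} (P? : ∀ x → Dec (P x)) {x} → P x → x ∈ comprehension P?
  ∈-comprehension⁺ = ∈-tabulate⁺

  ∈-comprehension⁻ : ∀ {k} {P : Fin k → Set} (P? : ∀ x → Dec (P x)) {x} → x ∈ comprehension P? → P x
  ∈-comprehension⁻ = ∈-tabulate⁻

∈-image⁺ : ∀ {k N} (f : Fin k → Fin N) i → f i ∈ image f
∈-image⁺ f i = ∈-tabulate⁺ (λ x → any? (λ i → f i ≟ᶠ x)) (i , refl)

∈-image⁻ : ∀ {k N} (f : Fin k → Fin N) {x} → x ∈ image f → ∃[ i ] f i ≡ x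
∈-image⁻ f = ∈-tabulate⁻ (λ x → any? (λ i → f i ≟ᶠ x))

infixl 6 _▸_
opaque
  _▸_ : ∀ {k} → Subset k → Fin k → Subset k
  X ▸ e = X ∪ ⁅ e ⁆

  ▸⁻ : ∀ {k} {X : Subset k} {e f} → f ∈ X ▸ e → f ∈ X ⊎ f ≡ e
  ▸⁻ {X = X} {e} f∈ = Sum.map₂ (x∈⁅y⁆⇒x≡y e) (x∈p∪q⁻ X _ f∈)

  ▸ˡ : ∀ {k} {X : Subset k} {e} → X ⊆ X ▸ e
  ▸ˡ f∈ = x∈p∪q⁺ (inj₁ f∈)

  ▸ʳ : ∀ {k} {X : Subset k} {e} → e ∈ X ▸ e
  ▸ʳ {e = e} = x∈p∪q⁺ (inj₂ (x∈⁅x⁆ e))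

▸-least : ∀ {k} {X Y : Subset k} {e} → X ⊆ Y → e ∈ Y → X ▸ e ⊆ Y
▸-least X⊆Y e∈Y f∈ with ▸⁻ f∈
... | inj₁ f∈X = X⊆Y f∈X
... | inj₂ refl = e∈Y

▸-mono : ∀ {k} {X Y : Subset k} {e} → X ⊆ Y → X ▸ e ⊆ Y ▸ e
▸-mono X⊆Y = ▸-least (λ f∈ → ▸ˡ (X⊆Y f∈)) ▸ʳ

_∈ˡ?_ : ∀ {k} (x : Fin k) (l : List (Fin k)) → Dec (x ∈ˡ l)
x ∈ˡ? l = Any.any? (x ≟ᶠ_) l

-- `cls` takes edge sets, so the kind of a cycle assembled from walks depends only on the list of
-- its edges up to order and repetition.
fromList : ∀ {k} → List (Fin k) → Subset k
fromList l = comprehension (_∈ˡ? l)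

∈-fromList⁺ : ∀ {k} {l : List (Fin k)} {x} → x ∈ˡ l → x ∈ fromList l
∈-fromList⁺ {l = l} = ∈-comprehension⁺ (_∈ˡ? l)

∈-fromList⁻ : ∀ {k} {l : List (Fin k)} {x} → x ∈ fromList l → x ∈ˡ l
∈-fromList⁻ {l = l} = ∈-comprehension⁻ (_∈ˡ? l)

fromList-≡ : ∀ {k} {l : List (Fin k)} {S : Subset k} →
  (∀ {x} → x ∈ S → x ∈ˡ l) → (∀ {x} → x ∈ˡ l → x ∈ S) → S ≡ fromList l
fromList-≡ a b = ⊆-antisym (λ x∈ → ∈-fromList⁺ (a x∈)) (λ x∈ → b (∈-fromList⁻ x∈))

fromList-cong : ∀ {k} {l l′ : List (Fin k)} →
  (∀ {x} → x ∈ˡ l → x ∈ˡ l′) → (∀ {x} → x ∈ˡ l′ → x ∈ˡ l) → fromList l ≡ fromList l′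
fromList-cong a b = fromList-≡ (λ x∈ → a (∈-fromList⁻ x∈)) (λ x∈ → ∈-fromList⁺ (b x∈))

next-inject₁ : ∀ {k} (j : Fin k) → next (inject₁ j) ≡ suc j
next-inject₁ {k} j with toℕ (inject₁ j) ℕ.<? k
... | yes p = toℕ-injective (trans (toℕ-fromℕ< (s≤s p)) (cong suc (toℕ-inject₁ j)))
... | no ¬p = contradiction (subst (_< k) (sym (toℕ-inject₁ j)) (toℕ<n j)) ¬p

next-fromℕ : ∀ k → next (fromℕ k) ≡ zero
next-fromℕ k with toℕ (fromℕ k) ℕ.<? k
... | yes p = contradiction (subst (_< k) (toℕ-fromℕ k) p) (ℕₚ.n≮n k)
... | no _ = refl

-- `next` wraps around exactly at the last index, so statements about cycles split into this index
-- and the embedded ones.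
data LastView {k : ℕ} : Fin (suc k) → Set where
  isLast : LastView (fromℕ k)
  isInject : (j : Fin k) → LastView (inject₁ j)

lastView : ∀ {k} (i : Fin (suc k)) → LastView i
lastView {zero} zero = isLast
lastView {suc k} zero = isInject zero
lastView {suc k} (suc i) with lastView i
... | isLast = isLast
... | isInject j = isInject (suc j)

_◂_ : ∀ {k} → Subset k → Fin k → Subset k
X ◂ e = comprehension (λ f → f ∈? X ×-dec ¬? (f ≟ᶠ e))

◂⁺ : ∀ {k} {X : Subset k} {e f} → f ∈ X → f ≢ e → f ∈ X ◂ e
◂⁺ {X = X} {e} f∈ f≢ = ∈-comprehension⁺ (λ f → f ∈? X ×-dec ¬? (f ≟ᶠ e)) (f∈ , f≢)

◂⁻ : ∀ {k} {X : Subset k} {e f} → f ∈ X ◂ e → f ∈ X × f ≢ e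
◂⁻ {X = X} {e} f∈ = ∈-comprehension⁻ (λ f → f ∈? X ×-dec ¬? (f ≟ᶠ e)) f∈

opaque
  -- Q is arbitrary, hence maximality against single insertions only. Under the invariant
  -- `k ≤ ∣ A ∣ + fuel` the fuel can be exhausted only when A is already full.
  grow : ∀ {k} {Q : Subset k → Set} → (∀ A → Dec (Q A)) → ∀ {A} → Q A →
    ∃[ B ] (A ⊆ B × Q B × (∀ {e} → e ∉ B → ¬ Q (B ▸ e)))
  grow {k} {Q} Q? {A} qA = go k A qA (ℕₚ.m≤n+m k ∣ A ∣)
    where
    go : ∀ fuel A → Q A → k ≤ ∣ A ∣ + fuel → ∃[ B ] (A ⊆ B × Q B × (∀ {e} → e ∉ B → ¬ Q (B ▸ e)))
    go fuel A qA le with any? (λ e → ¬? (e ∈? A) ×-dec Q? (A ▸ e))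
    go fuel A qA le | no ¬a = A , id , qA , λ e∉ q → ¬a (_ , e∉ , q)
    go zero A qA le | yes (e , e∉ , q) = contradiction
      (ℕₚ.<-≤-trans (p⊂q⇒∣p∣<∣q∣ (▸ˡ , e , ▸ʳ , e∉)) (ℕₚ.≤-trans (∣p∣≤n (A ▸ e)) (subst (k ≤_) (ℕₚ.+-identityʳ _) le)))
      (ℕₚ.n≮n _)
    go (suc fuel) A qA le | yes (e , e∉ , q)
      with B , sub , qB , mx ← go fuel (A ▸ e) q (ℕₚ.≤-trans le
             (subst (_≤ ∣ A ▸ e ∣ + fuel) (sym (ℕₚ.+-suc _ _)) (ℕₚ.+-monoˡ-≤ fuel (p⊂q⇒∣p∣<∣q∣ (▸ˡ , e , ▸ʳ , e∉)))))
      = B , (λ x∈ → sub (▸ˡ x∈)) , qB , mx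

opaque
  shrink : ∀ {k} {Q : Subset k → Set} → (∀ A → Dec (Q A)) → ∀ {A} → Q A →
    ∃[ B ] (B ⊆ A × Q B × (∀ {e} → e ∈ B → ¬ Q (B ◂ e)))
  shrink {k} {Q} Q? {A} qA = go (suc ∣ A ∣) A qA ℕₚ.≤-refl
    where
    go : ∀ fuel A → Q A → ∣ A ∣ < fuel → ∃[ B ] (B ⊆ A × Q B × (∀ {e} → e ∈ B → ¬ Q (B ◂ e)))
    go zero A qA ()
    go (suc fuel) A qA le with any? (λ e → (e ∈? A) ×-dec Q? (A ◂ e))
    ... | no ¬a = A , id , qA , λ e∈ q → ¬a (_ , e∈ , q)
    ... | yes (e , e∈ , q)
      with B , sub , qB , mn ← go fuel (A ◂ e) q (ℕₚ.≤-trans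
             (p⊂q⇒∣p∣<∣q∣ ((λ x∈ → proj₁ (◂⁻ x∈)) , e , e∈ , λ e∈′ → proj₂ (◂⁻ e∈′) refl)) (ℕₚ.≤-pred le))
      = B , (λ x∈ → proj₁ (◂⁻ (sub x∈))) , qB , mn

-- X is rebuilt by inserting its elements along `allFin k`; `resp` identifies the rebuilt set with
-- X.
subset-induction : ∀ {k} (P : Subset k → Set) → (∀ {X Y} → X ⊆ Y → Y ⊆ X → P X → P Y) →
  (∀ {X} → Empty X → P X) → (∀ X e → P X → P (X ▸ e)) → ∀ X → P X
subset-induction {k} P resp base ins X =
  resp (λ x∈ → proj₁ (∈-comprehension⁻ (restr? (allFin k)) x∈)) (λ x∈ → ∈-comprehension⁺ (restr? (allFin k)) (x∈ , ∈-allFin _)) (go (allFin k))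
  where
  restr? : ∀ (l : List (Fin k)) x → Dec (x ∈ X × x ∈ˡ l)
  restr? l x = x ∈? X ×-dec (x ∈ˡ? l)
  go : ∀ l → P (comprehension (restr? l))
  go [] = base λ { (x , x∈) → case (proj₂ (∈-comprehension⁻ (restr? []) x∈)) }
    where
    case : ∀ {x} → x ∈ˡ [] → ⊥
    case ()
  go (e ∷ l) with e ∈? X
  ... | yes e∈ = resp (▸-least fwd (∈-comprehension⁺ (restr? (e ∷ l)) (e∈ , here refl))) bwd (ins _ e (go l))
    where
    fwd : comprehension (restr? l) ⊆ comprehension (restr? (e ∷ l))
    fwd x∈ with x∈X , x∈l ← ∈-comprehension⁻ (restr? l) x∈ = ∈-comprehension⁺ (restr? (e ∷ l)) (x∈X , there x∈l)
    bwd : comprehension (restr? (e ∷ l)) ⊆ comprehension (restr? l) ▸ e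
    bwd x∈ with ∈-comprehension⁻ (restr? (e ∷ l)) x∈
    ... | _ , here refl = ▸ʳ
    ... | x∈X , there x∈l = ▸ˡ (∈-comprehension⁺ (restr? l) (x∈X , x∈l))
  ... | no e∉ = resp fwd bwd (go l)
    where
    fwd : comprehension (restr? l) ⊆ comprehension (restr? (e ∷ l))
    fwd x∈ with x∈X , x∈l ← ∈-comprehension⁻ (restr? l) x∈ = ∈-comprehension⁺ (restr? (e ∷ l)) (x∈X , there x∈l)
    bwd : comprehension (restr? (e ∷ l)) ⊆ comprehension (restr? l)
    bwd x∈ with ∈-comprehension⁻ (restr? (e ∷ l)) x∈
    ... | x∈X , here refl = contradiction x∈X e∉
    ... | x∈X , there x∈l = ∈-comprehension⁺ (restr? l) (x∈X , x∈l)

consᶠ : ∀ {k} {A : Set} → A → (Fin k → A) → Fin (suc k) → A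
consᶠ x f zero = x
consᶠ x f (suc i) = f i

-- A function is searched value by value and reassembled by `consᶠ`, which agrees with the original
-- only pointwise; P must therefore respect pointwise equality.
anyFunction? : ∀ {N} k (P : (Fin k → Fin N) → Set) → (∀ f → Dec (P f)) →
  (∀ {f g} → (∀ i → f i ≡ g i) → P f → P g) → Dec (∃ P)
anyFunction? zero P P? resp = map′ (_ ,_) (λ { (f , pf) → resp (λ ()) pf }) (P? λ ())
anyFunction? (suc k) P P? resp = map′
  (λ { (x , f , pf) → consᶠ x f , pf })
  (λ { (f , pf) → f zero , (f ∘ suc) , resp (λ { zero → refl ; (suc i) → refl }) pf })
  (any? λ x → anyFunction? k (P ∘ consᶠ x) (P? ∘ consᶠ x) (λ eq → resp λ { zero → refl ; (suc i) → eq i }))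

image-cong : ∀ {k N} {f g : Fin k → Fin N} → (∀ i → f i ≡ g i) → image f ≡ image g
image-cong {f = f} {g} eq = ⊆-antisym (sub eq) (sub (sym ∘ eq))
  where
  sub : ∀ {f g} → (∀ i → f i ≡ g i) → image f ⊆ image g
  sub {f} {g} eq x∈ with ∈-image⁻ f x∈
  ... | i , refl = subst (_∈ image g) (sym (eq i)) (∈-image⁺ g i)

bal? : (k : Kind) → Dec (k ≡ bal)
bal? bal = yes refl
bal? lft = no λ ()
bal? frm = no λ ()

_⊑_ : ∀ {k} → List (Fin k) → List (Fin k) → Set
l ⊑ l′ = ∀ {x} → x ∈ˡ l → x ∈ˡ l′

++-⊑ : ∀ {k} {l₁ l₂ l : List (Fin k)} → l₁ ⊑ l → l₂ ⊑ l → (l₁ ++ l₂) ⊑ l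
++-⊑ {l₁ = l₁} a b x∈ = [ a , b ]′ (∈-++⁻ l₁ x∈)

∷-⊑ : ∀ {k} {y : Fin k} {l₁ l : List (Fin k)} → y ∈ˡ l → l₁ ⊑ l → (y ∷ l₁) ⊑ l
∷-⊑ a b (here refl) = a
∷-⊑ a b (there x∈) = b x∈

-- Turns a pointwise alternative on a finite domain into a global one. This replaces excluded middle
-- where the failure of a universal statement has to produce a witness.
allFin-or : ∀ {k} {P : Fin k → Set} {O : Set} → (∀ i → P i ⊎ O) → (∀ i → P i) ⊎ O
allFin-or {zero} h = inj₁ λ ()
allFin-or {suc k} h with h zero | allFin-or (h ∘ suc)
... | inj₁ p | inj₁ ps = inj₁ λ { zero → p ; (suc i) → ps i }
... | inj₂ o | _ = inj₂ o
... | inj₁ _ | inj₂ o = inj₂ o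

allSubset-or : ∀ {k} {P : Subset k → Set} {O : Set} → (∀ X → P X ⊎ O) → (∀ X → P X) ⊎ O
allSubset-or {zero} h with h Data.Vec.[]
... | inj₁ p = inj₁ λ { Data.Vec.[] → p }
... | inj₂ o = inj₂ o
allSubset-or {suc k} h with allSubset-or (λ X → h (true Data.Vec.∷ X)) | allSubset-or (λ X → h (false Data.Vec.∷ X))
... | inj₁ p | inj₁ q = inj₁ λ { (true Data.Vec.∷ X) → p X ; (false Data.Vec.∷ X) → q X }
... | inj₂ o | _ = inj₂ o
... | inj₁ _ | inj₂ o = inj₂ o

-- The missing path: at most two nonadjacent pairs, and these share a vertex

SamePair : ∀ {n} → Fin n → Fin n → Fin n → Fin n → Set
SamePair a b c d = (a ≡ c × b ≡ d) ⊎ (a ≡ d × b ≡ c)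

module _ {n : ℕ} (P : SmallPath n) where
  open SmallPath P

  pathPair? : ∀ u v → Dec (PathPair P u v)
  pathPair? u v = any? λ i → (u ≟ᶠ pv (inject₁ i) ×-dec v ≟ᶠ pv (suc i)) ⊎-dec (v ≟ᶠ pv (inject₁ i) ×-dec u ≟ᶠ pv (suc i))

  same-index : ∀ {a b c d} ((i , _) : PathPair P a b) ((j , _) : PathPair P c d) → i ≡ j → SamePair a b c d
  same-index (i , inj₁ (refl , refl)) (_ , inj₁ (refl , refl)) refl = inj₁ (refl , refl)
  same-index (i , inj₁ (refl , refl)) (_ , inj₂ (refl , refl)) refl = inj₂ (refl , refl)
  same-index (i , inj₂ (refl , refl)) (_ , inj₁ (refl , refl)) refl = inj₂ (refl , refl)
  same-index (i , inj₂ (refl , refl)) (_ , inj₂ (refl , refl)) refl = inj₁ (refl , refl)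

  -- Pigeonhole: three distinct indices would inject `Fin 3` into the at most two edges of the path.
  three-pairs : ∀ {a b c d e f} → PathPair P a b → PathPair P c d → PathPair P e f →
    SamePair a b c d ⊎ SamePair a b e f ⊎ SamePair c d e f
  three-pairs p@(i , _) q@(j , _) r@(k , _) with i ≟ᶠ j | i ≟ᶠ k | j ≟ᶠ k
  ... | yes eq | _ | _ = inj₁ (same-index p q eq)
  ... | no _ | yes eq | _ = inj₂ (inj₁ (same-index p r eq))
  ... | no _ | no _ | yes eq = inj₂ (inj₂ (same-index q r eq))
  ... | no i≢j | no i≢k | no j≢k = contradiction (injective⇒≤ {f = idx} idx-inj) (ℕₚ.<⇒≱ (s≤s len≤2))
    where
    idx : Fin 3 → Fin len
    idx zero = i
    idx (suc zero) = j
    idx (suc (suc zero)) = k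
    idx-inj : ∀ {x y} → idx x ≡ idx y → x ≡ y
    idx-inj {zero} {zero} _ = refl
    idx-inj {zero} {suc zero} eq = contradiction eq i≢j
    idx-inj {zero} {suc (suc zero)} eq = contradiction eq i≢k
    idx-inj {suc zero} {zero} eq = contradiction (sym eq) i≢j
    idx-inj {suc zero} {suc zero} _ = refl
    idx-inj {suc zero} {suc (suc zero)} eq = contradiction eq j≢k
    idx-inj {suc (suc zero)} {zero} eq = contradiction (sym eq) i≢k
    idx-inj {suc (suc zero)} {suc zero} eq = contradiction (sym eq) j≢k
    idx-inj {suc (suc zero)} {suc (suc zero)} _ = refl

private
  -- Two distinct edges of such a path are its first and its second, which share the middle vertex;
  -- the order of i and j decides the alternative.
  consecutive : ∀ {n} (P : SmallPath n) (i j : Fin (SmallPath.len P)) → i ≢ j →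
    let open SmallPath P in pv (suc i) ≡ pv (inject₁ j) ⊎ pv (inject₁ i) ≡ pv (suc j)
  consecutive record { len = suc zero } zero zero i≢j = contradiction refl i≢j
  consecutive record { len = suc (suc zero) } zero zero i≢j = contradiction refl i≢j
  consecutive record { len = suc (suc zero) } zero (suc zero) i≢j = inj₁ refl
  consecutive record { len = suc (suc zero) } (suc zero) zero i≢j = inj₂ refl
  consecutive record { len = suc (suc zero) } (suc zero) (suc zero) i≢j = contradiction refl i≢j
  consecutive record { len = suc (suc (suc _)) ; len≤2 = s≤s (s≤s ()) } _ _ _

pairs-share : ∀ {n} (P : SmallPath n) {a b c d} → PathPair P a b → PathPair P c d → a ≡ c ⊎ a ≡ d ⊎ b ≡ c ⊎ b ≡ d
pairs-share P p@(i , _) q@(j , _) with i ≟ᶠ j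
... | yes eq = [ (λ z → inj₁ (proj₁ z)) , (λ z → inj₂ (inj₁ (proj₁ z))) ]′ (same-index P p q eq)
pairs-share P (i , inj₁ (refl , refl)) (j , inj₁ (refl , refl)) | no i≢j =
  [ (λ z → inj₂ (inj₂ (inj₁ z))) , (λ z → inj₂ (inj₁ z)) ]′ (consecutive P i j i≢j)
pairs-share P (i , inj₁ (refl , refl)) (j , inj₂ (refl , refl)) | no i≢j =
  [ (λ z → inj₂ (inj₂ (inj₂ z))) , inj₁ ]′ (consecutive P i j i≢j)
pairs-share P (i , inj₂ (refl , refl)) (j , inj₁ (refl , refl)) | no i≢j =
  [ inj₁ , (λ z → inj₂ (inj₂ (inj₂ z))) ]′ (consecutive P i j i≢j)
pairs-share P (i , inj₂ (refl , refl)) (j , inj₂ (refl , refl)) | no i≢j =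
  [ (λ z → inj₂ (inj₁ z)) , (λ z → inj₂ (inj₂ (inj₁ z))) ]′ (consecutive P i j i≢j)

fresh : ∀ {n} → 3 < n → (x y z : Fin n) → ∃[ w ] (w ≢ x × w ≢ y × w ≢ z)
fresh {n} lt x y z with any? (λ w → ¬? (w ≟ᶠ x) ×-dec (¬? (w ≟ᶠ y) ×-dec ¬? (w ≟ᶠ z)))
... | yes r = r
... | no none = contradiction (injective⇒≤ {f = tag} tag-inj) (ℕₚ.<⇒≱ lt)
  where
  -- If x, y and z exhausted the vertices, `tag` would inject `Fin n` into `Fin 3`.
  tag : Fin n → Fin 3
  tag w with w ≟ᶠ x | w ≟ᶠ y
  ... | yes _ | _ = zero
  ... | no _ | yes _ = suc zero
  ... | no _ | no _ = suc (suc zero)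
  value : Fin 3 → Fin n
  value zero = x
  value (suc zero) = y
  value (suc (suc zero)) = z
  value-tag : ∀ w → value (tag w) ≡ w
  value-tag w with w ≟ᶠ x | w ≟ᶠ y | w ≟ᶠ z
  ... | yes refl | _ | _ = refl
  ... | no _ | yes refl | _ = refl
  ... | no _ | no _ | yes refl = refl
  ... | no a | no b | no c = contradiction (w , a , b , c) none
  tag-inj : ∀ {v w} → tag v ≡ tag w → v ≡ w
  tag-inj {v} {w} eq = trans (sym (value-tag v)) (trans (cong value eq) (value-tag w))

pattern 0F = zero
pattern 1F = suc zero
pattern 2F = suc (suc zero)

differ : ∀ {k} {a i j : Fin k} → a ≡ i → i ≢ j → a ≢ j
differ a≡i i≢j a≡j = i≢j (trans (sym a≡i) a≡j)

third : ∀ {i : Fin 3} → i ≢ 0F → i ≢ 1F → i ≡ 2F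
third {0F} a b = contradiction refl a
third {1F} a b = contradiction refl b
third {2F} a b = refl

other : ∀ {i : Fin 2} → i ≢ 0F → i ≡ 1F
other {0F} a = contradiction refl a
other {1F} a = refl

module GraphTheory {n m : ℕ} (G : Graph n m) where

  flipJ : ∀ {e a b} → Joins G e a b → Joins G e b a
  flipJ (inj₁ x) = inj₂ x
  flipJ (inj₂ x) = inj₁ x

  joins-unique : ∀ {e a b c d} → Joins G e a b → Joins G e c d → (a ≡ c × b ≡ d) ⊎ (a ≡ d × b ≡ c)
  joins-unique (inj₁ p) (inj₁ q) with refl ← trans (sym p) q = inj₁ (refl , refl)
  joins-unique (inj₁ p) (inj₂ q) with refl ← trans (sym p) q = inj₂ (refl , refl)
  joins-unique (inj₂ p) (inj₁ q) with refl ← trans (sym p) q = inj₂ (refl , refl)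
  joins-unique (inj₂ p) (inj₂ q) with refl ← trans (sym p) q = inj₁ (refl , refl)

  joins-target : ∀ {e a b c} → Joins G e a b → Joins G e a c → b ≡ c
  joins-target j k with joins-unique j k
  ... | inj₁ (_ , q) = q
  ... | inj₂ (refl , refl) = refl

  -- Walks and cycles

  -- Indexed by its ends, so that cutting and joining are structural; the records `Path` and `Cycle`
  -- are reached by conversion only.
  data Walk : Fin n → Fin n → Set where
    []   : ∀ {u} → Walk u u
    cons : ∀ {u w v} (e : Fin m) → Joins G e u w → Walk w v → Walk u v

  -- All vertices but the first: `verts p` is then a cons even for a variable p, and membership of
  -- the start holds by `here refl`.
  later : ∀ {u v} → Walk u v → List (Fin n)
  later [] = []
  later (cons {w = w} e j p) = w ∷ later p

  verts : ∀ {u v} → Walk u v → List (Fin n)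
  verts {u} p = u ∷ later p

  edges : ∀ {u v} → Walk u v → List (Fin m)
  edges [] = []
  edges (cons e _ p) = e ∷ edges p

  infixr 5 _⊕_
  _⊕_ : ∀ {u w v} → Walk u w → Walk w v → Walk u v
  [] ⊕ q = q
  cons e j p ⊕ q = cons e j (p ⊕ q)

  start∈ : ∀ {u v} (p : Walk u v) → u ∈ˡ verts p
  start∈ p = here refl

  end∈ : ∀ {u v} (p : Walk u v) → v ∈ˡ verts p
  end∈ [] = here refl
  end∈ (cons e j p) = there (end∈ p)

  verts-⊕⁻ : ∀ {u w v} (p : Walk u w) (q : Walk w v) {x} → x ∈ˡ verts (p ⊕ q) → x ∈ˡ verts p ⊎ x ∈ˡ verts q
  verts-⊕⁻ [] q x∈ = inj₂ x∈
  verts-⊕⁻ (cons e j p) q (here eq) = inj₁ (here eq)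
  verts-⊕⁻ (cons e j p) q (there x∈) = Sum.map₁ there (verts-⊕⁻ p q x∈)

  verts-⊕ʳ : ∀ {u w v} (p : Walk u w) (q : Walk w v) {x} → x ∈ˡ verts q → x ∈ˡ verts (p ⊕ q)
  verts-⊕ʳ [] q x∈ = x∈
  verts-⊕ʳ (cons e j p) q x∈ = there (verts-⊕ʳ p q x∈)

  verts-⊕ˡ : ∀ {u w v} (p : Walk u w) (q : Walk w v) {x} → x ∈ˡ verts p → x ∈ˡ verts (p ⊕ q)
  verts-⊕ˡ [] q (here refl) = here refl
  verts-⊕ˡ (cons e j p) q (here eq) = here eq
  verts-⊕ˡ (cons e j p) q (there x∈) = there (verts-⊕ˡ p q x∈)

  edges-⊕ : ∀ {u w v} (p : Walk u w) (q : Walk w v) → edges (p ⊕ q) ≡ edges p ++ edges q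
  edges-⊕ [] q = refl
  edges-⊕ (cons e j p) q = cong (e ∷_) (edges-⊕ p q)

  edges-⊕⁻ : ∀ {u w v} (p : Walk u w) (q : Walk w v) {x} → x ∈ˡ edges (p ⊕ q) → x ∈ˡ edges p ⊎ x ∈ˡ edges q
  edges-⊕⁻ p q x∈ = ∈-++⁻ (edges p) (subst (_ ∈ˡ_) (edges-⊕ p q) x∈)

  edges-⊕ˡ : ∀ {u w v} (p : Walk u w) (q : Walk w v) {x} → x ∈ˡ edges p → x ∈ˡ edges (p ⊕ q)
  edges-⊕ˡ p q x∈ = subst (_ ∈ˡ_) (sym (edges-⊕ p q)) (∈-++⁺ˡ x∈)

  edges-⊕ʳ : ∀ {u w v} (p : Walk u w) (q : Walk w v) {x} → x ∈ˡ edges q → x ∈ˡ edges (p ⊕ q)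
  edges-⊕ʳ p q x∈ = subst (_ ∈ˡ_) (sym (edges-⊕ p q)) (∈-++⁺ʳ (edges p) x∈)

  rev : ∀ {u v} → Walk u v → Walk v u
  rev [] = []
  rev (cons e j p) = rev p ⊕ cons e (flipJ j) []

  verts-rev⁻ : ∀ {u v} (p : Walk u v) {x} → x ∈ˡ verts (rev p) → x ∈ˡ verts p
  verts-rev⁻ [] x∈ = x∈
  verts-rev⁻ (cons e j p) x∈ with verts-⊕⁻ (rev p) _ x∈
  ... | inj₁ y = there (verts-rev⁻ p y)
  ... | inj₂ (here refl) = there (here refl)
  ... | inj₂ (there (here refl)) = here refl

  verts-rev⁺ : ∀ {u v} (p : Walk u v) {x} → x ∈ˡ verts p → x ∈ˡ verts (rev p)
  verts-rev⁺ [] x∈ = x∈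
  verts-rev⁺ (cons e j p) (here refl) = verts-⊕ʳ (rev p) _ (there (here refl))
  verts-rev⁺ (cons e j p) (there x∈) = verts-⊕ˡ (rev p) _ (verts-rev⁺ p x∈)

  edges-rev⁻ : ∀ {u v} (p : Walk u v) {x} → x ∈ˡ edges (rev p) → x ∈ˡ edges p
  edges-rev⁻ (cons e j p) x∈ with edges-⊕⁻ (rev p) _ x∈
  ... | inj₁ y = there (edges-rev⁻ p y)
  ... | inj₂ (here refl) = here refl

  edges-rev⁺ : ∀ {u v} (p : Walk u v) {x} → x ∈ˡ edges p → x ∈ˡ edges (rev p)
  edges-rev⁺ (cons e j p) (here refl) = edges-⊕ʳ (rev p) _ (here refl)
  edges-rev⁺ (cons e j p) (there x∈) = edges-⊕ˡ (rev p) _ (edges-rev⁺ p x∈)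

  -- Only the vertices are required to be distinct. The edges then are too, since a repeated edge
  -- repeats its ends (`first-edge∉`).
  Simple : ∀ {u v} → Walk u v → Set
  Simple [] = Unit
  Simple (cons {u = u} e j p) = u ∉ˡ verts p × Simple p

  simple-⊕ : ∀ {u w v} (p : Walk u w) (q : Walk w v) → Simple p → Simple q →
    (∀ {x} → x ∈ˡ verts p → x ∈ˡ verts q → x ≡ w) → Simple (p ⊕ q)
  simple-⊕ [] q sp sq d = sq
  simple-⊕ (cons {u = u} e j p) q (u∉ , sp) sq d =
    (λ u∈ → [ u∉ , (λ u∈q → u∉ (subst (_∈ˡ verts p) (sym (d (here refl) u∈q)) (end∈ p))) ]′ (verts-⊕⁻ p q u∈))
    , simple-⊕ p q sp sq (λ x∈ → d (there x∈))

  simple-⊕ˡ : ∀ {u w v} (p : Walk u w) (q : Walk w v) → Simple (p ⊕ q) → Simple p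
  simple-⊕ˡ [] q s = tt
  simple-⊕ˡ (cons e j p) q (u∉ , s) = (λ u∈ → u∉ (verts-⊕ˡ p q u∈)) , simple-⊕ˡ p q s

  simple-⊕ʳ : ∀ {u w v} (p : Walk u w) (q : Walk w v) → Simple (p ⊕ q) → Simple q
  simple-⊕ʳ [] q s = s
  simple-⊕ʳ (cons e j p) q (_ , s) = simple-⊕ʳ p q s

  simple-overlap : ∀ {u w v} (p : Walk u w) (q : Walk w v) → Simple (p ⊕ q) →
    ∀ {x} → x ∈ˡ verts p → x ∈ˡ verts q → x ≡ w
  simple-overlap [] q s (here refl) y = refl
  simple-overlap (cons e j p) q (u∉ , s) (here refl) y = contradiction (verts-⊕ʳ p q y) u∉
  simple-overlap (cons e j p) q (u∉ , s) (there x) y = simple-overlap p q s x y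

  simple-rev : ∀ {u v} (p : Walk u v) → Simple p → Simple (rev p)
  simple-rev [] s = tt
  simple-rev (cons {u} {w} e j p) (u∉ , s) = simple-⊕ (rev p) _ (simple-rev p s)
    ((λ { (here refl) → u∉ (start∈ p) }) , tt)
    λ { x∈ (here refl) → refl ; x∈ (there (here refl)) → contradiction (verts-rev⁻ p x∈) u∉ }

  edge-ends : ∀ {u v} (p : Walk u v) {f a b} → f ∈ˡ edges p → Joins G f a b → a ∈ˡ verts p × b ∈ˡ verts p
  edge-ends (cons e j p) (here refl) k with joins-unique j k
  ... | inj₁ (refl , refl) = here refl , there (start∈ p)
  ... | inj₂ (refl , refl) = there (start∈ p) , here refl
  edge-ends (cons e j p) (there f∈) k = there (proj₁ (edge-ends p f∈ k)) , there (proj₂ (edge-ends p f∈ k))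

  first-edge∉ : ∀ {u w v e} {j : Joins G e u w} (p : Walk w v) → u ∉ˡ verts p → e ∉ˡ edges p
  first-edge∉ {j = j} p u∉ e∈ = u∉ (proj₁ (edge-ends p e∈ j))

  simple-ends≢ : ∀ {u v} (p : Walk u v) {f a b} → Simple p → f ∈ˡ edges p → Joins G f a b → a ≢ b
  simple-ends≢ (cons e j p) (u∉ , s) (here refl) k refl with joins-unique j k
  ... | inj₁ (refl , refl) = u∉ (start∈ p)
  ... | inj₂ (refl , refl) = u∉ (start∈ p)
  simple-ends≢ (cons e j p) (u∉ , s) (there f∈) k = simple-ends≢ p s f∈ k

  simple-closed : ∀ {u} (p : Walk u u) → Simple p → p ≡ []
  simple-closed [] s = refl
  simple-closed (cons e j p) (u∉ , s) = contradiction (end∈ p) u∉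

  opaque
    split-vertex : ∀ {u v} (p : Walk u v) {x} → x ∈ˡ verts p → Σ (Walk u x) λ p₁ → Σ (Walk x v) λ p₂ → p ≡ p₁ ⊕ p₂
    split-vertex p (here refl) = [] , p , refl
    split-vertex (cons e j p) (there x∈) with split-vertex p x∈
    ... | p₁ , p₂ , refl = cons e j p₁ , p₂ , refl

  opaque
    split-edge : ∀ {u v} (p : Walk u v) {f} → f ∈ˡ edges p →
      ∃[ a ] ∃[ b ] Σ (Walk u a) λ p₁ → Σ (Joins G f a b) λ j → Σ (Walk b v) λ p₂ → p ≡ p₁ ⊕ cons f j p₂
    split-edge (cons e j p) (here refl) = _ , _ , [] , j , p , refl
    split-edge (cons e j p) (there f∈) with split-edge p f∈
    ... | a , b , p₁ , k , p₂ , refl = a , b , cons e j p₁ , k , p₂ , refl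

  opaque
    first-hit : ∀ {u v} {P : Fin n → Set} (P? : ∀ x → Dec (P x)) (p : Walk u v) {y} → y ∈ˡ verts p → P y →
      ∃[ x ] Σ (Walk u x) λ p₁ → Σ (Walk x v) λ p₂ →
        p ≡ p₁ ⊕ p₂ × P x × (∀ {z} → z ∈ˡ verts p₁ → P z → z ≡ x)
    first-hit {u} P? p y∈ py with P? u
    ... | yes pu = u , [] , p , refl , pu , λ { (here refl) _ → refl }
    first-hit P? p (here refl) py | no ¬pu = contradiction py ¬pu
    first-hit P? (cons e j p) (there y∈) py | no ¬pu with first-hit P? p y∈ py
    ... | x , p₁ , p₂ , refl , px , h = x , cons e j p₁ , p₂ , refl , px ,
          λ { (here refl) pz → contradiction pz ¬pu ; (there z∈) pz → h z∈ pz }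

  opaque
    last-hit : ∀ {u v} {P : Fin n → Set} (P? : ∀ x → Dec (P x)) (p : Walk u v) {y} → y ∈ˡ verts p → P y →
      ∃[ x ] Σ (Walk u x) λ p₁ → Σ (Walk x v) λ p₂ →
        p ≡ p₁ ⊕ p₂ × P x × (∀ {z} → z ∈ˡ verts p₂ → P z → z ≡ x)
    last-hit P? [] (here refl) py = _ , [] , [] , refl , py , λ { (here refl) _ → refl }
    last-hit P? (cons e j p) y∈ py with Any.any? P? (verts p)
    last-hit P? (cons e j p) y∈ py | yes a with find a
    ... | x′ , x′∈ , px′ with last-hit P? p x′∈ px′
    ... | x , p₁ , p₂ , refl , px , h = x , cons e j p₁ , p₂ , refl , px , h
    last-hit P? (cons e j p) (there y∈) py | no ¬a = contradiction (lose y∈ py) ¬a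
    last-hit P? (cons e j p) (here refl) py | no ¬a = _ , [] , cons e j p , refl , py ,
      λ { (here refl) _ → refl ; (there z∈) pz → contradiction (lose z∈ pz) ¬a }

  len : ∀ {u v} → Walk u v → ℕ
  len [] = 0
  len (cons _ _ p) = suc (len p)

  vertexAt : ∀ {u v} (p : Walk u v) → Fin (suc (len p)) → Fin n
  vertexAt {u} p zero = u
  vertexAt (cons e j p) (suc i) = vertexAt p i

  edgeAt : ∀ {u v} (p : Walk u v) → Fin (len p) → Fin m
  edgeAt (cons e j p) zero = e
  edgeAt (cons e j p) (suc i) = edgeAt p i

  vertexAt∈ : ∀ {u v} (p : Walk u v) i → vertexAt p i ∈ˡ verts p
  vertexAt∈ p zero = here refl
  vertexAt∈ (cons e j p) (suc i) = there (vertexAt∈ p i)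

  ∈vertexAt : ∀ {u v} (p : Walk u v) {x} → x ∈ˡ verts p → ∃[ i ] vertexAt p i ≡ x
  ∈vertexAt p (here refl) = zero , refl
  ∈vertexAt (cons e j p) (there x∈) with ∈vertexAt p x∈
  ... | i , eq = suc i , eq

  edgeAt∈ : ∀ {u v} (p : Walk u v) i → edgeAt p i ∈ˡ edges p
  edgeAt∈ (cons e j p) zero = here refl
  edgeAt∈ (cons e j p) (suc i) = there (edgeAt∈ p i)

  ∈edgeAt : ∀ {u v} (p : Walk u v) {x} → x ∈ˡ edges p → ∃[ i ] edgeAt p i ≡ x
  ∈edgeAt (cons e j p) (here refl) = zero , refl
  ∈edgeAt (cons e j p) (there x∈) with ∈edgeAt p x∈
  ... | i , eq = suc i , eq

  vertexAt-inj : ∀ {u v} (p : Walk u v) → Simple p → ∀ {i k} → vertexAt p i ≡ vertexAt p k → i ≡ k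
  vertexAt-inj p s {zero} {zero} eq = refl
  vertexAt-inj (cons e j p) (u∉ , s) {zero} {suc k} eq = contradiction (subst (_∈ˡ verts p) (sym eq) (vertexAt∈ p k)) u∉
  vertexAt-inj (cons e j p) (u∉ , s) {suc i} {zero} eq = contradiction (subst (_∈ˡ verts p) eq (vertexAt∈ p i)) u∉
  vertexAt-inj (cons e j p) (u∉ , s) {suc i} {suc k} eq = cong suc (vertexAt-inj p s eq)

  edgeAt-inj : ∀ {u v} (p : Walk u v) → Simple p → ∀ {i k} → edgeAt p i ≡ edgeAt p k → i ≡ k
  edgeAt-inj (cons e j p) s {zero} {zero} eq = refl
  edgeAt-inj (cons e j p) (u∉ , s) {zero} {suc k} eq =
    contradiction (subst (_∈ˡ edges p) (sym eq) (edgeAt∈ p k)) (first-edge∉ {j = j} p u∉)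
  edgeAt-inj (cons e j p) (u∉ , s) {suc i} {zero} eq =
    contradiction (subst (_∈ˡ edges p) eq (edgeAt∈ p i)) (first-edge∉ {j = j} p u∉)
  edgeAt-inj (cons e j p) (u∉ , s) {suc i} {suc k} eq = cong suc (edgeAt-inj p s eq)

  vertexAt-last : ∀ {u v} (p : Walk u v) → vertexAt p (fromℕ (len p)) ≡ v
  vertexAt-last [] = refl
  vertexAt-last (cons e j p) = vertexAt-last p

  edgeAt-joins : ∀ {u v} (p : Walk u v) i → Joins G (edgeAt p i) (vertexAt p (inject₁ i)) (vertexAt p (suc i))
  edgeAt-joins (cons e j p) zero = j
  edgeAt-joins (cons e j p) (suc i) = edgeAt-joins p i

  toPath : ∀ {u v} (p : Walk u v) → Simple p → Path G
  toPath p s = record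
    { len = len p ; vtx = vertexAt p ; edg = edgeAt p
    ; vtx-inj = vertexAt-inj p s ; edg-inj = edgeAt-inj p s ; joins = edgeAt-joins p }

  toPath-E⁺ : ∀ {u v} (p : Walk u v) (s : Simple p) {f} → f ∈ˡ edges p → f ∈ Path.E (toPath p s)
  toPath-E⁺ p s f∈ with ∈edgeAt p f∈
  ... | i , refl = ∈-image⁺ (edgeAt p) i

  toPath-E⁻ : ∀ {u v} (p : Walk u v) (s : Simple p) {f} → f ∈ Path.E (toPath p s) → f ∈ˡ edges p
  toPath-E⁻ p s f∈ with ∈-image⁻ (edgeAt p) f∈
  ... | i , refl = edgeAt∈ p i

  toPath-V⁻ : ∀ {u v} (p : Walk u v) (s : Simple p) {x} → x ∈ Path.V (toPath p s) → x ∈ˡ verts p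
  toPath-V⁻ p s x∈ with ∈-image⁻ (vertexAt p) x∈
  ... | i , refl = vertexAt∈ p i

  -- The closing edge d gets the last index, where `next` returns to the start.
  closedEdgeAt : ∀ {u v} (p : Walk u v) → Fin m → Fin (suc (len p)) → Fin m
  closedEdgeAt [] d zero = d
  closedEdgeAt (cons e j p) d zero = e
  closedEdgeAt (cons e j p) d (suc i) = closedEdgeAt p d i

  closedEdgeAt-inject₁ : ∀ {u v} (p : Walk u v) d i → closedEdgeAt p d (inject₁ i) ≡ edgeAt p i
  closedEdgeAt-inject₁ (cons e j p) d zero = refl
  closedEdgeAt-inject₁ (cons e j p) d (suc i) = closedEdgeAt-inject₁ p d i

  closedEdgeAt-last : ∀ {u v} (p : Walk u v) d → closedEdgeAt p d (fromℕ (len p)) ≡ d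
  closedEdgeAt-last [] d = refl
  closedEdgeAt-last (cons e j p) d = closedEdgeAt-last p d

  closedEdgeAt∈ : ∀ {u v} (p : Walk u v) d i → closedEdgeAt p d i ∈ˡ d ∷ edges p
  closedEdgeAt∈ p d i with lastView i
  ... | isLast = here (closedEdgeAt-last p d)
  ... | isInject k = there (subst (_∈ˡ edges p) (sym (closedEdgeAt-inject₁ p d k)) (edgeAt∈ p k))

  closedEdgeAt-inj : ∀ {u v} (p : Walk u v) d → Simple p → d ∉ˡ edges p →
    ∀ {i k} → closedEdgeAt p d i ≡ closedEdgeAt p d k → i ≡ k
  closedEdgeAt-inj p d s d∉ {i} {k} eq with lastView i | lastView k
  ... | isLast | isLast = refl
  ... | isLast | isInject k′ = contradiction
    (subst (_∈ˡ edges p) (trans (sym (closedEdgeAt-inject₁ p d k′)) (trans (sym eq) (closedEdgeAt-last p d))) (edgeAt∈ p k′)) d∉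
  ... | isInject i′ | isLast = contradiction
    (subst (_∈ˡ edges p) (trans (sym (closedEdgeAt-inject₁ p d i′)) (trans eq (closedEdgeAt-last p d))) (edgeAt∈ p i′)) d∉
  ... | isInject i′ | isInject k′ = cong inject₁ (edgeAt-inj p s
    (trans (sym (closedEdgeAt-inject₁ p d i′)) (trans eq (closedEdgeAt-inject₁ p d k′))))

  closedEdgeAt-joins : ∀ {u v} (p : Walk u v) d → Joins G d v u →
    ∀ i → Joins G (closedEdgeAt p d i) (vertexAt p i) (vertexAt p (next i))
  closedEdgeAt-joins p d j i with lastView i
  ... | isLast rewrite closedEdgeAt-last p d | vertexAt-last p | next-fromℕ (len p) = j
  ... | isInject k rewrite closedEdgeAt-inject₁ p d k | next-inject₁ k = edgeAt-joins p k

  opaque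
    -- The empty walk closes to a loop and a single edge to a 2-cycle; in the latter case
    -- `d ∉ˡ edges p` says that d is a second, parallel edge.
    close : ∀ {u v} (p : Walk u v) → Simple p → ∀ {d} → Joins G d v u → d ∉ˡ edges p →
      ∃[ C ] (Cycle.E {G = G} C ≡ fromList (d ∷ edges p) × (∀ {x} → x ∈ Cycle.V C → x ∈ˡ verts p) ×
              (∀ {x} → x ∈ˡ verts p → x ∈ Cycle.V C))
    close p s {d} j d∉ = record
      { len = len p ; vtx = vertexAt p ; edg = closedEdgeAt p d
      ; vtx-inj = vertexAt-inj p s ; edg-inj = closedEdgeAt-inj p d s d∉ ; joins = closedEdgeAt-joins p d j }
      , fromList-≡ e⁻ e⁺ , v⁻ , v⁺
      where
      e⁻ : ∀ {x} → x ∈ image (closedEdgeAt p d) → x ∈ˡ d ∷ edges p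
      e⁻ x∈ with ∈-image⁻ (closedEdgeAt p d) x∈
      ... | i , refl = closedEdgeAt∈ p d i
      e⁺ : ∀ {x} → x ∈ˡ d ∷ edges p → x ∈ image (closedEdgeAt p d)
      e⁺ (here refl) = subst (_∈ image (closedEdgeAt p d)) (closedEdgeAt-last p d) (∈-image⁺ (closedEdgeAt p d) (fromℕ (len p)))
      e⁺ (there x∈) with ∈edgeAt p x∈
      ... | i , refl = subst (_∈ image (closedEdgeAt p d)) (closedEdgeAt-inject₁ p d i) (∈-image⁺ (closedEdgeAt p d) (inject₁ i))
      v⁻ : ∀ {x} → x ∈ image (vertexAt p) → x ∈ˡ verts p
      v⁻ x∈ with ∈-image⁻ (vertexAt p) x∈
      ... | i , refl = vertexAt∈ p i
      v⁺ : ∀ {x} → x ∈ˡ verts p → x ∈ image (vertexAt p)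
      v⁺ x∈ with ∈vertexAt p x∈
      ... | i , refl = ∈-image⁺ (vertexAt p) i

  walkAlong : ∀ k (vt : Fin (suc k) → Fin n) (ed : Fin k → Fin m) →
    (∀ i → Joins G (ed i) (vt (inject₁ i)) (vt (suc i))) → Walk (vt zero) (vt (fromℕ k))
  walkAlong zero vt ed j = []
  walkAlong (suc k) vt ed j = cons (ed zero) (j zero) (walkAlong k (λ i → vt (suc i)) (λ i → ed (suc i)) (λ i → j (suc i)))

  walkAlong-verts⁻ : ∀ k vt ed j {x} → x ∈ˡ verts (walkAlong k vt ed j) → ∃[ i ] vt i ≡ x
  walkAlong-verts⁻ k vt ed j (here refl) = zero , refl
  walkAlong-verts⁻ (suc k) vt ed j (there x∈) with walkAlong-verts⁻ k _ _ _ x∈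
  ... | i , eq = suc i , eq

  walkAlong-verts⁺ : ∀ k vt ed j i → vt i ∈ˡ verts (walkAlong k vt ed j)
  walkAlong-verts⁺ k vt ed j zero = here refl
  walkAlong-verts⁺ (suc k) vt ed j (suc i) = there (walkAlong-verts⁺ k _ _ _ i)

  walkAlong-edges⁻ : ∀ k vt ed j {x} → x ∈ˡ edges (walkAlong k vt ed j) → ∃[ i ] ed i ≡ x
  walkAlong-edges⁻ (suc k) vt ed j (here refl) = zero , refl
  walkAlong-edges⁻ (suc k) vt ed j (there x∈) with walkAlong-edges⁻ k _ _ _ x∈
  ... | i , eq = suc i , eq

  walkAlong-edges⁺ : ∀ k vt ed j i → ed i ∈ˡ edges (walkAlong k vt ed j)
  walkAlong-edges⁺ (suc k) vt ed j zero = here refl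
  walkAlong-edges⁺ (suc k) vt ed j (suc i) = there (walkAlong-edges⁺ k _ _ _ i)

  walkAlong-simple : ∀ k vt ed j → (∀ {a b} → vt a ≡ vt b → a ≡ b) → Simple (walkAlong k vt ed j)
  walkAlong-simple zero vt ed j inj = tt
  walkAlong-simple (suc k) vt ed j inj =
    (λ x∈ → let i , eq = walkAlong-verts⁻ k _ _ _ x∈ in contradiction (inj eq) λ ())
    , walkAlong-simple k _ _ _ (λ eq → suc-injective (inj eq))

  opaque
    fromPath : (P : Path G) → Σ (Walk (Path.start P) (Path.end P)) λ p → Simple p ×
      (∀ {f} → f ∈ˡ edges p → f ∈ Path.E P) × (∀ {f} → f ∈ Path.E P → f ∈ˡ edges p) ×
      (∀ {x} → x ∈ˡ verts p → x ∈ Path.V P) × (∀ {x} → x ∈ Path.V P → x ∈ˡ verts p)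
    fromPath P = walkAlong k vtx edg joins , walkAlong-simple k vtx edg joins vtx-inj
      , (λ f∈ → let i , eq = walkAlong-edges⁻ k vtx edg joins f∈ in subst (_∈ image edg) eq (∈-image⁺ edg i))
      , (λ f∈ → let i , eq = ∈-image⁻ edg f∈ in subst (_∈ˡ _) eq (walkAlong-edges⁺ k vtx edg joins i))
      , (λ f∈ → let i , eq = walkAlong-verts⁻ k vtx edg joins f∈ in subst (_∈ image vtx) eq (∈-image⁺ vtx i))
      , (λ f∈ → let i , eq = ∈-image⁻ vtx f∈ in subst (_∈ˡ _) eq (walkAlong-verts⁺ k vtx edg joins i))
      where open Path P renaming (len to k)

  src tgt : Fin m → Fin n
  src e = proj₁ (G e)
  tgt e = proj₂ (G e)

  joins-ends : ∀ e → Joins G e (src e) (tgt e)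
  joins-ends e = inj₁ refl

  -- A cycle cut open at e. With the ends fixed as `src e` and `tgt e`, in this order, two cycles
  -- through e differ only in their paths and can be compared.
  record Opened (C : Cycle G) (e : Fin m) : Set where
    field
      path   : Walk (src e) (tgt e)
      simple : Simple path
      e∉     : e ∉ˡ edges path
      E⁻     : ∀ {f} → f ∈ Cycle.E C → f ∈ˡ e ∷ edges path
      E⁺     : ∀ {f} → f ∈ˡ e ∷ edges path → f ∈ Cycle.E C
      V⁻     : ∀ {x} → x ∈ Cycle.V C → x ∈ˡ verts path
      V⁺     : ∀ {x} → x ∈ˡ verts path → x ∈ Cycle.V C
    E≡ : Cycle.E C ≡ fromList (e ∷ edges path)
    E≡ = fromList-≡ E⁻ E⁺

  private
    record Closed (C : Cycle G) (d : Fin m) : Set where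
      constructor mkClosed
      field
        {a b} : Fin n
        p     : Walk a b
        s     : Simple p
        j     : Joins G d b a
        d∉    : d ∉ˡ edges p
        pE⁻   : ∀ {f} → f ∈ Cycle.E C → f ∈ˡ d ∷ edges p
        pE⁺   : ∀ {f} → f ∈ˡ d ∷ edges p → f ∈ Cycle.E C
        pV⁻   : ∀ {x} → x ∈ Cycle.V C → x ∈ˡ verts p
        pV⁺   : ∀ {x} → x ∈ˡ verts p → x ∈ Cycle.V C

    orient : ∀ {C e} → Closed C e → Opened C e
    orient {e = e} (mkClosed p s j e∉ a b c d) with joins-unique (joins-ends e) j
    ... | inj₂ (refl , refl) = record { path = p ; simple = s ; e∉ = e∉ ; E⁻ = a ; E⁺ = b ; V⁻ = c ; V⁺ = d }
    ... | inj₁ (refl , refl) = record { path = rev p ; simple = simple-rev p s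
      ; e∉ = λ x∈ → e∉ (edges-rev⁻ p x∈)
      ; E⁻ = λ f∈ → case-∷ (a f∈)
      ; E⁺ = λ { (here eq) → b (here eq) ; (there f∈) → b (there (edges-rev⁻ p f∈)) }
      ; V⁻ = λ x∈ → verts-rev⁺ p (c x∈) ; V⁺ = λ x∈ → d (verts-rev⁻ p x∈) }
      where
      case-∷ : ∀ {f} → f ∈ˡ e ∷ edges p → f ∈ˡ e ∷ edges (rev p)
      case-∷ (here eq) = here eq
      case-∷ (there f∈) = there (edges-rev⁺ p f∈)

    closeLast : (C : Cycle G) → ∃[ d ] Closed C d
    closeLast C = edg last , mkClosed p ps lastJ d∉ pE⁻ pE⁺ pV⁻ pV⁺
      where
      open Cycle C using (vtx; edg; vtx-inj; edg-inj; joins) renaming (len to k)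
      last = fromℕ k
      lastJ : Joins G (edg last) (vtx last) (vtx zero)
      lastJ = subst (λ z → Joins G (edg last) (vtx last) (vtx z)) (next-fromℕ k) (joins last)
      stepJ : ∀ j → Joins G (edg (inject₁ j)) (vtx (inject₁ j)) (vtx (suc j))
      stepJ j = subst (λ z → Joins G (edg (inject₁ j)) (vtx (inject₁ j)) (vtx z)) (next-inject₁ j) (joins (inject₁ j))
      p = walkAlong k vtx (λ j → edg (inject₁ j)) stepJ
      ps : Simple p
      ps = walkAlong-simple k vtx _ stepJ vtx-inj
      d∉ : edg last ∉ˡ edges p
      d∉ x∈ with walkAlong-edges⁻ k vtx _ stepJ x∈
      ... | j , eq′ = fromℕ≢inject₁ (sym (edg-inj eq′))
      pE⁻ : ∀ {f} → f ∈ Cycle.E C → f ∈ˡ edg last ∷ edges p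
      pE⁻ f∈ with ∈-image⁻ edg f∈
      ... | j , eq′ with lastView j
      ... | isLast = here (sym eq′)
      ... | isInject j′ = there (subst (_∈ˡ edges p) eq′ (walkAlong-edges⁺ k vtx _ stepJ j′))
      pE⁺ : ∀ {f} → f ∈ˡ edg last ∷ edges p → f ∈ Cycle.E C
      pE⁺ (here refl) = ∈-image⁺ edg last
      pE⁺ (there f∈) with walkAlong-edges⁻ k vtx _ stepJ f∈
      ... | j , refl = ∈-image⁺ edg (inject₁ j)
      pV⁻ : ∀ {x} → x ∈ Cycle.V C → x ∈ˡ verts p
      pV⁻ x∈ with ∈-image⁻ vtx x∈
      ... | j , refl = walkAlong-verts⁺ k vtx _ stepJ j
      pV⁺ : ∀ {x} → x ∈ˡ verts p → x ∈ Cycle.V C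
      pV⁺ x∈ with walkAlong-verts⁻ k vtx _ stepJ x∈
      ... | j , refl = ∈-image⁺ vtx j

    -- If e cuts the open walk into p₁ and p₂, then p₂ followed by d and p₁ is a walk closed by e.
    rotate : ∀ {C d e} → Closed C d → e ∈ Cycle.E C → Closed C e
    rotate {C} {d} {e} c@(mkClosed p s j d∉ pE⁻ pE⁺ pV⁻ pV⁺) e∈ with pE⁻ e∈
    ... | here refl = c
    ... | there e∈p with split-edge p e∈p
    ... | x , y , p₁ , k , p₂ , refl = mkClosed q sq k e∉q qE⁻ qE⁺ qV⁻ qV⁺
      where
      r = cons e k p₂
      s₁ : Simple p₁
      s₁ = simple-⊕ˡ p₁ r s
      sr : Simple r
      sr = simple-⊕ʳ p₁ r s
      apart : ∀ {z} → z ∈ˡ verts p₁ → z ∉ˡ verts p₂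
      apart z₁ z₂ with simple-overlap p₁ r s z₁ (there z₂)
      ... | refl = proj₁ sr z₂
      q = p₂ ⊕ cons d j p₁
      sq : Simple q
      sq = simple-⊕ p₂ (cons d j p₁) (proj₂ sr) ((λ z₁ → apart z₁ (end∈ p₂)) , s₁)
        λ { z₂ (here eq) → eq ; z₂ (there z₁) → contradiction z₂ (apart z₁) }
      e∉q : e ∉ˡ edges q
      e∉q e∈q with edges-⊕⁻ p₂ (cons d j p₁) e∈q
      ... | inj₁ e∈₂ = first-edge∉ {j = k} p₂ (proj₁ sr) e∈₂
      ... | inj₂ (here refl) = d∉ e∈p
      ... | inj₂ (there e∈₁) = apart (proj₂ (edge-ends p₁ e∈₁ k)) (start∈ p₂)
      qE⁻ : ∀ {f} → f ∈ Cycle.E C → f ∈ˡ e ∷ edges q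
      qE⁻ f∈ with pE⁻ f∈
      ... | here refl = there (edges-⊕ʳ p₂ _ (here refl))
      ... | there f∈p with edges-⊕⁻ p₁ r f∈p
      ... | inj₁ f∈₁ = there (edges-⊕ʳ p₂ _ (there f∈₁))
      ... | inj₂ (here refl) = here refl
      ... | inj₂ (there f∈₂) = there (edges-⊕ˡ p₂ _ f∈₂)
      qE⁺ : ∀ {f} → f ∈ˡ e ∷ edges q → f ∈ Cycle.E C
      qE⁺ (here refl) = e∈
      qE⁺ (there f∈) with edges-⊕⁻ p₂ (cons d j p₁) f∈
      ... | inj₁ f∈₂ = pE⁺ (there (edges-⊕ʳ p₁ r (there f∈₂)))
      ... | inj₂ (here refl) = pE⁺ (here refl)
      ... | inj₂ (there f∈₁) = pE⁺ (there (edges-⊕ˡ p₁ r f∈₁))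
      qV⁻ : ∀ {z} → z ∈ Cycle.V C → z ∈ˡ verts q
      qV⁻ z∈ with verts-⊕⁻ p₁ r (pV⁻ z∈)
      ... | inj₁ z₁ = verts-⊕ʳ p₂ _ (there z₁)
      ... | inj₂ (here refl) = verts-⊕ʳ p₂ _ (there (end∈ p₁))
      ... | inj₂ (there z₂) = verts-⊕ˡ p₂ _ z₂
      qV⁺ : ∀ {z} → z ∈ˡ verts q → z ∈ Cycle.V C
      qV⁺ z∈ with verts-⊕⁻ p₂ (cons d j p₁) z∈
      ... | inj₁ z₂ = pV⁺ (verts-⊕ʳ p₁ r (there z₂))
      ... | inj₂ (here refl) = pV⁺ (end∈ (p₁ ⊕ r))
      ... | inj₂ (there z₁) = pV⁺ (verts-⊕ˡ p₁ r z₁)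

  opaque
    openAt : (C : Cycle G) {e : Fin m} → e ∈ Cycle.E C → Opened C e
    openAt C e∈ = orient (rotate (proj₂ (closeLast C)) e∈)

    cycle-edge : (C : Cycle G) → ∃[ e ] e ∈ Cycle.E C
    cycle-edge C = Cycle.edg C zero , ∈-image⁺ (Cycle.edg C) zero

  -- Reachability

  -- The components of the spanning subgraph with edge set X, isolated vertices included. `Reach` is
  -- confined to a vertex set and occurs only where connectivity of induced subgraphs is stated.
  data R (X : Subset m) : Fin n → Fin n → Set where
    rfl : ∀ {u} → R X u u
    cns : ∀ {e u w v} → e ∈ X → Joins G e u w → R X w v → R X u v

  R-trans : ∀ {X u v w} → R X u v → R X v w → R X u w
  R-trans rfl s = s
  R-trans (cns e∈ j r) s = cns e∈ j (R-trans r s)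

  R-joins : ∀ {X e u v} → e ∈ X → Joins G e u v → R X u v
  R-joins e∈ j = cns e∈ j rfl

  R-edge : ∀ {X e} → e ∈ X → R X (src e) (tgt e)
  R-edge {e = e} e∈ = R-joins e∈ (joins-ends e)

  R-sym : ∀ {X u v} → R X u v → R X v u
  R-sym rfl = rfl
  R-sym (cns e∈ j r) = R-trans (R-sym r) (R-joins e∈ (flipJ j))

  R-mono : ∀ {X Y u v} → X ⊆ Y → R X u v → R Y u v
  R-mono s rfl = rfl
  R-mono s (cns e∈ j r) = cns (s e∈) j (R-mono s r)

  _inside_ : ∀ {u v} → Walk u v → Subset m → Set
  p inside X = ∀ {f} → f ∈ˡ edges p → f ∈ X

  R-walk : ∀ {X u v} (p : Walk u v) → p inside X → ∀ {x} → x ∈ˡ verts p → R X u x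
  R-walk p sub (here refl) = rfl
  R-walk (cons e j p) sub (there x∈) = cns (sub (here refl)) j (R-walk p (sub ∘ there) x∈)

  opaque
    simplePath : ∀ {X u v} → R X u v → Σ (Walk u v) λ p → Simple p × p inside X
    simplePath rfl = [] , tt , λ ()
    simplePath {u = u} (cns {e} e∈ j r) with simplePath r
    ... | p , s , sub with u ∈ˡ? verts p
    ... | no u∉ = cons e j p , (u∉ , s) , λ { (here refl) → e∈ ; (there f∈) → sub f∈ }
    ... | yes u∈ with split-vertex p u∈
    ... | p₁ , p₂ , refl = p₂ , simple-⊕ʳ p₁ p₂ s , λ f∈ → sub (edges-⊕ʳ p₁ p₂ f∈)

  -- A walk that uses g several times can be shortened to use it at most once; the cases are no use
  -- and the two directions.
  R-▸ : ∀ {X g u v} → R (X ▸ g) u v →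
    R X u v ⊎ (R X u (src g) × R X (tgt g) v) ⊎ (R X u (tgt g) × R X (src g) v)
  R-▸ rfl = inj₁ rfl
  R-▸ {g = g} (cns e∈ j r) with ▸⁻ e∈ | R-▸ r
  ... | inj₁ e∈X | inj₁ a = inj₁ (cns e∈X j a)
  ... | inj₁ e∈X | inj₂ (inj₁ (a , b)) = inj₂ (inj₁ (cns e∈X j a , b))
  ... | inj₁ e∈X | inj₂ (inj₂ (a , b)) = inj₂ (inj₂ (cns e∈X j a , b))
  ... | inj₂ refl | ih with joins-unique (joins-ends g) j | ih
  ... | inj₁ (refl , refl) | inj₁ a = inj₂ (inj₁ (rfl , a))
  ... | inj₁ (refl , refl) | inj₂ (inj₁ (a , b)) = inj₂ (inj₁ (rfl , b))
  ... | inj₁ (refl , refl) | inj₂ (inj₂ (a , b)) = inj₁ b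
  ... | inj₂ (refl , refl) | inj₁ a = inj₂ (inj₂ (rfl , a))
  ... | inj₂ (refl , refl) | inj₂ (inj₁ (a , b)) = inj₁ b
  ... | inj₂ (refl , refl) | inj₂ (inj₂ (a , b)) = inj₂ (inj₂ (rfl , b))

  R-▸-chord : ∀ {X g u v} → R X (src g) (tgt g) → R (X ▸ g) u v → R X u v
  R-▸-chord c r with R-▸ r
  ... | inj₁ a = a
  ... | inj₂ (inj₁ (a , b)) = R-trans a (R-trans c b)
  ... | inj₂ (inj₂ (a , b)) = R-trans a (R-trans (R-sym c) b)

  opaque
    -- `R-▸` reduces reachability after an insertion to reachability before it, so no walks have to
    -- be enumerated.
    R? : ∀ X u v → Dec (R X u v)
    R? = subset-induction (λ X → ∀ u v → Dec (R X u v))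
      (λ s t d u v → map′ (R-mono s) (R-mono t) (d u v))
      (λ emp u v → map′ (λ { refl → rfl }) (λ { rfl → refl ; (cns e∈ _ _) → contradiction (_ , e∈) emp }) (u ≟ᶠ v))
      (λ X e d u v → map′
        [ R-mono ▸ˡ , [ (λ { (a , b) → R-trans (R-mono ▸ˡ a) (R-trans (R-edge ▸ʳ) (R-mono ▸ˡ b)) })
                      , (λ { (a , b) → R-trans (R-mono ▸ˡ a) (R-trans (R-sym (R-edge ▸ʳ)) (R-mono ▸ˡ b)) }) ]′ ]′
        R-▸ (d u v ⊎-dec ((d u (src e) ×-dec d (tgt e) v) ⊎-dec (d u (tgt e) ×-dec d (src e) v))))

  Joins? : ∀ e u v → Dec (Joins G e u v)
  Joins? e u v = pair? (G e) (u , v) ⊎-dec pair? (G e) (v , u)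
    where
    pair? : (x y : Fin n × Fin n) → Dec (x ≡ y)
    pair? (a , b) (c , d) = map′ (λ { (refl , refl) → refl }) (λ { refl → refl , refl }) (a ≟ᶠ c ×-dec b ≟ᶠ d)

  opaque
    -- A cycle has `suc len` distinct vertices, so `len` is below n and the search over lengths and
    -- pairs of functions is finite.
    anyCycle? : (Q : Subset m → Subset n → Set) → (∀ E V → Dec (Q E V)) →
      Dec (∃[ C ] Q (Cycle.E {G = G} C) (Cycle.V C))
    anyCycle? Q Q? = map′ fwd bwd
      (any? {n} λ k → anyFunction? (suc (toℕ k)) (λ vt → ∃[ ed ] Cond (toℕ k) vt ed)
        (λ vt → anyFunction? (suc (toℕ k)) (Cond (toℕ k) vt) (cond? (toℕ k) vt) (λ eq → cond-resp (toℕ k) (λ _ → refl) eq))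
        (λ { eq (ed , c) → ed , cond-resp (toℕ k) eq (λ _ → refl) c }))
      where
      Cond : ∀ k → (Fin (suc k) → Fin n) → (Fin (suc k) → Fin m) → Set
      Cond k vt ed = (∀ i j → vt i ≡ vt j → i ≡ j) × (∀ i j → ed i ≡ ed j → i ≡ j) ×
        (∀ i → Joins G (ed i) (vt i) (vt (next i))) × Q (image ed) (image vt)
      cond? : ∀ k vt ed → Dec (Cond k vt ed)
      cond? k vt ed = all? (λ i → all? λ j → (vt i ≟ᶠ vt j) →-dec (i ≟ᶠ j)) ×-dec
        (all? (λ i → all? λ j → (ed i ≟ᶠ ed j) →-dec (i ≟ᶠ j)) ×-dec
        (all? (λ i → Joins? (ed i) (vt i) (vt (next i))) ×-dec Q? (image ed) (image vt)))
      cond-resp : ∀ k {vt vt′ ed ed′} → (∀ i → vt i ≡ vt′ i) → (∀ i → ed i ≡ ed′ i) → Cond k vt ed → Cond k vt′ ed′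
      cond-resp k {vt} {vt′} {ed} {ed′} ev ee (a , b , c , q) =
        (λ i j eq → a i j (trans (ev i) (trans eq (sym (ev j))))) ,
        (λ i j eq → b i j (trans (ee i) (trans eq (sym (ee j))))) ,
        (λ i → subst (λ e → Joins G e (vt′ i) (vt′ (next i))) (ee i)
          (subst (λ x → Joins G (ed i) x (vt′ (next i))) (ev i) (subst (Joins G (ed i) (vt i)) (ev (next i)) (c i)))) ,
        subst (λ z → Q z (image vt′)) (image-cong ee) (subst (Q (image ed)) (image-cong ev) q)
      fwd : (∃[ k ] ∃[ vt ] ∃[ ed ] Cond (toℕ {n} k) vt ed) → ∃[ C ] Q (Cycle.E {G = G} C) (Cycle.V C)
      fwd (k , vt , ed , a , b , c , q) = record { len = toℕ k ; vtx = vt ; edg = ed ; vtx-inj = a _ _ ; edg-inj = b _ _ ; joins = c } , q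
      bwd : ∃[ C ] Q (Cycle.E {G = G} C) (Cycle.V C) → ∃[ k ] ∃[ vt ] ∃[ ed ] Cond (toℕ {n} k) vt ed
      bwd (C , q) = fromℕ< lt , subst (λ l → ∃[ vt ] ∃[ ed ] Cond l vt ed) (sym (toℕ-fromℕ< lt))
        (vtx , edg , (λ _ _ → vtx-inj) , (λ _ _ → edg-inj) , joins , q)
        where
        open Cycle C renaming (len to k)
        lt : k < n
        lt = injective⇒≤ vtx-inj

  -- Theta subgraphs

  record Apart {a b : Fin n} (p q : Walk a b) : Set where
    constructor apart
    field
      verts-apart : ∀ {x} → x ∈ˡ verts p → x ∈ˡ verts q → x ≡ a ⊎ x ≡ b
      edges-apart : ∀ {f} → f ∈ˡ edges p → f ∉ˡ edges q
  open Apart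

  Apart-sym : ∀ {a b} {p q : Walk a b} → Apart p q → Apart q p
  Apart-sym (apart v e) = apart (λ x y → v y x) (λ x y → e y x)

  -- A shared edge has two distinct shared ends.
  meet-once⇒edges-disjoint : ∀ {a b c d} (p : Walk a b) (q : Walk c d) {z} → Simple p →
    (∀ {x} → x ∈ˡ verts p → x ∈ˡ verts q → x ≡ z) → ∀ {f} → f ∈ˡ edges p → f ∉ˡ edges q
  meet-once⇒edges-disjoint p q s h {f} f∈p f∈q
    with p₁ , p₂ ← edge-ends p f∈p (joins-ends f) | q₁ , q₂ ← edge-ends q f∈q (joins-ends f)
    = simple-ends≢ p s f∈p (joins-ends f) (trans (h p₁ q₁) (sym (h p₂ q₂)))

  -- The complementary arc. On a cycle formed by f and a path from x along g to a, on to b and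
  -- backwards along h to y, this is the route from a to b through f.
  through : ∀ {x a b y f} → Walk x a → Joins G f x y → Walk b y → Walk a b
  through g j h = rev g ⊕ cons _ j (rev h)

  module _ {x a b y f} (g : Walk x a) (j : Joins G f x y) (h : Walk b y) where

    through-simple : Simple g → Simple h → (∀ {z} → z ∈ˡ verts g → z ∉ˡ verts h) → Simple (through g j h)
    through-simple sg sh dis = simple-⊕ (rev g) _ (simple-rev g sg) ((λ z∈ → dis (start∈ g) (verts-rev⁻ h z∈)) , simple-rev h sh)
      λ { z∈ (here refl) → refl ; z∈ (there w∈) → contradiction (verts-rev⁻ h w∈) (dis (verts-rev⁻ g z∈)) }

    through-verts : ∀ {z} → z ∈ˡ verts (through g j h) → z ∈ˡ verts g ⊎ z ∈ˡ verts h
    through-verts z∈ with verts-⊕⁻ (rev g) _ z∈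
    ... | inj₁ w = inj₁ (verts-rev⁻ g w)
    ... | inj₂ (here refl) = inj₁ (start∈ g)
    ... | inj₂ (there w) = inj₂ (verts-rev⁻ h w)

    through-edges⁻ : ∀ {z} → z ∈ˡ edges (through g j h) → z ∈ˡ edges g ⊎ z ≡ f ⊎ z ∈ˡ edges h
    through-edges⁻ z∈ with edges-⊕⁻ (rev g) _ z∈
    ... | inj₁ w = inj₁ (edges-rev⁻ g w)
    ... | inj₂ (here eq) = inj₂ (inj₁ eq)
    ... | inj₂ (there w) = inj₂ (inj₂ (edges-rev⁻ h w))

    through-edges⁺ : ∀ {z} → z ∈ˡ edges g ⊎ z ≡ f ⊎ z ∈ˡ edges h → z ∈ˡ edges (through g j h)
    through-edges⁺ (inj₁ w) = edges-⊕ˡ (rev g) _ (edges-rev⁺ g w)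
    through-edges⁺ (inj₂ (inj₁ eq)) = edges-⊕ʳ (rev g) _ (here eq)
    through-edges⁺ (inj₂ (inj₂ w)) = edges-⊕ʳ (rev g) _ (there (edges-rev⁺ h w))

    through-closing : ∀ l → fromList (l ++ edges (through g j h)) ≡ fromList (f ∷ edges g ++ l ++ edges h)
    through-closing l = fromList-cong
      (++-⊑ (λ z∈ → there (∈-++⁺ʳ (edges g) (∈-++⁺ˡ z∈)))
        (λ z∈ → [ (λ w → there (∈-++⁺ˡ w)) , [ here , (λ w → there (∈-++⁺ʳ (edges g) (∈-++⁺ʳ l w))) ]′ ]′ (through-edges⁻ z∈)))
      (∷-⊑ (∈-++⁺ʳ l (through-edges⁺ (inj₂ (inj₁ refl))))
        (++-⊑ (λ z∈ → ∈-++⁺ʳ l (through-edges⁺ (inj₁ z∈)))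
          (++-⊑ ∈-++⁺ˡ (λ z∈ → ∈-++⁺ʳ l (through-edges⁺ (inj₂ (inj₂ z∈)))))))

    Apart-through : ∀ {p : Walk a b} → (∀ {z} → z ∈ˡ verts g → z ∈ˡ verts p → z ≡ a) → (∀ {z} → z ∈ˡ verts h → z ∈ˡ verts p → z ≡ b) →
      (∀ {z} → z ∈ˡ edges p → z ∉ˡ edges g) → (∀ {z} → z ∈ˡ edges p → z ∉ˡ edges h) → f ∉ˡ edges p → Apart p (through g j h)
    Apart-through vg vh eg eh f∉ = apart
      (λ z∈ w∈ → Sum.map (λ w → vg w z∈) (λ w → vh w z∈) (through-verts w∈))
      (λ z∈ w∈ → [ eg z∈ , [ (λ { refl → f∉ z∈ }) , eh z∈ ]′ ]′ (through-edges⁻ w∈))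

  toPath-∪ : ∀ {a b c d} (p : Walk a b) (q : Walk c d) (sp : Simple p) (sq : Simple q) →
    Path.E (toPath p sp) ∪ Path.E (toPath q sq) ≡ fromList (edges p ++ edges q)
  toPath-∪ p q sp sq = fromList-≡
    (λ x∈ → [ (λ y → ∈-++⁺ˡ (toPath-E⁻ p sp y)) , (λ y → ∈-++⁺ʳ (edges p) (toPath-E⁻ q sq y)) ]′ (x∈p∪q⁻ _ _ x∈))
    (λ x∈ → x∈p∪q⁺ (Sum.map (toPath-E⁺ p sp) (toPath-E⁺ q sq) (∈-++⁻ (edges p) x∈)))

  module _ {a b : Fin n} (a≢b : a ≢ b) (p₁ p₂ p₃ : Walk a b) (s₁ : Simple p₁) (s₂ : Simple p₂) (s₃ : Simple p₃)
    (a₁₂ : Apart p₁ p₂) (a₁₃ : Apart p₁ p₃) (a₂₃ : Apart p₂ p₃) where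

    private
      edis : ∀ {p q : Walk a b} {sp : Simple p} {sq : Simple q} → Apart p q →
        Empty (Path.E (toPath p sp) ∩ Path.E (toPath q sq))
      edis {p} {q} {sp} {sq} ap (x , x∈) with x∈₁ , x∈₂ ← x∈p∩q⁻ _ _ x∈ =
        edges-apart ap (toPath-E⁻ p sp x∈₁) (toPath-E⁻ q sq x∈₂)

      int : ∀ {p q : Walk a b} {sp : Simple p} {sq : Simple q} → Apart p q →
        ∀ w → Path.Internal (toPath p sp) w → w ∉ Path.V (toPath q sq)
      int {p} {q} {sp} {sq} ap w (w∈ , w≢s , w≢e) w∈′ with verts-apart ap (toPath-V⁻ p sp w∈) (toPath-V⁻ q sq w∈′)
      ... | inj₁ eq = w≢s eq
      ... | inj₂ eq = w≢e (trans eq (sym (vertexAt-last p)))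

    mkTheta : Theta G
    mkTheta = record
      { u = a ; v = b ; u≢v = a≢b ; P₁ = toPath p₁ s₁ ; P₂ = toPath p₂ s₂ ; P₃ = toPath p₃ s₃
      ; st₁ = refl ; st₂ = refl ; st₃ = refl
      ; en₁ = vertexAt-last p₁ ; en₂ = vertexAt-last p₂ ; en₃ = vertexAt-last p₃
      ; edis₁₂ = edis {sp = s₁} {s₂} a₁₂ ; edis₁₃ = edis {sp = s₁} {s₃} a₁₃ ; edis₂₃ = edis {sp = s₂} {s₃} a₂₃
      ; int₁ = λ w i → int {sp = s₁} {s₂} a₁₂ w i , int {sp = s₁} {s₃} a₁₃ w i
      ; int₂ = λ w i → int {sp = s₂} {s₁} (Apart-sym a₁₂) w i , int {sp = s₂} {s₃} a₂₃ w i
      ; int₃ = λ w i → int {sp = s₃} {s₁} (Apart-sym a₁₃) w i , int {sp = s₃} {s₂} (Apart-sym a₂₃) w i }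

  opaque
    joinPaths : ∀ {a b} → a ≢ b → (p q : Walk a b) → Simple p → Simple q → Apart p q →
      ∃[ C ] (Cycle.E {G = G} C ≡ fromList (edges p ++ edges q) ×
              (∀ {x} → x ∈ Cycle.V C → x ∈ˡ verts p ⊎ x ∈ˡ verts q) ×
              (∀ {x} → x ∈ˡ verts p → x ∈ Cycle.V C))
    joinPaths a≢b [] q sp sq ap = contradiction refl a≢b
    -- The first edge d of the first path closes the walk that follows the rest of this path and
    -- returns along q.
    joinPaths {a} {b} a≢b (cons d j p) q (a∉ , sp) sq ap
      with close (p ⊕ rev q) sr j d∉
      where
      sr : Simple (p ⊕ rev q)
      sr = simple-⊕ p (rev q) sp (simple-rev q sq) λ x∈p x∈q →
        [ (λ { refl → contradiction x∈p a∉ }) , id ]′ (verts-apart ap (there x∈p) (verts-rev⁻ q x∈q))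
      d∉ : d ∉ˡ edges (p ⊕ rev q)
      d∉ d∈ with edges-⊕⁻ p (rev q) d∈
      ... | inj₁ d∈p = first-edge∉ {j = j} p a∉ d∈p
      ... | inj₂ d∈q = edges-apart ap (here refl) (edges-rev⁻ q d∈q)
    ... | C , eqE , v⁻ , v⁺ = C
      , trans eqE (fromList-cong
          (∷-⊑ (here refl) λ x∈ → [ (λ y → there (∈-++⁺ˡ y)) , (λ y → there (∈-++⁺ʳ (edges p) (edges-rev⁻ q y))) ]′ (edges-⊕⁻ p (rev q) x∈))
          (∷-⊑ (here refl) (++-⊑ (λ x∈ → there (edges-⊕ˡ p (rev q) x∈)) (λ x∈ → there (edges-⊕ʳ p (rev q) (edges-rev⁺ q x∈))))))
      , (λ x∈ → Sum.map there (verts-rev⁻ q) (verts-⊕⁻ p (rev q) (v⁻ x∈)))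
      , λ { (here refl) → v⁺ (end∈ (p ⊕ rev q)) ; (there x∈) → v⁺ (verts-⊕ˡ p (rev q) x∈) }

  -- Induced and crossing edges, cells and their connectivity

  private
    lookup-∈ : ∀ {k} {W : Subset k} {x} → lookup W x ≡ true → x ∈ W
    lookup-∈ {W = W} {x} = lookup⇒[]= x W

  ∈-inducedE⁺ : ∀ {W e} → src e ∈ W → tgt e ∈ W → e ∈ inducedE G W
  ∈-inducedE⁺ {W} {e} s t = lookup⇒[]= e _ (trans (lookup∘tabulate _ e) both)
    where
    both : lookup W (src e) Data.Bool.∧ lookup W (tgt e) ≡ true
    both rewrite []=⇒lookup s | []=⇒lookup t = refl

  ∈-inducedE⁻ : ∀ {W e} → e ∈ inducedE G W → src e ∈ W × tgt e ∈ W
  ∈-inducedE⁻ {W} {e} e∈ with lookup W (src e) in p | lookup W (tgt e) in q | trans (sym (lookup∘tabulate _ e)) ([]=⇒lookup e∈)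
  ... | true | true | _ = lookup-∈ p , lookup-∈ q
  ... | true | false | ()
  ... | false | _ | ()

  ∈-crossE⁺ : ∀ {W W′ e} → (src e ∈ W × tgt e ∈ W′) ⊎ (src e ∈ W′ × tgt e ∈ W) → e ∈ crossE G W W′
  ∈-crossE⁺ {W} {W′} {e} h = lookup⇒[]= e _ (trans (lookup∘tabulate _ e) (one h))
    where
    one : (src e ∈ W × tgt e ∈ W′) ⊎ (src e ∈ W′ × tgt e ∈ W) →
      (lookup W (src e) Data.Bool.∧ lookup W′ (tgt e)) Data.Bool.∨ (lookup W′ (src e) Data.Bool.∧ lookup W (tgt e)) ≡ true
    one (inj₁ (s , t)) rewrite []=⇒lookup s | []=⇒lookup t = refl
    one (inj₂ (s , t)) rewrite []=⇒lookup s | []=⇒lookup t = ∨-zeroʳ _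

  ∈-crossE⁻ : ∀ {W W′ e} → e ∈ crossE G W W′ → (src e ∈ W × tgt e ∈ W′) ⊎ (src e ∈ W′ × tgt e ∈ W)
  ∈-crossE⁻ {W} {W′} {e} e∈
    with lookup W (src e) in p | lookup W′ (tgt e) in q | lookup W′ (src e) in p′ | lookup W (tgt e) in q′
       | trans (sym (lookup∘tabulate _ e)) ([]=⇒lookup e∈)
  ... | true | true | _ | _ | _ = inj₁ (lookup-∈ p , lookup-∈ q)
  ... | true | false | true | true | _ = inj₂ (lookup-∈ p′ , lookup-∈ q′)
  ... | false | _ | true | true | _ = inj₂ (lookup-∈ p′ , lookup-∈ q′)
  ... | true | false | true | false | ()
  ... | true | false | false | _ | ()
  ... | false | _ | true | false | ()
  ... | false | _ | false | _ | ()

  module _ {k : ℕ} (p : Partition n k) where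
    open Partition p

    ∈-cell⁺ : ∀ {i v} → part v ≡ i → v ∈ cell i
    ∈-cell⁺ {i} = ∈-tabulate⁺ (λ v → part v ≟ᶠ i)

    ∈-cell⁻ : ∀ {i v} → v ∈ cell i → part v ≡ i
    ∈-cell⁻ {i} = ∈-tabulate⁻ (λ v → part v ≟ᶠ i)

  Reach⇒R : ∀ {W A Y u v} → (∀ {e} → e ∈ A → src e ∈ W → tgt e ∈ W → e ∈ Y) → u ∈ W → Reach G W A u v → v ∈ W × R Y u v
  Reach⇒R h u∈ here = u∈ , rfl
  Reach⇒R h u∈ (step {e = e} r e∈ j x∈) with Reach⇒R h u∈ r
  ... | w∈ , r′ with joins-unique (joins-ends e) j
  ... | inj₁ (refl , refl) = x∈ , R-trans r′ (R-joins (h e∈ w∈ x∈) j)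
  ... | inj₂ (refl , refl) = x∈ , R-trans r′ (R-joins (h e∈ x∈ w∈) j)

  -- `Reach` grows at its end and `R` at its start, hence the accumulated prefix in `go`. The whole
  -- component of u stays in W, so every intermediate vertex qualifies.
  R⇒Reach : ∀ {W A Y u v} → Y ⊆ A → (∀ {x} → R Y u x → x ∈ W) → R Y u v → Reach G W A u v
  R⇒Reach {W} {A} {Y} {u} sub stay r = go rfl here r
    where
    go : ∀ {w v} → R Y u w → Reach G W A u w → R Y w v → Reach G W A u v
    go uw q rfl = q
    go uw q (cns e∈ j r) = go uw′ (step q (sub e∈) j (stay uw′)) r
      where uw′ = R-trans uw (R-joins e∈ j)

  connectedOn⇒R : ∀ {W A Y} → (∀ {e} → e ∈ A → src e ∈ W → tgt e ∈ W → e ∈ Y) → ConnectedOn G W A →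
    ∀ {u v} → u ∈ W → v ∈ W → R Y u v
  connectedOn⇒R h (_ , c) u∈ v∈ = proj₂ (Reach⇒R h u∈ (c _ _ u∈ v∈))

  R⇒connectedOn : ∀ {W A Y a} → Y ⊆ A → a ∈ W → (∀ {u x} → u ∈ W → R Y u x → x ∈ W) → (∀ {u v} → u ∈ W → v ∈ W → R Y u v) →
    ConnectedOn G W A
  R⇒connectedOn sub a∈ stay c = (_ , a∈) , λ u v u∈ v∈ → R⇒Reach sub (stay u∈) (c u∈ v∈)

  -- Quasi-biased graphs: the theta condition and rerouting

  module QuasiGraphic (cls : Subset m → Kind) (qb : QuasiBiased G cls) where
    open QuasiBiased qb
    open Matroid (Circuit G cls)

    theta-third : (T : Theta G) → cls (Theta.C₁₂ T) ≡ bal → cls (Theta.C₁₃ T) ≡ bal → cls (Theta.C₂₃ T) ≡ bal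
    theta-third T e₁ e₂ with cls (Theta.C₁₂ T) | cls (Theta.C₁₃ T) | cls (Theta.C₂₃ T) | theta-cond T
    theta-third T refl refl | bal | bal | bal | h = refl
    theta-third T refl refl | bal | bal | lft | h = contradiction refl h
    theta-third T refl refl | bal | bal | frm | h = contradiction refl h

    theta-bal : ∀ {a b} → a ≢ b → (p₁ p₂ p₃ : Walk a b) → Simple p₁ → Simple p₂ → Simple p₃ → Apart p₁ p₂ → Apart p₁ p₃ → Apart p₂ p₃ →
      cls (fromList (edges p₁ ++ edges p₂)) ≡ bal → cls (fromList (edges p₁ ++ edges p₃)) ≡ bal → cls (fromList (edges p₂ ++ edges p₃)) ≡ bal
    theta-bal a≢b p₁ p₂ p₃ s₁ s₂ s₃ a₁₂ a₁₃ a₂₃ b₁₂ b₁₃ = trans (cong cls (sym (toPath-∪ p₂ p₃ s₂ s₃)))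
      (theta-third (mkTheta a≢b p₁ p₂ p₃ s₁ s₂ s₃ a₁₂ a₁₃ a₂₃)
        (trans (cong cls (toPath-∪ p₁ p₂ s₁ s₂)) b₁₂) (trans (cong cls (toPath-∪ p₁ p₃ s₁ s₃)) b₁₃))

    -- Balance is asked only of the cycles in the component of `src e`, because closure will be
    -- computed component by component.
    module _ (X : Subset m) (e : Fin m) (e∉X : e ∉ X)
      (balanced : ∀ (C : Cycle G) → Cycle.E C ⊆ X → (∀ {x} → x ∈ Cycle.V C → R X (src e) x) → cls (Cycle.E C) ≡ bal) where
      private
        u = src e
        v = tgt e

        Closes : List (Fin m) → Set
        Closes l = cls (fromList (e ∷ l)) ≡ bal

        edges-⊕-++ : ∀ {a b c} (r : Walk a b) (S : Walk b c) l → edges (r ⊕ S) ++ l ≡ edges r ++ edges S ++ l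
        edges-⊕-++ r S l = trans (cong (_++ l) (edges-⊕ r S)) (++-assoc (edges r) (edges S) l)

        -- A theta with branch vertices a and y and paths p₁, S and the arc through r, e and p₂. The
        -- cycle of p₁ and S lies in the balanced component, so balance passes from one of the other
        -- two cycles to the other.
        exchange : ∀ {a y} → a ≢ y → (r : Walk u a) (p₁ S : Walk a y) (p₂ : Walk y v) →
          Simple r → Simple p₁ → Simple S → Simple p₂ →
          (∀ {x} → x ∈ˡ verts r → x ∈ˡ verts p₁ → x ≡ a) → (∀ {x} → x ∈ˡ verts p₂ → x ∈ˡ verts p₁ → x ≡ y) →
          (∀ {x} → x ∈ˡ verts r → x ∈ˡ verts S → x ≡ a) → (∀ {x} → x ∈ˡ verts p₂ → x ∈ˡ verts S → x ≡ y) →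
          (∀ {x} → x ∈ˡ verts r → x ∉ˡ verts p₂) → Apart p₁ S → r inside X → p₁ inside X → S inside X →
          Closes (edges r ++ edges p₁ ++ edges p₂) → Closes (edges r ++ edges S ++ edges p₂)
        exchange a≢y r p₁ S p₂ sr s₁ sS s₂ rp pp rS pS rp₂ p₁S ir i₁ iS h =
          trans (cong cls (sym (through-closing r J p₂ (edges S))))
            (theta-bal a≢y p₁ S (through r J p₂) s₁ sS (through-simple r J p₂ sr s₂ rp₂) p₁S
              (ap s₁ i₁ rp pp) (ap sS iS rS pS) old (trans (cong cls (through-closing r J p₂ (edges p₁))) h))
          where
          J = joins-ends e
          ap : ∀ {t : Walk _ _} → Simple t → t inside X → (∀ {x} → x ∈ˡ verts r → x ∈ˡ verts t → x ≡ _) →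
            (∀ {x} → x ∈ˡ verts p₂ → x ∈ˡ verts t → x ≡ _) → Apart t (through r J p₂)
          ap {t} st it hr hp = Apart-through r J p₂ hr hp
            (λ f∈ f∈r → meet-once⇒edges-disjoint r t sr hr f∈r f∈) (λ f∈ f∈p → meet-once⇒edges-disjoint p₂ t s₂ hp f∈p f∈) (e∉X ∘ it)
          old : cls (fromList (edges p₁ ++ edges S)) ≡ bal
          old with joinPaths a≢y p₁ S s₁ sS p₁S
          ... | C , eqE , v⁻ , _ = trans (cong cls (sym eqE)) (balanced C
            (λ f∈ → [ i₁ , iS ]′ (∈-++⁻ (edges p₁) (∈-fromList⁻ (subst (_ ∈_) eqE f∈))))
            (λ x∈ → R-trans (R-walk r ir (end∈ r)) ([ R-walk p₁ i₁ , R-walk S iS ]′ (v⁻ x∈))))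

        -- Induction on the part q of the target path still to be followed. The part r is already
        -- shared, and each round replaces the beginning of p by that of q without losing balance.
        go : ∀ fuel {a} (r : Walk u a) (p q : Walk a v) → len q ≤ fuel → Simple r → Simple p → Simple q →
          (∀ {x} → x ∈ˡ verts r → x ∈ˡ verts p → x ≡ a) → (∀ {x} → x ∈ˡ verts r → x ∈ˡ verts q → x ≡ a) →
          r inside X → p inside X → q inside X → Closes (edges r ++ edges p) → Closes (edges r ++ edges q)

        advance : ∀ fuel {a y} (r : Walk u a) (S : Walk a y) (p q : Walk y v) → len q ≤ fuel →
          Simple r → Simple S → Simple p → Simple q →
          (∀ {x} → x ∈ˡ verts r → x ∈ˡ verts S → x ≡ a) →
          (∀ {x} → x ∈ˡ verts r → x ∈ˡ verts p → x ≡ a) → (∀ {x} → x ∈ˡ verts r → x ∈ˡ verts q → x ≡ a) →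
          (∀ {x} → x ∈ˡ verts S → x ∈ˡ verts p → x ≡ y) → (∀ {x} → x ∈ˡ verts S → x ∈ˡ verts q → x ≡ y) →
          r inside X → S inside X → p inside X → q inside X →
          Closes (edges r ++ edges S ++ edges p) → Closes (edges r ++ edges S ++ edges q)
        advance fuel r S p q le sr sS sp sq rS rp rq Sp Sq ir iS ip iq h =
          subst Closes (edges-⊕-++ r S (edges q))
            (go fuel (r ⊕ S) p q le (simple-⊕ r S sr sS rS) sp sq (ov p rp Sp) (ov q rq Sq)
              (λ f∈ → [ ir , iS ]′ (edges-⊕⁻ r S f∈)) ip iq (subst Closes (sym (edges-⊕-++ r S (edges p))) h))
          where
          ov : ∀ (t : Walk _ v) → (∀ {x} → x ∈ˡ verts r → x ∈ˡ verts t → x ≡ _) → (∀ {x} → x ∈ˡ verts S → x ∈ˡ verts t → x ≡ _) →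
            ∀ {x} → x ∈ˡ verts (r ⊕ S) → x ∈ˡ verts t → x ≡ _
          ov t h₁ h₂ x∈ x∈t with verts-⊕⁻ r S x∈
          ... | inj₂ x∈S = h₂ x∈S x∈t
          ... | inj₁ x∈r with h₁ x∈r x∈t
          ... | refl = h₂ (start∈ S) x∈t

        -- q leaves p at a along an edge d not in p, and S₁ is the part of q up to its next visit y to p.
        detour : ∀ fuel {a b y} (r : Walk u a) (p₁ : Walk a y) (p₂ : Walk y v) (d : Fin m) (j : Joins G d a b) (S₁ : Walk b y) (q : Walk y v) →
          len q ≤ fuel → Simple r → Simple (p₁ ⊕ p₂) → Simple (cons d j (S₁ ⊕ q)) →
          (∀ {x} → x ∈ˡ verts r → x ∈ˡ verts (p₁ ⊕ p₂) → x ≡ a) → (∀ {x} → x ∈ˡ verts r → x ∈ˡ verts (cons d j (S₁ ⊕ q)) → x ≡ a) →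
          r inside X → (p₁ ⊕ p₂) inside X → cons d j (S₁ ⊕ q) inside X → d ∉ˡ edges (p₁ ⊕ p₂) →
          (∀ {z} → z ∈ˡ verts S₁ → z ∈ˡ verts (p₁ ⊕ p₂) → z ≡ y) →
          Closes (edges r ++ edges p₁ ++ edges p₂) → Closes (edges r ++ edges (cons d j S₁) ++ edges q)
        detour fuel {a} {b} {y} r p₁ p₂ d j S₁ q le sr sp (a∉q , sq) rp rq ir ip iq d∉p hit h =
          advance fuel r S p₂ q le sr sS s₂ (simple-⊕ʳ S₁ q sq) rS (λ x∈ z → rp x∈ (verts-⊕ʳ p₁ p₂ z))
            (λ x∈ z → rq x∈ (there (verts-⊕ʳ S₁ q z))) S∩p₂ S∩q ir iS (λ f∈ → ip (edges-⊕ʳ p₁ p₂ f∈)) (λ f∈ → iq (there (edges-⊕ʳ S₁ q f∈)))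
            (exchange a≢y r p₁ S p₂ sr s₁ sS s₂ (λ x∈ z → rp x∈ (verts-⊕ˡ p₁ p₂ z)) (λ x∈ z → simple-overlap p₁ p₂ sp z x∈)
              rS (λ x∈ z → S∩p₂ z x∈) r∩p₂
              (apart (λ x∈ z → S∩p z (verts-⊕ˡ p₁ p₂ x∈)) λ { f∈ (here refl) → d∉p (edges-⊕ˡ p₁ p₂ f∈)
                ; f∈ (there z) → meet-once⇒edges-disjoint S₁ (p₁ ⊕ p₂) (proj₂ sS) hit z (edges-⊕ˡ p₁ p₂ f∈) })
              ir (λ f∈ → ip (edges-⊕ˡ p₁ p₂ f∈)) iS h)
          where
          S = cons d j S₁
          s₁ : Simple p₁
          s₁ = simple-⊕ˡ p₁ p₂ sp
          s₂ : Simple p₂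
          s₂ = simple-⊕ʳ p₁ p₂ sp
          a∉S₁ : a ∉ˡ verts S₁
          a∉S₁ x∈ = a∉q (verts-⊕ˡ S₁ q x∈)
          sS : Simple S
          sS = a∉S₁ , simple-⊕ˡ S₁ q sq
          iS : S inside X
          iS (here refl) = iq (here refl)
          iS (there f∈) = iq (there (edges-⊕ˡ S₁ q f∈))
          rS : ∀ {x} → x ∈ˡ verts r → x ∈ˡ verts S → x ≡ a
          rS x∈ (here refl) = refl
          rS x∈ (there z) = rq x∈ (there (verts-⊕ˡ S₁ q z))
          a≢y : a ≢ y
          a≢y refl = a∉S₁ (end∈ S₁)
          a∉p₂ : a ∉ˡ verts p₂
          a∉p₂ x∈ = a≢y (simple-overlap p₁ p₂ sp (start∈ p₁) x∈)
          S∩p : ∀ {x} → x ∈ˡ verts S → x ∈ˡ verts (p₁ ⊕ p₂) → x ≡ a ⊎ x ≡ y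
          S∩p (here refl) z = inj₁ refl
          S∩p (there x∈) z = inj₂ (hit x∈ z)
          S∩p₂ : ∀ {x} → x ∈ˡ verts S → x ∈ˡ verts p₂ → x ≡ y
          S∩p₂ (here refl) z = contradiction z a∉p₂
          S∩p₂ (there x∈) z = hit x∈ (verts-⊕ʳ p₁ p₂ z)
          S∩q : ∀ {x} → x ∈ˡ verts S → x ∈ˡ verts q → x ≡ y
          S∩q (here refl) z = contradiction (verts-⊕ʳ S₁ q z) a∉q
          S∩q (there x∈) z = simple-overlap S₁ q sq x∈ z
          r∩p₂ : ∀ {x} → x ∈ˡ verts r → x ∉ˡ verts p₂
          r∩p₂ x∈ z with rp x∈ (verts-⊕ʳ p₁ p₂ z)
          ... | refl = a∉p₂ z

        go fuel r p [] le sr sp sq rp rq ir ip iq h with simple-closed p sp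
        ... | refl = h
        go fuel r [] (cons d j q) le sr sp (a∉ , sq) rp rq ir ip iq h = contradiction (end∈ q) a∉
        go (suc fuel) {a} r (cons f k p) (cons d j q) (s≤s le) sr (a∉p , sp) (a∉q , sq) rp rq ir ip iq h with d ≟ᶠ f
        -- Both paths leave a by the same edge, which is moved to the shared part.
        ... | yes refl with joins-target k j
        ... | refl = advance fuel r (cons d j []) p q le sr ((λ { (here refl) → a∉p (start∈ p) }) , tt) sp sq
                  (λ { x∈ (here refl) → refl ; x∈ (there (here refl)) → rq x∈ (there (here refl)) })
                  (λ x∈ y → rp x∈ (there y)) (λ x∈ y → rq x∈ (there y)) (one a∉p) (one a∉q)
                  ir (λ { (here refl) → iq (here refl) }) (ip ∘ there) (iq ∘ there) h
          where
          one : ∀ {t : Walk _ v} → a ∉ˡ verts t → ∀ {x} → x ∈ˡ verts (cons d j []) → x ∈ˡ verts t → x ≡ _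
          one a∉ (here refl) y = contradiction y a∉
          one a∉ (there (here refl)) y = refl
        go (suc fuel) r p′@(cons f k p) (cons d j q) (s≤s le) sr sp′@(a∉p , sp) sq′ rp rq ir ip iq h | no d≢f
          -- The remainder after the detour is no longer than q, so the fuel left after the edge d
          -- suffices.
          with first-hit (_∈ˡ? verts p′) q (end∈ q) (end∈ p′)
        ... | y , S₁ , q₃ , refl , y∈p , hit with split-vertex p′ y∈p
        ... | p₁ , p₂ , eq = subst Closes (cong (λ l → edges r ++ d ∷ l) (sym (edges-⊕ S₁ q₃)))
          (detour fuel r p₁ p₂ d j S₁ q₃ (ℕₚ.≤-trans (len-⊕ʳ S₁ q₃) le) sr (subst Simple eq sp′) sq′
            (λ x∈ z → rp x∈ (subst (λ t → _ ∈ˡ verts t) (sym eq) z)) rq ir (λ z → ip (subst (λ t → _ ∈ˡ edges t) (sym eq) z)) iq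
            (λ z → d∉p (subst (λ t → _ ∈ˡ edges t) (sym eq) z)) (λ z∈ z → hit z∈ (subst (λ t → _ ∈ˡ verts t) (sym eq) z))
            (subst Closes (cong (edges r ++_) (trans (cong edges eq) (edges-⊕ p₁ p₂))) h))
          where
          len-⊕ʳ : ∀ {a b c} (p : Walk a b) (q : Walk b c) → len q ≤ len (p ⊕ q)
          len-⊕ʳ [] q = ℕₚ.≤-refl
          len-⊕ʳ (cons _ _ p) q = ℕₚ.m≤n⇒m≤1+n (len-⊕ʳ p q)
          d∉p : d ∉ˡ edges p′
          d∉p (here d≡f) = d≢f d≡f
          d∉p (there d∈) = a∉p (proj₁ (edge-ends p d∈ j))

      opaque
        reroute : (p q : Walk u v) → Simple p → Simple q → p inside X → q inside X →
          cls (fromList (e ∷ edges p)) ≡ bal → cls (fromList (e ∷ edges q)) ≡ bal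
        reroute p q sp sq ip iq h = go (len q) [] p q ℕₚ.≤-refl tt sp sq
          (λ { (here refl) _ → refl }) (λ { (here refl) _ → refl }) (λ ()) ip iq h

    E : Cycle G → Subset m
    E = Cycle.E
    V : Cycle G → Subset n
    V = Cycle.V

    Balanced : Subset m → Set
    Balanced X = ∀ C → E C ⊆ X → cls (E C) ≡ bal

    -- Closure

    BalAt : Subset m → Fin n → Set
    BalAt X u = ∀ C → E C ⊆ X → ∀ {x} → x ∈ V C → R X u x → cls (E C) ≡ bal

    UnbAt : Subset m → Fin n → Set
    UnbAt X u = ∃[ C ] (E C ⊆ X × cls (E C) ≢ bal × ∃[ x ] (x ∈ V C × R X u x))

    HasL : Subset m → Set
    HasL X = ∃[ C ] (E C ⊆ X × cls (E C) ≡ lft)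

    FAt : Subset m → Fin n → Set
    FAt X u = ∃[ C ] (E C ⊆ X × cls (E C) ≡ frm × ∃[ x ] (x ∈ V C × R X u x))

    Bal : Subset m → Fin m → Set
    Bal X e = ∃[ C ] (e ∈ E C × E C ⊆ X ▸ e × cls (E C) ≡ bal)

    -- The graph-theoretic form of Matroid.InClosure.
    data Dep (X : Subset m) (e : Fin m) : Set where
      member    : e ∈ X → Dep X e
      by-bal    : Bal X e → Dep X e
      by-full   : R X (src e) (tgt e) → HasL X ⊎ FAt X (src e) → Dep X e
      by-frames : FAt X (src e) → FAt X (tgt e) → Dep X e

    HasL-mono : ∀ {X Y} → X ⊆ Y → HasL X → HasL Y
    HasL-mono s (C , i , k) = C , s ∘ i , k

    FAt-mono : ∀ {X Y u} → X ⊆ Y → FAt X u → FAt Y u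
    FAt-mono s (C , i , k , x , x∈ , r) = C , s ∘ i , k , x , x∈ , R-mono s r

    FAt-R : ∀ {X u v} → R X u v → FAt X v → FAt X u
    FAt-R r (C , i , k , x , x∈ , r′) = C , i , k , x , x∈ , R-trans r r′

    Bal-mono : ∀ {X Y e} → X ⊆ Y → Bal X e → Bal Y e
    Bal-mono s (C , e∈ , i , k) = C , e∈ , ▸-mono s ∘ i , k

    Dep-mono : ∀ {X Y e} → X ⊆ Y → Dep X e → Dep Y e
    Dep-mono s (member x) = member (s x)
    Dep-mono s (by-bal b) = by-bal (Bal-mono s b)
    Dep-mono s (by-full r f) = by-full (R-mono s r) (Sum.map (HasL-mono s) (FAt-mono s) f)
    Dep-mono s (by-frames f g) = by-frames (FAt-mono s f) (FAt-mono s g)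

    BalAt-R : ∀ {X u v} → R X u v → BalAt X u → BalAt X v
    BalAt-R r b C i x∈ r′ = b C i x∈ (R-trans r r′)

    opened-inside : ∀ {X e C} → E C ⊆ X ▸ e → (o : Opened C e) → Opened.path o inside X
    opened-inside sub o f∈ with ▸⁻ (sub (Opened.E⁺ o (there f∈)))
    ... | inj₁ f∈X = f∈X
    ... | inj₂ refl = contradiction f∈ (Opened.e∉ o)

    src∈V : ∀ C {e} → e ∈ E C → src e ∈ V C
    src∈V C e∈ = Opened.V⁺ (openAt C e∈) (start∈ _)

    tgt∈V : ∀ C {e} → e ∈ E C → tgt e ∈ V C
    tgt∈V C e∈ = Opened.V⁺ (openAt C e∈) (end∈ (Opened.path (openAt C e∈)))

    -- Removing e from the cycle leaves a path through all of its vertices.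
    cycle-R : ∀ {X e} C {x y} → e ∈ E C → E C ⊆ X ▸ e → x ∈ V C → y ∈ V C → R X x y
    cycle-R C e∈ sub x∈ y∈ = R-trans (R-sym (r x∈)) (r y∈)
      where
      o = openAt C e∈
      r : ∀ {x} → x ∈ V C → R _ _ x
      r x∈ = R-walk (Opened.path o) (opened-inside sub o) (Opened.V⁻ o x∈)

    cycle-connected : ∀ {X} C {x y} → E C ⊆ X → x ∈ V C → y ∈ V C → R X x y
    cycle-connected C sub = cycle-R C (proj₂ (cycle-edge C)) (▸ˡ ∘ sub)

    cycle-▸ : ∀ {X e} C → E C ⊆ X ▸ e → E C ⊆ X ⊎ e ∈ E C
    cycle-▸ {e = e} C sub with e ∈? E C
    ... | yes e∈ = inj₂ e∈
    ... | no e∉ = inj₁ λ f∈ → [ id , (λ { refl → contradiction f∈ e∉ }) ]′ (▸⁻ (sub f∈))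

    Bal-chord : ∀ {X e} → Bal X e → R X (src e) (tgt e)
    Bal-chord (C , e∈ , sub , _) = cycle-R C e∈ sub (src∈V C e∈) (tgt∈V C e∈)

    opaque
      chord-cycle : ∀ {X e} → e ∉ X → R X (src e) (tgt e) →
        ∃[ C ] (e ∈ E C × E C ⊆ X ▸ e × (∀ {x} → x ∈ V C → R X (src e) x))
      chord-cycle {X} {e} e∉ r with simplePath r
      ... | p , s , sub with close p s (flipJ (joins-ends e)) (e∉ ∘ sub)
      ... | C , eqE , v⁻ , _ = C , subst (e ∈_) (sym eqE) (∈-fromList⁺ (here refl))
        , (λ f∈ → case (∈-fromList⁻ (subst (_ ∈_) eqE f∈))) , R-walk p sub ∘ v⁻
        where
        case : ∀ {f} → f ∈ˡ e ∷ edges p → f ∈ X ▸ e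
        case (here refl) = ▸ʳ
        case (there f∈) = ▸ˡ (sub f∈)

    -- A new cycle contains e, and so does the given balanced one. Opened at e, they are two paths
    -- of X with the same ends, and `reroute` carries balance over.
    BalAt-▸ : ∀ {X e} → BalAt X (src e) → Bal X e → BalAt (X ▸ e) (src e)
    BalAt-▸ {X} {e} b bl@(C , e∈C , subC , k) D subD x∈ r with cycle-▸ D subD | e ∈? X
    ... | inj₁ sub | _ = b D sub x∈ (R-▸-chord (Bal-chord bl) r)
    ... | inj₂ e∈D | yes e∈X = b D (λ f∈ → ▸-least id e∈X (subD f∈)) x∈ (R-▸-chord (Bal-chord bl) r)
    ... | inj₂ e∈D | no e∉X = trans (cong cls (Opened.E≡ o′))
      (reroute X e e∉X (λ C′ i h → b C′ i (src∈V C′ (proj₂ (cycle-edge C′))) (h (src∈V C′ (proj₂ (cycle-edge C′)))))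
        (path o) (path o′) (simple o) (simple o′) (opened-inside subC o) (opened-inside subD o′)
        (trans (cong cls (sym (Opened.E≡ o))) k))
      where
      open Opened using (path; simple)
      o = openAt C e∈C
      o′ = openAt D e∈D

    Balanced⇒BalAt : ∀ {X u} → Balanced X → BalAt X u
    Balanced⇒BalAt b C sub _ _ = b C sub

    Balanced-▸ : ∀ {X e} → Balanced X → Bal X e → Balanced (X ▸ e)
    Balanced-▸ {X} {e} b bl D subD with cycle-▸ D subD
    ... | inj₁ sub = b D sub
    ... | inj₂ e∈D = BalAt-▸ (Balanced⇒BalAt b) bl D subD (src∈V D e∈D) rfl

    -- A cycle through e would join the ends of e without it.
    Balanced-bridge : ∀ {X e} → Balanced X → ¬ R X (src e) (tgt e) → Balanced (X ▸ e)
    Balanced-bridge b ¬r D subD with cycle-▸ D subD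
    ... | inj₁ sub = b D sub
    ... | inj₂ e∈D = contradiction (cycle-R D e∈D subD (src∈V D e∈D) (tgt∈V D e∈D)) ¬r

    kind-cases : ∀ C → cls (E C) ≢ bal → cls (E C) ≡ lft ⊎ cls (E C) ≡ frm
    kind-cases C ≢b with cls (E C)
    ... | bal = contradiction refl ≢b
    ... | lft = inj₁ refl
    ... | frm = inj₂ refl

    opaque
      balanced? : ∀ X → Dec (Balanced X)
      balanced? X with anyCycle? (λ E _ → E ⊆ X × cls E ≢ bal) (λ E _ → E ⊆? X ×-dec ¬? (bal? (cls E)))
      ... | yes (C , sub , ≢b) = no λ b → ≢b (b C sub)
      ... | no ¬c = yes λ C sub → [ id , (λ ≢b → ⊥-elim (¬c (C , sub , ≢b))) ]′ (dec-case (bal? (cls (E C))))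
        where
        dec-case : ∀ {P : Set} → Dec P → P ⊎ ¬ P
        dec-case (yes p) = inj₁ p
        dec-case (no ¬p) = inj₂ ¬p

      unbAt? : ∀ X u → Dec (UnbAt X u)
      unbAt? X u = anyCycle? (λ E V → E ⊆ X × cls E ≢ bal × ∃[ x ] (x ∈ V × R X u x))
        (λ E V → E ⊆? X ×-dec (¬? (bal? (cls E)) ×-dec any? (λ x → x ∈? V ×-dec R? X u x)))

      kind≟ : (k l : Kind) → Dec (k ≡ l)
      kind≟ bal bal = yes refl
      kind≟ bal lft = no λ ()
      kind≟ bal frm = no λ ()
      kind≟ lft bal = no λ ()
      kind≟ lft lft = yes refl
      kind≟ lft frm = no λ ()
      kind≟ frm bal = no λ ()
      kind≟ frm lft = no λ ()
      kind≟ frm frm = yes refl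

      hasL? : ∀ X → Dec (HasL X)
      hasL? X = anyCycle? (λ E _ → E ⊆ X × cls E ≡ lft) (λ E _ → E ⊆? X ×-dec kind≟ (cls E) lft)

      FAt? : ∀ X u → Dec (FAt X u)
      FAt? X u = anyCycle? (λ E V → E ⊆ X × cls E ≡ frm × ∃[ x ] (x ∈ V × R X u x))
        (λ E V → E ⊆? X ×-dec (kind≟ (cls E) frm ×-dec any? (λ x → x ∈? V ×-dec R? X u x)))

      Bal? : ∀ X e → Dec (Bal X e)
      Bal? X e = anyCycle? (λ E _ → e ∈ E × E ⊆ X ▸ e × cls E ≡ bal)
        (λ E _ → e ∈? E ×-dec (E ⊆? X ▸ e ×-dec kind≟ (cls E) bal))

      Dep? : ∀ X e → Dec (Dep X e)
      Dep? X e = map′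
        [ member , [ by-bal , [ (λ { (a , b) → by-full a b }) , (λ { (a , b) → by-frames a b }) ]′ ]′ ]′
        (λ { (member a) → inj₁ a ; (by-bal b) → inj₂ (inj₁ b) ; (by-full a b) → inj₂ (inj₂ (inj₁ (a , b)))
           ; (by-frames a b) → inj₂ (inj₂ (inj₂ (a , b))) })
        (e ∈? X ⊎-dec (Bal? X e ⊎-dec ((R? X (src e) (tgt e) ×-dec (hasL? X ⊎-dec FAt? X (src e)))
          ⊎-dec (FAt? X (src e) ×-dec FAt? X (tgt e)))))

    ¬UnbAt⇒BalAt : ∀ {X u} → ¬ UnbAt X u → BalAt X u
    ¬UnbAt⇒BalAt ¬u C sub x∈ r with bal? (cls (E C))
    ... | yes b = b
    ... | no ≢b = ⊥-elim (¬u (C , sub , ≢b , _ , x∈ , r))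

    UnbAt⇒Full : ∀ {X u} → UnbAt X u → HasL X ⊎ FAt X u
    UnbAt⇒Full (C , sub , ≢b , w) with kind-cases C ≢b
    ... | inj₁ k = inj₁ (C , sub , k)
    ... | inj₂ k = inj₂ (C , sub , k , w)

    -- The balanced analogue of a spanning forest: it has the components of X, and each further edge
    -- of X closes only unbalanced cycles with it.
    record MaxBalanced (X A : Subset m) : Set where
      field
        A⊆X      : A ⊆ X
        balanced : Balanced A
        maximal  : ∀ {e} → e ∈ X → e ∉ A → ¬ Balanced (A ▸ e)

      ¬Bal : ∀ {e} → e ∈ X → e ∉ A → ¬ Bal A e
      ¬Bal e∈ e∉ b = maximal e∈ e∉ (Balanced-▸ balanced b)

      -- An edge joining two components of A could be added without creating a cycle, against
      -- maximality.
      spans-edge : ∀ {e} → e ∈ X → R A (src e) (tgt e)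
      spans-edge {e} e∈ with e ∈? A | R? A (src e) (tgt e)
      ... | yes e∈A | _ = R-edge e∈A
      ... | no _ | yes r = r
      ... | no e∉A | no ¬r = contradiction (Balanced-bridge balanced ¬r) (maximal e∈ e∉A)

      spans : ∀ {u v} → R X u v → R A u v
      spans rfl = rfl
      spans (cns {e} e∈ j r) with joins-unique (joins-ends e) j
      ... | inj₁ (refl , refl) = R-trans (spans-edge e∈) (spans r)
      ... | inj₂ (refl , refl) = R-trans (R-sym (spans-edge e∈)) (spans r)

    opaque
      maxBalanced : ∀ X {A} → A ⊆ X → Balanced A → ∃[ B ] (A ⊆ B × MaxBalanced X B)
      maxBalanced X A⊆X bA with grow (λ B → B ⊆? X ×-dec balanced? B) ((λ {x} → A⊆X {x}) , bA)
      ... | B , A⊆B , (B⊆X , bB) , mx = B , A⊆B , record { A⊆X = B⊆X ; balanced = bB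
          ; maximal = λ e∈ e∉ b → mx e∉ (▸-least B⊆X e∈ , b) }

    ∅-balanced : Balanced Data.Fin.Subset.⊥
    ∅-balanced C sub = contradiction (sub (proj₂ (cycle-edge C))) ∉⊥

    loose : ∀ C D → VDisjoint G C D → cls (E C) ≡ frm → cls (E D) ≡ frm →
      ∀ {c d} (w : Walk c d) → Simple w → c ∈ V C → d ∈ V D →
      (∀ {z} → z ∈ˡ verts w → z ∈ V C → z ≡ c) → (∀ {z} → z ∈ˡ verts w → z ∈ V D → z ≡ d) →
      ∃[ S ] (Circuit G cls S × (∀ {f} → f ∈ S → f ∈ E C ⊎ f ∈ E D ⊎ f ∈ˡ edges w) ×
              (∀ {f} → f ∈ E C ⊎ f ∈ E D ⊎ f ∈ˡ edges w → f ∈ S))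
    loose C D dis kC kD {c} {d} w sw c∈ d∈ hC hD = _ ,
      loose-handcuff C D dis (toPath w sw) c∈ (subst (_∈ V D) (sym (vertexAt-last w)) d∈)
        (λ x x∈ → [ (λ y → inj₁ (hC (toPath-V⁻ w sw x∈) y))
                  , (λ y → inj₂ (trans (hD (toPath-V⁻ w sw x∈) y) (sym (vertexAt-last w)))) ]′)
        refl kC kD ,
      (λ f∈ → Sum.map₂ (λ y → Sum.map₂ (toPath-E⁻ w sw) (x∈p∪q⁻ _ _ y)) (x∈p∪q⁻ _ _ f∈)) ,
      (λ f∈ → x∈p∪q⁺ (Sum.map₂ (λ y → x∈p∪q⁺ (Sum.map₂ (toPath-E⁺ w sw) y)) f∈))

    lft≢bal : lft ≢ bal
    lft≢bal ()

    frm≢bal : frm ≢ bal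
    frm≢bal ()

    VDisjoint⁺ : ∀ C D → (∀ {x} → x ∈ V C → x ∉ V D) → VDisjoint G C D
    VDisjoint⁺ C D h (x , x∈) with a , b ← x∈p∩q⁻ (V C) (V D) x∈ = h a b

    lf-disjoint : ∀ C D → cls (E C) ≡ lft → cls (E D) ≡ frm → ¬ (∀ {x} → x ∈ V C → x ∉ V D)
    lf-disjoint C D kC kD h with lf-meet C D kC kD
    ... | x , x∈ with a , b ← x∈p∩q⁻ (V C) (V D) x∈ = h a b

    -- Either the third cycle is balanced and is itself a circuit, or all three are unbalanced and
    -- the theta is one. Both contain p₂, on which the prescribed element will be placed.
    theta-or-cycle : ∀ {a b} → a ≢ b → (p₁ p₂ p₃ : Walk a b) → Simple p₁ → Simple p₂ → Simple p₃ → Apart p₁ p₂ → Apart p₁ p₃ → Apart p₂ p₃ →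
      cls (fromList (edges p₁ ++ edges p₂)) ≢ bal → cls (fromList (edges p₁ ++ edges p₃)) ≢ bal →
      ∃[ S ] (Circuit G cls S × (∀ {f} → f ∈ˡ edges p₂ → f ∈ S) × (∀ {f} → f ∈ S → f ∈ˡ edges p₁ ⊎ f ∈ˡ edges p₂ ⊎ f ∈ˡ edges p₃))
    theta-or-cycle a≢b p₁ p₂ p₃ s₁ s₂ s₃ a₁₂ a₁₃ a₂₃ u₁₂ u₁₃ with bal? (cls (fromList (edges p₂ ++ edges p₃)))
    ... | yes b with joinPaths a≢b p₂ p₃ s₂ s₃ a₂₃
    ... | K , eqE , _ = E K , balanced-cycle K refl (trans (cong cls eqE) b)
      , (λ f∈ → subst (_ ∈_) (sym eqE) (∈-fromList⁺ (∈-++⁺ˡ f∈)))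
      , (λ f∈ → inj₂ (∈-++⁻ (edges p₂) (∈-fromList⁻ (subst (_ ∈_) eqE f∈))))
    theta-or-cycle a≢b p₁ p₂ p₃ s₁ s₂ s₃ a₁₂ a₁₃ a₂₃ u₁₂ u₁₃ | no u₂₃ =
      Theta.E θ , theta θ refl (unb p₁ p₂ s₁ s₂ u₁₂) (unb p₁ p₃ s₁ s₃ u₁₃) (unb p₂ p₃ s₂ s₃ u₂₃)
      , (λ f∈ → x∈p∪q⁺ (inj₂ (x∈p∪q⁺ (inj₁ (toPath-E⁺ p₂ s₂ f∈)))))
      , (λ f∈ → Sum.map (toPath-E⁻ p₁ s₁) (λ w → Sum.map (toPath-E⁻ p₂ s₂) (toPath-E⁻ p₃ s₃) (x∈p∪q⁻ _ _ w)) (x∈p∪q⁻ _ _ f∈))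
      where
      θ = mkTheta a≢b p₁ p₂ p₃ s₁ s₂ s₃ a₁₂ a₁₃ a₂₃
      unb : ∀ (p q : Walk _ _) (sp : Simple p) (sq : Simple q) → cls (fromList (edges p ++ edges q)) ≢ bal →
        cls (Path.E (toPath p sp) ∪ Path.E (toPath q sq)) ≢ bal
      unb p q sp sq h b = h (trans (cong cls (sym (toPath-∪ p q sp sq))) b)

    -- Two unbalanced chords of a balanced set: a circuit through the first

    module TwoChords (A : Subset m) (bA : Balanced A) (e d : Fin m) (e∉A : e ∉ A) (d∉A : d ∉ A) (e≢d : e ≢ d)
      (p : Walk (src e) (tgt e)) (sp : Simple p) (ip : p inside A) (unb-p : cls (fromList (e ∷ edges p)) ≢ bal)
      (q : Walk (src d) (tgt d)) (sq : Simple q) (iq : q inside A) (unb-q : cls (fromList (d ∷ edges q)) ≢ bal)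
      where

      Goal : Set
      Goal = ∃[ S ] (Circuit G cls S × e ∈ S × (∀ {f} → f ∈ S → f ∈ A ▸ d ⊎ f ≡ e))

      private
        A+ : ∀ {f} → f ∈ A → f ∈ A ▸ d ⊎ f ≡ e
        A+ f∈ = inj₁ (▸ˡ f∈)

        Cp = close p sp (flipJ (joins-ends e)) (e∉A ∘ ip)
        Cq = close q sq (flipJ (joins-ends d)) (d∉A ∘ iq)
        C = proj₁ Cp
        D = proj₁ Cq

        C-E : E C ≡ fromList (e ∷ edges p)
        C-E = proj₁ (proj₂ Cp)
        D-E : E D ≡ fromList (d ∷ edges q)
        D-E = proj₁ (proj₂ Cq)
        C-V : ∀ {x} → x ∈ V C → x ∈ˡ verts p
        C-V = proj₁ (proj₂ (proj₂ Cp))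
        D-V : ∀ {x} → x ∈ V D → x ∈ˡ verts q
        D-V = proj₁ (proj₂ (proj₂ Cq))
        V-C : ∀ {x} → x ∈ˡ verts p → x ∈ V C
        V-C = proj₂ (proj₂ (proj₂ Cp))
        V-D : ∀ {x} → x ∈ˡ verts q → x ∈ V D
        V-D = proj₂ (proj₂ (proj₂ Cq))

        E-C : ∀ {f} → f ∈ E C → f ∈ˡ e ∷ edges p
        E-C f∈ = ∈-fromList⁻ (subst (_ ∈_) C-E f∈)
        E-D : ∀ {f} → f ∈ E D → f ∈ˡ d ∷ edges q
        E-D f∈ = ∈-fromList⁻ (subst (_ ∈_) D-E f∈)
        e∈C : e ∈ E C
        e∈C = subst (e ∈_) (sym C-E) (∈-fromList⁺ (here refl))

        unb-C : cls (E C) ≢ bal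
        unb-C b = unb-p (trans (cong cls (sym C-E)) b)
        unb-D : cls (E D) ≢ bal
        unb-D b = unb-q (trans (cong cls (sym D-E)) b)

        C⊆ : ∀ {f} → f ∈ E C → f ∈ A ▸ d ⊎ f ≡ e
        C⊆ f∈ with E-C f∈
        ... | here refl = inj₂ refl
        ... | there y = A+ (ip y)
        D⊆ : ∀ {f} → f ∈ E D → f ∈ A ▸ d ⊎ f ≡ e
        D⊆ f∈ with E-D f∈
        ... | here refl = inj₁ ▸ʳ
        ... | there y = A+ (iq y)

        -- The theta consists of the segment pm of p, the rest of p with e, and the outer parts of q
        -- with d. The two cycles through pm are unbalanced, the first by hypothesis and the second
        -- by rerouting, so `theta-or-cycle` applies.
        theta-case : ∀ {a b x y} → a ≢ b → (pa : Walk (src e) a) (pm : Walk a b) (pb : Walk b (tgt e)) →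
          p ≡ pa ⊕ (pm ⊕ pb) → (q₁ : Walk x a) (q₂ : Walk b y) → Joins G d x y → Simple q₁ → Simple q₂ →
          (∀ {z} → z ∈ˡ verts q₁ → z ∈ˡ verts p → z ≡ a) → (∀ {z} → z ∈ˡ verts q₂ → z ∈ˡ verts p → z ≡ b) →
          (∀ {z} → z ∈ˡ verts q₁ → z ∉ˡ verts q₂) → q₁ inside A → q₂ inside A →
          cls (fromList (d ∷ edges q₁ ++ edges pm ++ edges q₂)) ≢ bal → Goal
        theta-case {a} {b} {x} {y} a≢b pa pm pb refl q₁ q₂ jd s₁ s₂ h₁ h₂ dis i₁ i₂ unb₁₃ =
          wrap (theta-or-cycle a≢b pm T₂ T₃ spm (through-simple pa je pb spa spb ab) (through-simple q₁ jd q₂ s₁ s₂ dis)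
            (Apart-through pa je pb am (λ z∈ w∈ → mb w∈ z∈) (λ f∈ w → meet-once⇒edges-disjoint pa pm spa am w f∈)
              (meet-once⇒edges-disjoint pm pb spm mb) (e∉A ∘ ip ∘ em))
            (apart (λ z∈ → pT₃ (vm z∈)) (λ f∈ → p∩T₃ (em f∈)))
            (apart (λ z∈ → pT₃ ([ va , vb ]′ (through-verts pa je pb z∈)))
              (λ f∈ → [ (λ w → p∩T₃ (ea w)) , [ (λ { refl → e∉T₃ }) , (λ w → p∩T₃ (eb w)) ]′ ]′ (through-edges⁻ pa je pb f∈)))
            (λ c → unb-p (trans (cong (λ l → cls (fromList (e ∷ l))) (trans (edges-⊕ pa _) (cong (edges pa ++_) (edges-⊕ pm pb))))
              (trans (cong cls (sym (through-closing pa je pb (edges pm)))) c)))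
            (λ c → unb₁₃ (trans (cong cls (sym (through-closing q₁ jd q₂ (edges pm)))) c)))
          where
          je = joins-ends e
          T₂ = through pa je pb
          T₃ = through q₁ jd q₂
          spa : Simple pa
          spa = simple-⊕ˡ pa _ sp
          sr : Simple (pm ⊕ pb)
          sr = simple-⊕ʳ pa _ sp
          spm : Simple pm
          spm = simple-⊕ˡ pm pb sr
          spb : Simple pb
          spb = simple-⊕ʳ pm pb sr
          va : ∀ {z} → z ∈ˡ verts pa → z ∈ˡ verts p
          va = verts-⊕ˡ pa _
          vm : ∀ {z} → z ∈ˡ verts pm → z ∈ˡ verts p
          vm z∈ = verts-⊕ʳ pa _ (verts-⊕ˡ pm pb z∈)
          vb : ∀ {z} → z ∈ˡ verts pb → z ∈ˡ verts p
          vb z∈ = verts-⊕ʳ pa _ (verts-⊕ʳ pm pb z∈)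
          ea : ∀ {z} → z ∈ˡ edges pa → z ∈ˡ edges p
          ea = edges-⊕ˡ pa _
          em : ∀ {z} → z ∈ˡ edges pm → z ∈ˡ edges p
          em z∈ = edges-⊕ʳ pa _ (edges-⊕ˡ pm pb z∈)
          eb : ∀ {z} → z ∈ˡ edges pb → z ∈ˡ edges p
          eb z∈ = edges-⊕ʳ pa _ (edges-⊕ʳ pm pb z∈)
          am : ∀ {z} → z ∈ˡ verts pa → z ∈ˡ verts pm → z ≡ a
          am z∈ w∈ = simple-overlap pa _ sp z∈ (verts-⊕ˡ pm pb w∈)
          mb : ∀ {z} → z ∈ˡ verts pm → z ∈ˡ verts pb → z ≡ b
          mb = simple-overlap pm pb sr
          ab : ∀ {z} → z ∈ˡ verts pa → z ∉ˡ verts pb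
          ab z∈ w∈ with simple-overlap pa _ sp z∈ (verts-⊕ʳ pm pb w∈)
          ... | refl = a≢b (mb (start∈ pm) w∈)
          p∩T₃ : ∀ {f} → f ∈ˡ edges p → f ∉ˡ edges T₃
          p∩T₃ f∈ f∈′ with through-edges⁻ q₁ jd q₂ f∈′
          ... | inj₁ w = meet-once⇒edges-disjoint q₁ p s₁ h₁ w f∈
          ... | inj₂ (inj₁ refl) = d∉A (ip f∈)
          ... | inj₂ (inj₂ w) = meet-once⇒edges-disjoint q₂ p s₂ h₂ w f∈
          pT₃ : ∀ {z} → z ∈ˡ verts p → z ∈ˡ verts T₃ → z ≡ a ⊎ z ≡ b
          pT₃ z∈ w∈ = Sum.map (λ w → h₁ w z∈) (λ w → h₂ w z∈) (through-verts q₁ jd q₂ w∈)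
          e∉T₃ : e ∉ˡ edges T₃
          e∉T₃ e∈ with through-edges⁻ q₁ jd q₂ e∈
          ... | inj₁ w = e∉A (i₁ w)
          ... | inj₂ (inj₁ e≡d) = e≢d e≡d
          ... | inj₂ (inj₂ w) = e∉A (i₂ w)
          wrap : ∃[ S ] (Circuit G cls S × (∀ {f} → f ∈ˡ edges T₂ → f ∈ S) ×
                   (∀ {f} → f ∈ S → f ∈ˡ edges pm ⊎ f ∈ˡ edges T₂ ⊎ f ∈ˡ edges T₃)) → Goal
          wrap (S , c , T₂⊆ , S⊆) = S , c , T₂⊆ (through-edges⁺ pa je pb (inj₂ (inj₁ refl)))
            , λ f∈ → [ A+ ∘ ip ∘ em , [ (λ w → [ A+ ∘ ip ∘ ea , [ inj₂ , A+ ∘ ip ∘ eb ]′ ]′ (through-edges⁻ pa je pb w))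
                     , (λ w → [ A+ ∘ i₁ , [ (λ { refl → inj₁ ▸ʳ }) , A+ ∘ i₂ ]′ ]′ (through-edges⁻ q₁ jd q₂ w)) ]′ ]′ (S⊆ f∈)

        meeting : ∀ {y} → y ∈ˡ verts q → y ∈ˡ verts p → Goal
        -- The vertices a and b are the first and the last of q on p. Between them q may meet p
        -- arbitrarily, so that part is discarded and a segment of p takes its place.
        meeting y∈q y∈p with first-hit (_∈ˡ? verts p) q y∈q y∈p
        ... | a , q₁ , q′ , eq₁ , a∈p , hit₁ with last-hit (_∈ˡ? verts p) q′ (start∈ q′) a∈p
        ... | b , qm , q₂ , refl , b∈p , hit₂ = by-position (a ≟ᶠ b)
          where
          sqq : Simple (q₁ ⊕ (qm ⊕ q₂))
          sqq = subst Simple eq₁ sq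
          s₁ : Simple q₁
          s₁ = simple-⊕ˡ q₁ _ sqq
          s′ : Simple (qm ⊕ q₂)
          s′ = simple-⊕ʳ q₁ _ sqq
          s₂ : Simple q₂
          s₂ = simple-⊕ʳ qm q₂ s′
          i₁ : q₁ inside A
          i₁ f∈ = iq (subst (λ z → _ ∈ˡ edges z) (sym eq₁) (edges-⊕ˡ q₁ _ f∈))
          i₂ : q₂ inside A
          i₂ f∈ = iq (subst (λ z → _ ∈ˡ edges z) (sym eq₁) (edges-⊕ʳ q₁ _ (edges-⊕ʳ qm q₂ f∈)))

          module _ (a≢b : a ≢ b) where
            dis : ∀ {z} → z ∈ˡ verts q₁ → z ∉ˡ verts q₂
            dis z∈ w∈ with simple-overlap q₁ _ sqq z∈ (verts-⊕ʳ qm q₂ w∈)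
            ... | refl = a≢b (simple-overlap qm q₂ s′ (start∈ qm) w∈)

            -- After the replacement q is still a path of the balanced set A between the ends of d,
            -- so by `reroute` it closes a balanced cycle only if q does.
            unb₁₃ : (r : Walk a b) → Simple r → r inside A → (∀ {z} → z ∈ˡ verts r → z ∈ˡ verts p) →
              cls (fromList (d ∷ edges q₁ ++ edges r ++ edges q₂)) ≢ bal
            unb₁₃ r sr ir r⊆p c = unb-q (reroute A d d∉A (λ K sub _ → bA K sub) (q₁ ⊕ (r ⊕ q₂)) q
              (simple-⊕ q₁ (r ⊕ q₂) s₁ (simple-⊕ r q₂ sr s₂ (λ z∈ w∈ → hit₂ w∈ (r⊆p z∈)))
                (λ z∈ w∈ → [ (λ w → hit₁ z∈ (r⊆p w)) , (λ w → contradiction w (dis z∈)) ]′ (verts-⊕⁻ r q₂ w∈)))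
              sq (λ f∈ → [ i₁ , (λ w → [ ir , i₂ ]′ (edges-⊕⁻ r q₂ w)) ]′ (edges-⊕⁻ q₁ _ f∈)) iq
              (subst (λ l → cls (fromList (d ∷ l)) ≡ bal)
                (sym (trans (edges-⊕ q₁ (r ⊕ q₂)) (cong (edges q₁ ++_) (edges-⊕ r q₂)))) c))

            ordered : Goal
            ordered with split-vertex p a∈p
            ... | pa , p′ , eq with verts-⊕⁻ pa p′ (subst (λ z → b ∈ˡ verts z) eq b∈p)
            ordered | pa , p′ , eq | inj₂ b∈p′ with split-vertex p′ b∈p′
            ... | pm , pb , refl = theta-case a≢b pa pm pb eq q₁ q₂ (joins-ends d) s₁ s₂ hit₁ hit₂ dis i₁ i₂
              (unb₁₃ pm (simple-⊕ˡ pm pb (simple-⊕ʳ pa _ (subst Simple eq sp)))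
                (λ f∈ → ip (subst (λ z → _ ∈ˡ edges z) (sym eq) (edges-⊕ʳ pa _ (edges-⊕ˡ pm pb f∈))))
                (λ z∈ → subst (λ z → _ ∈ˡ verts z) (sym eq) (verts-⊕ʳ pa _ (verts-⊕ˡ pm pb z∈))))
            -- Here b precedes a on p; traversing q and d backwards restores the order.
            ordered | pa , p′ , eq | inj₁ b∈pa with split-vertex pa b∈pa
            ... | pb , pm , refl = theta-case (a≢b ∘ sym) pb pm p′ (trans eq (⊕-assoc pb pm p′)) (rev q₂) (rev q₁)
              (flipJ (joins-ends d)) (simple-rev q₂ s₂) (simple-rev q₁ s₁)
              (λ z∈ → hit₂ (verts-rev⁻ q₂ z∈)) (λ z∈ → hit₁ (verts-rev⁻ q₁ z∈))
              (λ z∈ w∈ → dis (verts-rev⁻ q₁ w∈) (verts-rev⁻ q₂ z∈))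
              (λ f∈ → i₂ (edges-rev⁻ q₂ f∈)) (λ f∈ → i₁ (edges-rev⁻ q₁ f∈))
              (λ c → unb₁₃ (rev pm) (simple-rev pm (simple-⊕ʳ pb pm (simple-⊕ˡ _ p′ (subst Simple eq sp))))
                (λ f∈ → ip (subst (λ z → _ ∈ˡ edges z) (sym eq) (edges-⊕ˡ _ p′ (edges-⊕ʳ pb pm (edges-rev⁻ pm f∈)))))
                (λ z∈ → subst (λ z → _ ∈ˡ verts z) (sym eq) (verts-⊕ˡ _ p′ (verts-⊕ʳ pb pm (verts-rev⁻ pm z∈))))
                (trans (cong cls (fromList-cong
                  (∷-⊑ (here refl) (++-⊑ (λ f∈ → there (∈-++⁺ʳ (edges (rev q₂)) (∈-++⁺ʳ (edges pm) (edges-rev⁺ q₁ f∈))))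
                    (++-⊑ (λ f∈ → there (∈-++⁺ʳ (edges (rev q₂)) (∈-++⁺ˡ (edges-rev⁻ pm f∈))))
                          (λ f∈ → there (∈-++⁺ˡ (edges-rev⁺ q₂ f∈))))))
                  (∷-⊑ (here refl) (++-⊑ (λ f∈ → there (∈-++⁺ʳ (edges q₁) (∈-++⁺ʳ (edges (rev pm)) (edges-rev⁻ q₂ f∈))))
                    (++-⊑ (λ f∈ → there (∈-++⁺ʳ (edges q₁) (∈-++⁺ˡ (edges-rev⁺ pm f∈))))
                          (λ f∈ → there (∈-++⁺ˡ (edges-rev⁻ q₁ f∈)))))))) c))
              where
              ⊕-assoc : ∀ {a b c d} (x : Walk a b) (y : Walk b c) (z : Walk c d) → (x ⊕ y) ⊕ z ≡ x ⊕ (y ⊕ z)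
              ⊕-assoc [] y z = refl
              ⊕-assoc (cons f j x) y z = cong (cons f j) (⊕-assoc x y z)

          tight : a ≡ b → Goal
          tight refl with simple-closed qm (simple-⊕ˡ qm q₂ s′)
          ... | refl = E C ∪ E D
            , tight-handcuff C D edis a (V-C a∈p) (V-D (subst (λ z → a ∈ˡ verts z) (sym eq₁) (verts-⊕ʳ q₁ q₂ (start∈ q₂))))
                (λ x x∈C x∈D → once (D-V x∈D) (C-V x∈C)) refl unb-C unb-D
            , x∈p∪q⁺ (inj₁ e∈C) , λ f∈ → [ C⊆ , D⊆ ]′ (x∈p∪q⁻ _ _ f∈)
            where
            once : ∀ {z} → z ∈ˡ verts q → z ∈ˡ verts p → z ≡ a
            once z∈q z∈p with verts-⊕⁻ q₁ q₂ (subst (λ z → _ ∈ˡ verts z) eq₁ z∈q)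
            ... | inj₁ w = hit₁ w z∈p
            ... | inj₂ w = hit₂ w z∈p
            edis : Empty (E C ∩ E D)
            edis (f , f∈) with x∈p∩q⁻ (E C) (E D) f∈
            ... | f∈C , f∈D with E-C f∈C | E-D f∈D
            ... | here refl | here e≡d = e≢d e≡d
            ... | here refl | there w = e∉A (iq w)
            ... | there w | here refl = d∉A (ip w)
            ... | there w | there w′ = meet-once⇒edges-disjoint q p sq once w′ w

          by-position : Dec (a ≡ b) → Goal
          by-position (yes eq) = tight eq
          by-position (no a≢b) = ordered a≢b

        -- Disjoint unbalanced cycles are of one kind. Two lift cycles form a circuit outright. Two
        -- frame cycles need a path in A, trimmed to run from its last vertex on p to the next
        -- vertex on q.
        separate : (∀ {z} → z ∈ˡ verts q → z ∉ˡ verts p) → R A (src e) (src d) → Goal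
        separate dis r with kind-cases C unb-C | kind-cases D unb-D
        ... | inj₁ kC | inj₁ kD = E C ∪ E D , two-L-cycles C D (VDisjoint⁺ C D λ x∈ y∈ → dis (D-V y∈) (C-V x∈)) refl kC kD
          , x∈p∪q⁺ (inj₁ e∈C) , λ f∈ → [ C⊆ , D⊆ ]′ (x∈p∪q⁻ _ _ f∈)
        ... | inj₁ kC | inj₂ kD = ⊥-elim (lf-disjoint C D kC kD λ x∈ y∈ → dis (D-V y∈) (C-V x∈))
        ... | inj₂ kC | inj₁ kD = ⊥-elim (lf-disjoint D C kD kC λ x∈ y∈ → dis (D-V x∈) (C-V y∈))
        ... | inj₂ kC | inj₂ kD with simplePath r
        ... | w , sw , iw with last-hit (_∈ˡ? verts p) w (start∈ w) (start∈ p)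
        ... | c , w₁ , w₂ , refl , c∈p , hit₁ with first-hit (_∈ˡ? verts q) w₂ (end∈ w₂) (start∈ q)
        ... | c′ , w₃ , w₄ , refl , c′∈q , hit₂
          with loose C D (VDisjoint⁺ C D λ x∈ y∈ → dis (D-V y∈) (C-V x∈)) kC kD w₃
                 (simple-⊕ˡ w₃ w₄ (simple-⊕ʳ w₁ _ sw)) (V-C c∈p) (V-D c′∈q)
                 (λ z∈ z∈C → hit₁ (verts-⊕ˡ w₃ w₄ z∈) (C-V z∈C)) (λ z∈ z∈D → hit₂ z∈ (D-V z∈D))
        ... | S , circ , S⁻ , S⁺ = S , circ , S⁺ (inj₁ e∈C)
          , λ f∈ → [ C⊆ , [ D⊆ , (λ y → A+ (iw (edges-⊕ʳ w₁ _ (edges-⊕ˡ w₃ w₄ y)))) ]′ ]′ (S⁻ f∈)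

      opaque
        circuit-through : R A (src e) (src d) → Goal
        circuit-through r with Any.any? (_∈ˡ? verts p) (verts q)
        ... | yes a with y , y∈q , y∈p ← find a = meeting y∈q y∈p
        ... | no ¬a = separate (λ z∈ w∈ → ¬a (lose z∈ w∈)) r

    -- Dependence yields circuits

    module _ {X : Subset m} {e : Fin m} (e∉X : e ∉ X) where

      private
        closed : (∃[ S ] (Circuit G cls S × e ∈ S × (∀ {f} → f ∈ S → f ∈ X ⊎ f ≡ e))) → InClosure X e
        closed (S , c , e∈ , sub) = inj₂ (S , c , e∈ , λ f → sub)

      Bal⇒InClosure : Bal X e → InClosure X e
      Bal⇒InClosure (C , e∈ , sub , k) = closed (E C , balanced-cycle C refl k , e∈ , λ f∈ → ▸⁻ (sub f∈))

      -- Work over a maximal balanced A in X, and let C be the cycle closed by e. If C is unbalanced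
      -- and D lies near e, then D has an edge outside A, which by maximality closes an unbalanced
      -- cycle, and `TwoChords` applies. If D is a lift cycle in another component, it forms a
      -- circuit with C.
      chord⇒InClosure : R X (src e) (tgt e) → (∃[ D ] (E D ⊆ X × cls (E D) ≢ bal × (cls (E D) ≡ lft ⊎ ∃[ x ] (x ∈ V D × R X (src e) x)))) →
        InClosure X e
      chord⇒InClosure r (D , D⊆X , unb-D , alt)
        with maxBalanced X (λ x∈ → contradiction x∈ ∉⊥) ∅-balanced
      ... | A , _ , mb with simplePath (MaxBalanced.spans mb r)
      ... | p , sp , ip with close p sp (flipJ (joins-ends e)) (λ f∈ → e∉X (MaxBalanced.A⊆X mb (ip f∈)))
      ... | C , eqE , v⁻ , v⁺ = by-balance alt (bal? (cls (E C)))
        where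
        open MaxBalanced mb
        e∈C : e ∈ E C
        e∈C = subst (e ∈_) (sym eqE) (∈-fromList⁺ (here refl))
        C⊆ : ∀ {f} → f ∈ E C → f ∈ X ⊎ f ≡ e
        C⊆ f∈ with ∈-fromList⁻ (subst (_ ∈_) eqE f∈)
        ... | here eq = inj₂ eq
        ... | there f∈p = inj₁ (A⊆X (ip f∈p))

        near : cls (E C) ≢ bal → ∀ {x} → x ∈ V D → R X (src e) x → InClosure X e
        near unb-C {x} x∈D rx with any? (λ d → d ∈? E D ×-dec ¬? (d ∈? A))
        ... | no ¬d = contradiction (balanced D λ {f} f∈ → in-A f∈ (f ∈? A)) unb-D
          where
          in-A : ∀ {f} → f ∈ E D → Dec (f ∈ A) → f ∈ A
          in-A f∈ (yes f∈A) = f∈A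
          in-A f∈ (no f∉A) = contradiction (_ , f∈ , f∉A) ¬d
        ... | yes (d , d∈D , d∉A) with simplePath (spans-edge (D⊆X d∈D))
        ... | q , sq , iq with TwoChords.circuit-through A balanced e d (e∉X ∘ A⊆X) d∉A (λ { refl → e∉X (D⊆X d∈D) })
                p sp ip (λ b → unb-C (trans (cong cls eqE) b)) q sq iq unb-q
                (spans (R-trans rx (cycle-connected D D⊆X x∈D (src∈V D d∈D))))
          where
          unb-q : cls (fromList (d ∷ edges q)) ≢ bal
          unb-q b with close q sq (flipJ (joins-ends d)) (d∉A ∘ iq)
          ... | K , eqK , _ = ¬Bal (D⊆X d∈D) d∉A (K , subst (d ∈_) (sym eqK) (∈-fromList⁺ (here refl))
            , (λ f∈ → case (∈-fromList⁻ (subst (_ ∈_) eqK f∈))) , trans (cong cls eqK) b)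
            where
            case : ∀ {f} → f ∈ˡ d ∷ edges q → f ∈ A ▸ d
            case (here refl) = ▸ʳ
            case (there f∈) = ▸ˡ (iq f∈)
        ... | S , c , e∈S , sub = closed (S , c , e∈S , λ f∈ → Sum.map₁ (▸-least A⊆X (D⊆X d∈D)) (sub f∈))

        far : cls (E C) ≢ bal → cls (E D) ≡ lft → (∀ {x} → x ∈ V D → ¬ R X (src e) x) → InClosure X e
        far unb-C kD ¬r with kind-cases C unb-C
        ... | inj₁ kC = closed (E C ∪ E D , two-L-cycles C D
                (VDisjoint⁺ C D λ x∈ y∈ → ¬r y∈ (R-mono A⊆X (R-walk p ip (v⁻ x∈)))) refl kC kD
                , x∈p∪q⁺ (inj₁ e∈C) , λ f∈ → [ C⊆ , inj₁ ∘ D⊆X ]′ (x∈p∪q⁻ _ _ f∈))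
        ... | inj₂ kC = ⊥-elim (lf-disjoint D C kD kC λ y∈ x∈ → ¬r y∈ (R-mono A⊆X (R-walk p ip (v⁻ x∈))))

        by-balance : cls (E D) ≡ lft ⊎ ∃[ x ] (x ∈ V D × R X (src e) x) → Dec (cls (E C) ≡ bal) → InClosure X e
        by-balance _ (yes b) = closed (E C , balanced-cycle C refl b , e∈C , C⊆)
        by-balance (inj₂ (x , x∈ , rx)) (no unb-C) = near unb-C x∈ rx
        by-balance (inj₁ kD) (no unb-C) with cycle-edge D
        ... | f , f∈ with R? X (src e) (src f)
        ... | yes rf = near unb-C (src∈V D f∈) rf
        ... | no ¬rf = far unb-C kD λ x∈ rx → ¬rf (R-trans rx (cycle-connected D D⊆X x∈ (src∈V D f∈)))

      -- The ends of e lie in different components, which keeps the two frame cycles and the paths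
      -- leading to them apart; each path is stopped at its first vertex on the cycle.
      frames⇒InClosure : ¬ R X (src e) (tgt e) → FAt X (src e) → FAt X (tgt e) → InClosure X e
      frames⇒InClosure ¬r (C , C⊆ , kC , x , x∈ , rx) (D , D⊆ , kD , y , y∈ , ry)
        with simplePath rx | simplePath ry
      ... | w , sw , iw | w′ , sw′ , iw′
        with first-hit (_∈? V C) w (end∈ w) x∈ | first-hit (_∈? V D) w′ (end∈ w′) y∈
      ... | c , a , _ , refl , c∈ , hit | d , b , _ , refl , d∈ , hit′
        = closed (wrap (loose C D (VDisjoint⁺ C D λ z∈ z∈′ → ¬r (R-trans (nearC z∈) (R-sym (nearD z∈′)))) kC kD
            (rev a ⊕ cons e (joins-ends e) b)
            (simple-⊕ (rev a) _ (simple-rev a sa) ((λ z∈ → dis (start∈ a) z∈) , sb)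
              λ { z∈ (here refl) → refl ; z∈ (there z∈′) → contradiction z∈′ (dis (verts-rev⁻ a z∈)) })
            c∈ d∈
            (λ z∈ z∈C → [ (λ z → hit (verts-rev⁻ a z) z∈C)
                        , (λ { (here refl) → hit (start∈ a) z∈C ; (there z) → ⊥-elim (¬r (R-trans (nearC z∈C) (R-sym (rb z)))) }) ]′
                        (verts-⊕⁻ (rev a) _ z∈))
            (λ z∈ z∈D → [ (λ z → ⊥-elim (¬r (R-trans (ra (verts-rev⁻ a z)) (R-sym (nearD z∈D)))))
                        , (λ { (here refl) → ⊥-elim (¬r (R-sym (nearD z∈D))) ; (there z) → hit′ z z∈D }) ]′
                        (verts-⊕⁻ (rev a) _ z∈))))
        where
        sa : Simple a
        sa = simple-⊕ˡ a _ sw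
        sb : Simple b
        sb = simple-⊕ˡ b _ sw′
        ra : ∀ {z} → z ∈ˡ verts a → R X (src e) z
        ra = R-walk a (λ f∈ → iw (edges-⊕ˡ a _ f∈))
        rb : ∀ {z} → z ∈ˡ verts b → R X (tgt e) z
        rb = R-walk b (λ f∈ → iw′ (edges-⊕ˡ b _ f∈))
        nearC : ∀ {z} → z ∈ V C → R X (src e) z
        nearC z∈ = R-trans rx (cycle-connected C C⊆ x∈ z∈)
        nearD : ∀ {z} → z ∈ V D → R X (tgt e) z
        nearD z∈ = R-trans ry (cycle-connected D D⊆ y∈ z∈)
        dis : ∀ {z} → z ∈ˡ verts a → z ∉ˡ verts b
        dis z∈ z∈′ = ¬r (R-trans (ra z∈) (R-sym (rb z∈′)))
        walk = rev a ⊕ cons e (joins-ends e) b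
        wrap : ∃[ S ] (Circuit G cls S × (∀ {f} → f ∈ S → f ∈ E C ⊎ f ∈ E D ⊎ f ∈ˡ edges walk) ×
              (∀ {f} → f ∈ E C ⊎ f ∈ E D ⊎ f ∈ˡ edges walk → f ∈ S)) →
              ∃[ S ] (Circuit G cls S × e ∈ S × (∀ {f} → f ∈ S → f ∈ X ⊎ f ≡ e))
        wrap (S , circ , S⁻ , S⁺) = S , circ , S⁺ (inj₂ (inj₂ (edges-⊕ʳ (rev a) _ (here refl)))) ,
          λ f∈ → [ inj₁ ∘ C⊆ , [ inj₁ ∘ D⊆ , (λ z → [ (λ z → inj₁ (iw (edges-⊕ˡ a _ (edges-rev⁻ a z))))
                   , (λ { (here refl) → inj₂ refl ; (there z) → inj₁ (iw′ (edges-⊕ˡ b _ z)) }) ]′ (edges-⊕⁻ (rev a) _ z)) ]′ ]′ (S⁻ f∈)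

    opaque
      Dep⇒InClosure : ∀ {X e} → Dep X e → InClosure X e
      Dep⇒InClosure {X} {e} d with e ∈? X
      ... | yes e∈ = inj₁ e∈
      Dep⇒InClosure (member e∈) | no e∉ = inj₁ e∈
      Dep⇒InClosure (by-bal b) | no e∉ = Bal⇒InClosure e∉ b
      Dep⇒InClosure (by-full r (inj₁ (D , sub , k))) | no e∉ =
        chord⇒InClosure e∉ r (D , sub , (λ b → lft≢bal (trans (sym k) b)) , inj₁ k)
      Dep⇒InClosure (by-full r (inj₂ (D , sub , k , w))) | no e∉ =
        chord⇒InClosure e∉ r (D , sub , (λ b → frm≢bal (trans (sym k) b)) , inj₂ w)
      -- If the ends of e are joined in X, the two frame cycles lie in one component and may
      -- coincide; the chord case with one of them applies.
      Dep⇒InClosure {X} {e} (by-frames f@(D , sub , k , w) g) | no e∉ with R? X (src e) (tgt e)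
      ... | yes r = chord⇒InClosure e∉ r (D , sub , (λ b → frm≢bal (trans (sym k) b)) , inj₂ w)
      ... | no ¬r = frames⇒InClosure e∉ ¬r f g

    -- Circuits yield dependence

    chord-dep : ∀ {X e} C D → e ∈ E C → E C ⊆ X ▸ e → E D ⊆ X → cls (E D) ≢ bal → ∀ {x y} → x ∈ V C → y ∈ V D → R X x y → Dep X e
    chord-dep C D e∈ C⊆ D⊆ unb x∈ y∈ r = by-full (cycle-R C e∈ C⊆ (src∈V C e∈) (tgt∈V C e∈))
      (UnbAt⇒Full (D , D⊆ , unb , _ , y∈ , R-trans (cycle-R C e∈ C⊆ (src∈V C e∈) x∈) r))

    -- The cycle of p and q makes e a chord; the cycle of q and r is unbalanced, avoids e and meets
    -- the first one.
    theta-dep : ∀ {X e a b} → a ≢ b → (p q r : Walk a b) → Simple p → Simple q → Simple r →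
      Apart p q → Apart p r → Apart q r → e ∈ˡ edges p → (∀ {f} → f ∈ˡ edges p ⊎ f ∈ˡ edges q ⊎ f ∈ˡ edges r → f ∈ X ▸ e) →
      cls (fromList (edges q ++ edges r)) ≢ bal → Dep X e
    theta-dep {X} {e} a≢b p q r sp sq sr apq apr aqr e∈ sub unb
      with joinPaths a≢b p q sp sq apq | joinPaths a≢b q r sq sr aqr
    ... | C , eqC , _ , vC | D , eqD , _ , vD = chord-dep C D
      (subst (e ∈_) (sym eqC) (∈-fromList⁺ (∈-++⁺ˡ e∈)))
      (λ f∈ → [ sub ∘ inj₁ , sub ∘ inj₂ ∘ inj₁ ]′ (∈-++⁻ (edges p) (∈-fromList⁻ (subst (_ ∈_) eqC f∈))))
      (λ f∈ → [ (λ z → strip (Apart.edges-apart apq) z (sub (inj₂ (inj₁ z))))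
              , (λ z → strip (Apart.edges-apart apr) z (sub (inj₂ (inj₂ z)))) ]′ (∈-++⁻ (edges q) (∈-fromList⁻ (subst (_ ∈_) eqD f∈))))
      (λ b → unb (trans (cong cls (sym eqD)) b)) (vC (start∈ p)) (vD (start∈ q)) rfl
      where
      strip : ∀ {l : List (Fin m)} → (∀ {f} → f ∈ˡ edges p → f ∉ˡ l) → ∀ {f} → f ∈ˡ l → f ∈ X ▸ e → f ∈ X
      strip h f∈ f∈′ with ▸⁻ f∈′
      ... | inj₁ z = z
      ... | inj₂ refl = contradiction f∈ (h e∈)

    record PathWalk (P : Path G) (u v : Fin n) : Set where
      field
        walk : Walk u v
        simple : Simple walk
        E⁻ : ∀ {f} → f ∈ˡ edges walk → f ∈ Path.E P
        E⁺ : ∀ {f} → f ∈ Path.E P → f ∈ˡ edges walk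
        V⁻ : ∀ {x} → x ∈ˡ verts walk → x ∈ Path.V P

    pathWalk : ∀ P {u v} → Path.start P ≡ u → Path.end P ≡ v → PathWalk P u v
    pathWalk P refl refl with fromPath P
    ... | p , s , a , b , c , _ = record { walk = p ; simple = s ; E⁻ = a ; E⁺ = b ; V⁻ = c }

    module _ {X : Subset m} {e : Fin m} where

      theta-case : (T : Theta G) → e ∈ Theta.E T → (∀ {f} → f ∈ Theta.E T → f ∈ X ▸ e) →
        cls (Theta.C₁₂ T) ≢ bal → cls (Theta.C₁₃ T) ≢ bal → cls (Theta.C₂₃ T) ≢ bal → Dep X e
      theta-case T e∈ sub u₁₂ u₁₃ u₂₃ = by-path (Sum.map₂ (x∈p∪q⁻ _ _) (x∈p∪q⁻ _ _ e∈))
        where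
        open Theta T hiding (E)
        open PathWalk
        W₁ : PathWalk P₁ u v
        W₁ = pathWalk P₁ st₁ en₁
        W₂ : PathWalk P₂ u v
        W₂ = pathWalk P₂ st₂ en₂
        W₃ : PathWalk P₃ u v
        W₃ = pathWalk P₃ st₃ en₃
        in₁ : ∀ {f} → f ∈ˡ edges (walk W₁) → f ∈ X ▸ e
        in₁ z = sub (x∈p∪q⁺ (inj₁ (E⁻ W₁ z)))
        in₂ : ∀ {f} → f ∈ˡ edges (walk W₂) → f ∈ X ▸ e
        in₂ z = sub (x∈p∪q⁺ (inj₂ (x∈p∪q⁺ (inj₁ (E⁻ W₂ z)))))
        in₃ : ∀ {f} → f ∈ˡ edges (walk W₃) → f ∈ X ▸ e
        in₃ z = sub (x∈p∪q⁺ (inj₂ (x∈p∪q⁺ (inj₂ (E⁻ W₃ z)))))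
        un : ∀ {P Q} (W : PathWalk P u v) (W′ : PathWalk Q u v) →
          cls (Path.E P ∪ Path.E Q) ≢ bal → cls (fromList (edges (walk W) ++ edges (walk W′))) ≢ bal
        un W W′ h b = h (trans (cong cls (fromList-≡
          (λ x∈ → [ (λ z → ∈-++⁺ˡ (E⁺ W z)) , (λ z → ∈-++⁺ʳ (edges (walk W)) (E⁺ W′ z)) ]′ (x∈p∪q⁻ _ _ x∈))
          (λ x∈ → x∈p∪q⁺ (Sum.map (E⁻ W) (E⁻ W′) (∈-++⁻ (edges (walk W)) x∈))))) b)
        ap : ∀ {P Q} (W : PathWalk P u v) (W′ : PathWalk Q u v) → Path.start P ≡ u → Path.end P ≡ v → Empty (Path.E P ∩ Path.E Q) →
          (∀ w → Path.Internal P w → w ∉ Path.V Q) → Apart (walk W) (walk W′)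
        ap {P} {Q} W W′ st en dis int = apart vs (λ f∈ f∈′ → dis (_ , x∈p∩q⁺ (E⁻ W f∈ , E⁻ W′ f∈′)))
          where
          vs : ∀ {x} → x ∈ˡ verts (walk W) → x ∈ˡ verts (walk W′) → x ≡ u ⊎ x ≡ v
          vs {x} x∈ x∈′ with x ≟ᶠ u | x ≟ᶠ v
          ... | yes eq | _ = inj₁ eq
          ... | no _ | yes eq = inj₂ eq
          ... | no x≢u | no x≢v = contradiction (V⁻ W′ x∈′)
            (int x (V⁻ W x∈ , (λ eq → x≢u (trans eq st)) , (λ eq → x≢v (trans eq en))))
        A₁₂ : Apart (walk W₁) (walk W₂)
        A₁₂ = ap W₁ W₂ st₁ en₁ edis₁₂ (λ w i → proj₁ (int₁ w i))
        A₁₃ : Apart (walk W₁) (walk W₃)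
        A₁₃ = ap W₁ W₃ st₁ en₁ edis₁₃ (λ w i → proj₂ (int₁ w i))
        A₂₃ : Apart (walk W₂) (walk W₃)
        A₂₃ = ap W₂ W₃ st₂ en₂ edis₂₃ (λ w i → proj₂ (int₂ w i))
        by-path : e ∈ Path.E P₁ ⊎ e ∈ Path.E P₂ ⊎ e ∈ Path.E P₃ → Dep X e
        by-path (inj₁ e∈₁) = theta-dep u≢v (walk W₁) (walk W₂) (walk W₃) (simple W₁) (simple W₂) (simple W₃)
          A₁₂ A₁₃ A₂₃ (E⁺ W₁ e∈₁) [ in₁ , [ in₂ , in₃ ]′ ]′ (un W₂ W₃ u₂₃)
        by-path (inj₂ (inj₁ e∈₂)) = theta-dep u≢v (walk W₂) (walk W₁) (walk W₃) (simple W₂) (simple W₁) (simple W₃)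
          (Apart-sym A₁₂) A₂₃ A₁₃ (E⁺ W₂ e∈₂) [ in₂ , [ in₁ , in₃ ]′ ]′ (un W₁ W₃ u₁₃)
        by-path (inj₂ (inj₂ e∈₃)) = theta-dep u≢v (walk W₃) (walk W₁) (walk W₂) (simple W₃) (simple W₁) (simple W₂)
          (Apart-sym A₁₃) (Apart-sym A₂₃) A₁₂ (E⁺ W₃ e∈₃) [ in₃ , [ in₁ , in₂ ]′ ]′ (un W₁ W₂ u₁₂)

      strip : ∀ {S} → e ∉ S → (∀ {f} → f ∈ S → f ∈ X ▸ e) → S ⊆ X
      strip e∉ sub f∈ with ▸⁻ (sub f∈)
      ... | inj₁ z = z
      ... | inj₂ refl = contradiction f∈ e∉

      disjoint-edge : ∀ C D → VDisjoint G C D → e ∈ E C → e ∉ E D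
      disjoint-edge C D dis e∈ e∈′ = dis (_ , x∈p∩q⁺ (src∈V C e∈ , src∈V D e∈′))

      two-L-case : ∀ C D → VDisjoint G C D → cls (E D) ≡ lft → e ∈ E C → E C ⊆ X ▸ e → E D ⊆ X ▸ e → Dep X e
      two-L-case C D dis k e∈ C⊆ D⊆ = by-full (cycle-R C e∈ C⊆ (src∈V C e∈) (tgt∈V C e∈))
        (inj₁ (D , strip (disjoint-edge C D dis e∈) D⊆ , k))

      -- On its path e splits off a piece at either end; these pieces avoid e.
      loose-case : ∀ C D → VDisjoint G C D → (P : Path G) → Path.start P ∈ V C → Path.end P ∈ V D →
        cls (E C) ≡ frm → cls (E D) ≡ frm → E C ⊆ X ▸ e → E D ⊆ X ▸ e → Path.E P ⊆ X ▸ e →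
        e ∈ E C ⊎ e ∈ E D ⊎ e ∈ Path.E P → Dep X e
      loose-case C D dis P s∈ t∈ kC kD C⊆ D⊆ P⊆ e∈ with fromPath P
      ... | p , sp , E⁻ , E⁺ , _ = by-place e∈ (e ∈ˡ? edges p)
        where
        unbC : cls (E C) ≢ bal
        unbC b = frm≢bal (trans (sym kC) b)
        unbD : cls (E D) ≢ bal
        unbD b = frm≢bal (trans (sym kD) b)
        dis′ : VDisjoint G D C
        dis′ (x , x∈) with a , b ← x∈p∩q⁻ (V D) (V C) x∈ = dis (x , x∈p∩q⁺ (b , a))

        whole : e ∉ˡ edges p → R X (Path.start P) (Path.end P)
        whole e∉ = R-walk p (λ f∈ → strip (e∉ ∘ E⁺) P⊆ (E⁻ f∈)) (end∈ p)

        pieces : e ∈ˡ edges p → ∃[ a ] ∃[ b ] (Joins G e a b × R X (Path.start P) a × R X b (Path.end P))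
        pieces e∈p with split-edge p e∈p
        ... | a , b , p₁ , j , p₂ , refl = a , b , j , R-walk p₁ i₁ (end∈ p₁) , R-walk p₂ i₂ (end∈ p₂)
          where
          sr : Simple (cons e j p₂)
          sr = simple-⊕ʳ p₁ _ sp
          i₂ : p₂ inside X
          i₂ f∈ with ▸⁻ (P⊆ (E⁻ (edges-⊕ʳ p₁ _ (there f∈))))
          ... | inj₁ z = z
          ... | inj₂ refl = contradiction f∈ (first-edge∉ {j = j} p₂ (proj₁ sr))
          i₁ : p₁ inside X
          i₁ f∈ with ▸⁻ (P⊆ (E⁻ (edges-⊕ˡ p₁ _ f∈)))
          ... | inj₁ z = z
          ... | inj₂ refl with simple-overlap p₁ _ sp (proj₂ (edge-ends p₁ f∈ j)) (there (start∈ p₂))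
          ... | refl = contradiction (start∈ p₂) (proj₁ sr)

        end-in : ∀ K {a b} → e ∈ E K → Joins G e a b → a ∈ V K × b ∈ V K
        end-in K e∈K j with joins-unique (joins-ends e) j
        ... | inj₁ (refl , refl) = src∈V K e∈K , tgt∈V K e∈K
        ... | inj₂ (refl , refl) = tgt∈V K e∈K , src∈V K e∈K

        -- An edge of the path that also lies on C or D is not excluded beforehand; such a case is
        -- sent to the clauses for C and D.
        by-place : e ∈ E C ⊎ e ∈ E D ⊎ e ∈ Path.E P → Dec (e ∈ˡ edges p) → Dep X e
        by-place (inj₁ e∈C) (yes e∈p) with a , b , j , _ , r ← pieces e∈p =
          chord-dep C D e∈C C⊆ (strip (disjoint-edge C D dis e∈C) D⊆) unbD (proj₂ (end-in C e∈C j)) t∈ r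
        by-place (inj₁ e∈C) (no e∉p) =
          chord-dep C D e∈C C⊆ (strip (disjoint-edge C D dis e∈C) D⊆) unbD s∈ t∈ (whole e∉p)
        by-place (inj₂ (inj₁ e∈D)) (yes e∈p) with a , b , j , r , _ ← pieces e∈p =
          chord-dep D C e∈D D⊆ (strip (disjoint-edge D C dis′ e∈D) C⊆) unbC (proj₁ (end-in D e∈D j)) s∈ (R-sym r)
        by-place (inj₂ (inj₁ e∈D)) (no e∉p) =
          chord-dep D C e∈D D⊆ (strip (disjoint-edge D C dis′ e∈D) C⊆) unbC t∈ s∈ (R-sym (whole e∉p))
        by-place (inj₂ (inj₂ e∈P)) (no e∉p) = contradiction (E⁺ e∈P) e∉p
        by-place (inj₂ (inj₂ e∈P)) (yes e∈p) with e ∈? E C | e ∈? E D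
        ... | yes e∈C | _ = by-place (inj₁ e∈C) (yes e∈p)
        ... | no _ | yes e∈D = by-place (inj₂ (inj₁ e∈D)) (yes e∈p)
        ... | no e∉C | no e∉D with pieces e∈p
        ... | a , b , j , ra , rb with joins-unique (joins-ends e) j
        ... | inj₁ (refl , refl) = by-frames (C , strip e∉C C⊆ , kC , _ , s∈ , R-sym ra) (D , strip e∉D D⊆ , kD , _ , t∈ , rb)
        ... | inj₂ (refl , refl) = by-frames (D , strip e∉D D⊆ , kD , _ , t∈ , rb) (C , strip e∉C C⊆ , kC , _ , s∈ , R-sym ra)

      circuit-dep : ∀ {S} → Circuit G cls S → e ∈ S → (∀ {f} → f ∈ S → f ∈ X ▸ e) → Dep X e
      circuit-dep (balanced-cycle C refl k) e∈ sub = by-bal (C , e∈ , sub , k)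
      circuit-dep (theta T refl a b c) e∈ sub = theta-case T e∈ sub a b c
      circuit-dep (tight-handcuff C D dis w w∈C w∈D _ refl uC uD) e∈ sub with x∈p∪q⁻ _ _ e∈
      ... | inj₁ e∈C = chord-dep C D e∈C (λ z → sub (x∈p∪q⁺ (inj₁ z)))
              (strip (λ e∈D → dis (_ , x∈p∩q⁺ (e∈C , e∈D))) (λ z → sub (x∈p∪q⁺ (inj₂ z)))) uD w∈C w∈D rfl
      ... | inj₂ e∈D = chord-dep D C e∈D (λ z → sub (x∈p∪q⁺ (inj₂ z)))
              (strip (λ e∈C → dis (_ , x∈p∩q⁺ (e∈C , e∈D))) (λ z → sub (x∈p∪q⁺ (inj₁ z)))) uC w∈D w∈C rfl
      circuit-dep (two-L-cycles C D dis refl kC kD) e∈ sub with x∈p∪q⁻ _ _ e∈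
      ... | inj₁ e∈C = two-L-case C D dis kD e∈C (λ z → sub (x∈p∪q⁺ (inj₁ z))) (λ z → sub (x∈p∪q⁺ (inj₂ z)))
      ... | inj₂ e∈D = two-L-case D C (λ { (x , x∈) → let a , b = x∈p∩q⁻ (V D) (V C) x∈ in dis (x , x∈p∩q⁺ (b , a)) })
              kC e∈D (λ z → sub (x∈p∪q⁺ (inj₂ z))) (λ z → sub (x∈p∪q⁺ (inj₁ z)))
      circuit-dep (loose-handcuff C D dis P s∈ t∈ _ refl kC kD) e∈ sub = loose-case C D dis P s∈ t∈ kC kD
        (λ z → sub (x∈p∪q⁺ (inj₁ z))) (λ z → sub (x∈p∪q⁺ (inj₂ (x∈p∪q⁺ (inj₁ z))))) (λ z → sub (x∈p∪q⁺ (inj₂ (x∈p∪q⁺ (inj₂ z)))))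
        (Sum.map₂ (x∈p∪q⁻ _ _) (x∈p∪q⁻ _ _ e∈))

    opaque
      InClosure⇒Dep : ∀ {X e} → InClosure X e → Dep X e
      InClosure⇒Dep (inj₁ e∈) = member e∈
      InClosure⇒Dep (inj₂ (S , c , e∈ , sub)) = circuit-dep c e∈ (λ f∈ → [ ▸ˡ , (λ { refl → ▸ʳ }) ]′ (sub _ f∈))

    -- Transitivity of dependence

    ¬FAt-BalAt : ∀ {X u} → BalAt X u → ¬ FAt X u
    ¬FAt-BalAt b (C , sub , k , x , x∈ , r) = frm≢bal (trans (sym k) (b C sub x∈ r))

    Bal-drop : ∀ {X g e} → ¬ Bal X e → (b : Bal (X ▸ g) e) → g ∈ E (proj₁ b)
    Bal-drop {X} {g} {e} ¬b (C , e∈ , sub , k) with g ∈? E C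
    ... | yes g∈ = g∈
    ... | no g∉ = contradiction {A = Bal X e} (C , e∈ , (λ f∈ → drop f∈ (sub f∈)) , k) ¬b
      where
      drop : ∀ {f} → f ∈ E C → f ∈ X ▸ g ▸ e → f ∈ X ▸ e
      drop f∈ f∈′ with ▸⁻ f∈′
      ... | inj₂ refl = ▸ʳ
      ... | inj₁ f∈″ with ▸⁻ f∈″
      ... | inj₁ f∈X = ▸ˡ f∈X
      ... | inj₂ refl = contradiction f∈ g∉

    -- Adding g leaves the components of X as they are, so only the supply of unbalanced cycles can
    -- change.
    module Chord {X g} (g∉X : g ∉ X) (rg : R X (src g) (tgt g)) where

      -- A frame cycle near g is excluded, and a balanced cycle through g would keep the component
      -- balanced; what remains is that g depends on X through a lift cycle. The conclusion is
      -- doubly negated, as it is applied under `¬ HasL X`.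
      balanced-at-g : Dep X g → BalAt X (src g) → ∀ D → E D ⊆ X ▸ g → g ∈ E D → cls (E D) ≡ lft → ¬ ¬ HasL X
      balanced-at-g (member g∈X) b D D⊆ g∈D k ¬L = g∉X g∈X
      balanced-at-g (by-bal bg) b D D⊆ g∈D k ¬L = lft≢bal (trans (sym k) (BalAt-▸ b bg D D⊆ (src∈V D g∈D) rfl))
      balanced-at-g (by-full _ (inj₁ L)) b D D⊆ g∈D k ¬L = ¬L L
      balanced-at-g (by-full _ (inj₂ f)) b D D⊆ g∈D k ¬L = ¬FAt-BalAt b f
      balanced-at-g (by-frames f _) b D D⊆ g∈D k ¬L = ¬FAt-BalAt b f

      -- A lift cycle of X, the only remaining reason for g to depend on X, would have to meet the
      -- frame cycle through g and hence lie in the balanced component.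
      balanced-at-g′ : Dep X g → BalAt X (src g) → ∀ D → E D ⊆ X ▸ g → g ∈ E D → cls (E D) ≢ frm
      balanced-at-g′ (member g∈X) b D D⊆ g∈D k = g∉X g∈X
      balanced-at-g′ (by-bal bg) b D D⊆ g∈D k = frm≢bal (trans (sym k) (BalAt-▸ b bg D D⊆ (src∈V D g∈D) rfl))
      balanced-at-g′ (by-full _ (inj₁ (D′ , D′⊆ , k′))) b D D⊆ g∈D k = lf-disjoint D′ D k′ k λ z∈′ z∈ →
        lft≢bal (trans (sym k′) (b D′ D′⊆ z∈′ (cycle-R D g∈D D⊆ (src∈V D g∈D) z∈)))
      balanced-at-g′ (by-full _ (inj₂ f)) b D D⊆ g∈D k = ¬FAt-BalAt b f
      balanced-at-g′ (by-frames f _) b D D⊆ g∈D k = ¬FAt-BalAt b f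

      balanced-dep : Dep X g → ¬ HasL X → BalAt X (src g) → Bal X g
      balanced-dep (member g∈X) ¬L b = contradiction g∈X g∉X
      balanced-dep (by-bal bg) ¬L b = bg
      balanced-dep (by-full _ (inj₁ L)) ¬L b = contradiction L ¬L
      balanced-dep (by-full _ (inj₂ f)) ¬L b = contradiction f (¬FAt-BalAt b)
      balanced-dep (by-frames f _) ¬L b = contradiction f (¬FAt-BalAt b)

      -- If the frame cycle near u uses g, the component of u was unbalanced already. A lift cycle
      -- there would have to meet the frame cycle near w and so join u to w; hence it contains a
      -- frame cycle.
      frame-back : Dep X g → ∀ {u w} → ¬ R X u w → FAt (X ▸ g) u → FAt (X ▸ g) w → FAt X u
      frame-back dg {u} {w} ¬r (D , D⊆ , k , x , x∈ , rx) (D₂ , D₂⊆ , k₂ , x₂ , x₂∈ , rx₂) with cycle-▸ D D⊆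
      ... | inj₁ D⊆X = D , D⊆X , k , x , x∈ , R-▸-chord rg rx
      ... | inj₂ g∈D with unbAt? X (src g)
      ... | no ¬u = contradiction k (balanced-at-g′ dg (¬UnbAt⇒BalAt ¬u) D D⊆ g∈D)
      ... | yes (D′ , D′⊆ , unb , y , y∈ , ry) with kind-cases D′ unb
      ... | inj₂ k′ = FAt-R (R-trans (R-▸-chord rg rx) (cycle-R D g∈D D⊆ x∈ (src∈V D g∈D))) (D′ , D′⊆ , k′ , y , y∈ , ry)
      ... | inj₁ k′ = ⊥-elim (lf-disjoint D′ D₂ k′ k₂ λ z∈ z∈₂ → ¬r (R-trans
            (R-trans (R-▸-chord rg rx) (cycle-R D g∈D D⊆ x∈ (src∈V D g∈D)))
            (R-trans (R-trans ry (cycle-connected D′ D′⊆ y∈ z∈))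
              (R-sym (R-trans (R-▸-chord rg rx₂) (R-▸-chord rg (cycle-connected D₂ D₂⊆ x₂∈ z∈₂)))))))

      module _ (dg : Dep X g) {e} (e∉X : e ∉ X) (re : R X (src e) (tgt e)) (¬L : ¬ HasL X) (be : BalAt X (src e)) where

        -- From another component g can affect e only by closing a lift cycle D. Then the component
        -- of g was unbalanced and, in the absence of lift cycles, contains a frame cycle D′. An
        -- unbalanced cycle through e would miss D′ if it were a lift cycle and D if it were a frame
        -- cycle.
        elsewhere : ¬ R X (src e) (src g) → Dep (X ▸ g) e → Bal X e
        elsewhere ¬r d with Bal? X e
        ... | yes b = b
        ... | no ¬b with chord-cycle e∉X re
        ... | C , e∈C , C⊆ , near = by-type d
          where
          ¬here : ∀ {D} → E D ⊆ X ▸ g → g ∈ E D → ∀ {x} → x ∈ V D → ¬ R (X ▸ g) (src e) x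
          ¬here {D} D⊆ g∈ x∈ rx = ¬r (R-trans (R-▸-chord rg rx) (cycle-R D g∈ D⊆ x∈ (src∈V D g∈)))
          ¬F : ¬ FAt (X ▸ g) (src e)
          ¬F (D , D⊆ , k , x , x∈ , rx) with cycle-▸ D D⊆
          ... | inj₁ D⊆X = ¬FAt-BalAt be (D , D⊆X , k , x , x∈ , R-▸-chord rg rx)
          ... | inj₂ g∈ = ¬here {D} D⊆ g∈ x∈ rx
          by-type : Dep (X ▸ g) e → Bal X e
          by-type (member e∈) with ▸⁻ e∈
          ... | inj₁ e∈X = contradiction e∈X e∉X
          ... | inj₂ refl = contradiction rfl ¬r
          by-type (by-bal b@(D , e∈ , sub , k)) =
            ⊥-elim (¬r (R-▸-chord rg (cycle-R D e∈ sub (src∈V D e∈) (src∈V D (Bal-drop ¬b b)))))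
          by-type (by-full _ (inj₂ f)) = ⊥-elim (¬F f)
          by-type (by-frames f _) = ⊥-elim (¬F f)
          by-type (by-full _ (inj₁ (D , D⊆ , k))) with cycle-▸ D D⊆
          ... | inj₁ D⊆X = ⊥-elim (¬L (D , D⊆X , k))
          ... | inj₂ g∈D with unbAt? X (src g)
          ... | no ¬u = ⊥-elim (balanced-at-g dg (¬UnbAt⇒BalAt ¬u) D D⊆ g∈D k ¬L)
          ... | yes (D′ , D′⊆ , unb , y , y∈ , ry) with kind-cases D′ unb
          ... | inj₁ k′ = ⊥-elim (¬L (D′ , D′⊆ , k′))
          ... | inj₂ k′ with bal? (cls (E C))
          ... | yes b = C , e∈C , C⊆ , b
          ... | no unb-C with kind-cases C unb-C
          ... | inj₁ kC = ⊥-elim (lf-disjoint C D′ kC k′ λ z∈ z∈′ →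
                  ¬r (R-trans (near z∈) (R-sym (R-trans ry (cycle-connected D′ D′⊆ y∈ z∈′)))))
          ... | inj₂ kC = ⊥-elim (lf-disjoint D C k kC λ z∈ z∈′ →
                  ¬r (R-trans (near z∈′) (cycle-R D g∈D D⊆ z∈ (src∈V D g∈D))))

        same-component : R X (src e) (src g) → Dep (X ▸ g) e → Bal X e
        same-component r d with chord-cycle e∉X re
        ... | C , e∈C , C⊆ , near = by-type d
          where
          bg : BalAt X (src g)
          bg = BalAt-R r be
          Bal-g : Bal X g
          Bal-g = balanced-dep dg ¬L bg
          b⁺ : BalAt (X ▸ g) (src e)
          b⁺ = BalAt-R (R-sym (R-mono ▸ˡ r)) (BalAt-▸ bg Bal-g)
          by-type : Dep (X ▸ g) e → Bal X e
          by-type (member e∈) with ▸⁻ e∈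
          ... | inj₁ e∈X = contradiction e∈X e∉X
          ... | inj₂ refl = Bal-g
          by-type (by-bal b) = C , e∈C , C⊆ , BalAt-▸ b⁺ b C (▸-mono ▸ˡ ∘ C⊆) (src∈V C e∈C) rfl
          by-type (by-full _ (inj₂ f)) = contradiction f (¬FAt-BalAt b⁺)
          by-type (by-frames f _) = contradiction f (¬FAt-BalAt b⁺)
          by-type (by-full _ (inj₁ (D , D⊆ , k))) with cycle-▸ D D⊆
          ... | inj₁ D⊆X = ⊥-elim (¬L (D , D⊆X , k))
          ... | inj₂ g∈ = ⊥-elim (lft≢bal (trans (sym k) (b⁺ D D⊆ (src∈V D g∈) (R-mono ▸ˡ r))))

      chord-trans : Dep X g → ∀ {e} → e ∉ X → Dep (X ▸ g) e → Dep X e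
      chord-trans dg {e} e∉X d with R? X (src e) (tgt e)
      ... | yes re with hasL? X
      ... | yes L = by-full re (inj₁ L)
      ... | no ¬L with unbAt? X (src e)
      ... | yes u = by-full re (UnbAt⇒Full u)
      ... | no ¬u with R? X (src e) (src g)
      ... | yes r = by-bal (same-component dg e∉X re ¬L (¬UnbAt⇒BalAt ¬u) r d)
      ... | no ¬r = by-bal (elsewhere dg e∉X re ¬L (¬UnbAt⇒BalAt ¬u) ¬r d)
      chord-trans dg {e} e∉X d | no ¬re with d
      ... | by-bal b = contradiction (R-▸-chord rg (Bal-chord b)) ¬re
      ... | by-full r _ = contradiction (R-▸-chord rg r) ¬re
      ... | by-frames f f′ = by-frames (frame-back dg ¬re f f′) (frame-back dg (¬re ∘ R-sym) f′ f)
      ... | member e∈ with ▸⁻ e∈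
      ... | inj₁ e∈X = member e∈X
      ... | inj₂ refl = dg

    -- A bridge creates no cycle, and both components that it merges have frame cycles already.
    module Bridge {X g} (¬rg : ¬ R X (src g) (tgt g)) (fs : FAt X (src g)) (ft : FAt X (tgt g)) where

      old-cycle : ∀ D → E D ⊆ X ▸ g → E D ⊆ X
      old-cycle D D⊆ with cycle-▸ D D⊆
      ... | inj₁ D⊆X = D⊆X
      ... | inj₂ g∈ = contradiction (cycle-R D g∈ D⊆ (src∈V D g∈) (tgt∈V D g∈)) ¬rg

      frame-back : ∀ {u} → FAt (X ▸ g) u → FAt X u
      frame-back (D , D⊆ , k , x , x∈ , rx) with R-▸ rx
      ... | inj₁ r = D , old-cycle D D⊆ , k , x , x∈ , r
      ... | inj₂ (inj₁ (r , _)) = FAt-R r fs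
      ... | inj₂ (inj₂ (r , _)) = FAt-R r ft

      across : ∀ {e} → (R X (src e) (src g) × R X (tgt g) (tgt e)) ⊎ (R X (src e) (tgt g) × R X (src g) (tgt e)) → Dep X e
      across (inj₁ (r , r′)) = by-frames (FAt-R r fs) (FAt-R (R-sym r′) ft)
      across (inj₂ (r , r′)) = by-frames (FAt-R r ft) (FAt-R (R-sym r′) fs)

      bridge-trans : ∀ {e} → Dep X g → Dep (X ▸ g) e → Dep X e
      bridge-trans dg (member e∈) with ▸⁻ e∈
      ... | inj₁ e∈X = member e∈X
      ... | inj₂ refl = dg
      bridge-trans dg (by-frames f f′) = by-frames (frame-back f) (frame-back f′)
      bridge-trans dg (by-full r f) with R-▸ r
      ... | inj₁ re = by-full re (Sum.map (λ { (D , D⊆ , k) → D , old-cycle D D⊆ , k }) frame-back f)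
      ... | inj₂ a = across a
      bridge-trans {e} dg (by-bal b@(C , e∈ , C⊆ , k)) with Bal? X e
      ... | yes b′ = by-bal b′
      ... | no ¬b with R-▸ (Bal-chord b)
      ... | inj₂ a = across a
      ... | inj₁ re = contradiction (R-▸-chord re (cycle-R C g∈ C⊆′ (src∈V C g∈) (tgt∈V C g∈))) ¬rg
        where
        g∈ : g ∈ E C
        g∈ = Bal-drop ¬b b
        C⊆′ : E C ⊆ X ▸ e ▸ g
        C⊆′ f∈ with ▸⁻ (C⊆ f∈)
        ... | inj₂ refl = ▸ˡ ▸ʳ
        ... | inj₁ f∈′ = ▸-mono ▸ˡ f∈′

    opaque
      Dep-trans : ∀ {X g e} → Dep X g → Dep (X ▸ g) e → Dep X e
      Dep-trans {X} {g} {e} dg de with g ∈? X | e ∈? X | R? X (src g) (tgt g)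
      ... | yes g∈ | _ | _ = Dep-mono (▸-least id g∈) de
      ... | no _ | yes e∈ | _ = member e∈
      ... | no g∉ | no e∉ | yes rg = Chord.chord-trans g∉ rg dg e∉ de
      ... | no g∉ | no e∉ | no ¬rg with dg
      ... | member g∈ = contradiction g∈ g∉
      ... | by-bal b = contradiction (Bal-chord b) ¬rg
      ... | by-full r _ = contradiction r ¬rg
      ... | by-frames fs ft = Bridge.bridge-trans ¬rg fs ft dg de

    -- Contractions

    circuit⇒Dep : ∀ {X S e} → Circuit G cls S → e ∈ S → (∀ {f} → f ∈ S → f ∈ X ⊎ f ≡ e) → Dep X e
    circuit⇒Dep c e∈ sub = InClosure⇒Dep (inj₂ (_ , c , e∈ , λ _ → sub))

    Dep⇒circuit : ∀ {X e} → e ∉ X → Dep X e → ∃[ S ] (Circuit G cls S × e ∈ S × (∀ {f} → f ∈ S → f ∈ X ⊎ f ≡ e))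
    Dep⇒circuit e∉ d with Dep⇒InClosure d
    ... | inj₁ e∈ = contradiction e∈ e∉
    ... | inj₂ (S , c , e∈ , sub) = S , c , e∈ , λ {f} → sub f

    -- A circuit putting f into the closure of `X ▸ e` must contain e; read from e, it puts e into
    -- the closure of `X ▸ f`.
    Dep-exchange : ∀ {X e f} → Dep (X ▸ e) f → ¬ Dep X f → Dep (X ▸ f) e
    Dep-exchange {X} {e} {f} d ¬d with f ∈? (X ▸ e)
    ... | yes f∈ with ▸⁻ f∈
    ... | inj₁ f∈X = contradiction (member f∈X) ¬d
    ... | inj₂ refl = member ▸ʳ
    Dep-exchange {X} {e} {f} d ¬d | no f∉ with Dep⇒circuit f∉ d
    ... | S , c , f∈ , sub with e ∈? S
    ... | yes e∈ = circuit⇒Dep c e∈ λ g∈ → move (sub g∈)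
      where
      move : ∀ {g} → g ∈ X ▸ e ⊎ g ≡ f → g ∈ X ▸ f ⊎ g ≡ e
      move (inj₁ g∈) = Sum.map₁ ▸ˡ (▸⁻ g∈)
      move (inj₂ refl) = inj₁ ▸ʳ
    ... | no e∉ = contradiction (circuit⇒Dep c f∈ λ g∈ → Sum.map₁
      (λ z → [ id , (λ { refl → contradiction g∈ e∉ }) ]′ (▸⁻ z)) (sub g∈)) ¬d

    module _ (F F′ : Subset m) (F⊆F′ : F ⊆ F′) (e f : Fin m) (¬de : ¬ Dep F′ e) (e≢f : e ≢ f) (d : Dep (F′ ▸ f) e) where
      private
        Y₀? : ∀ x → Dec (x ∈ F′ ▸ f × x ∉ F)
        Y₀? x = x ∈? (F′ ▸ f) ×-dec ¬? (x ∈? F)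
        Y₀ = comprehension Y₀?

        d₀ : Dep (F ∪ Y₀) e
        d₀ = Dep-mono (λ {x} x∈ → x∈p∪q⁺ (pick x∈ (x ∈? F))) d
          where
          pick : ∀ {x} → x ∈ F′ ▸ f → Dec (x ∈ F) → x ∈ F ⊎ x ∈ Y₀
          pick x∈ (yes x∈F) = inj₁ x∈F
          pick x∈ (no x∉F) = inj₂ (∈-comprehension⁺ Y₀? (x∈ , x∉F))

      -- A minimal Y with e dependent on F ∪ Y gives the circuit Y ∪ {e} of M/F.
      opaque
        lift-circuit : ∃[ D ] (ContrCircuit F D × e ∈ D × f ∈ D)
        lift-circuit with shrink (λ Y → Dep? (F ∪ Y) e) {Y₀} d₀
        ... | Y , Y⊆ , dY , mn with Dep⇒circuit e∉ dY
          where
          e∉ : e ∉ F ∪ Y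
          e∉ e∈ with x∈p∪q⁻ F Y e∈
          ... | inj₁ e∈F = ¬de (member (F⊆F′ e∈F))
          ... | inj₂ e∈Y with ▸⁻ (proj₁ (∈-comprehension⁻ Y₀? (Y⊆ e∈Y)))
          ... | inj₁ e∈F′ = ¬de (member e∈F′)
          ... | inj₂ e≡f = e≢f e≡f
        ... | C , c , e∈C , C⊆ = C ∩ ∁ F , ((C , c , refl) , (e , e∈D) , minimal) , e∈D , Y⊆D f∈Y
          where
          Y∉F : ∀ {x} → x ∈ Y → x ∉ F
          Y∉F x∈ = proj₂ (∈-comprehension⁻ Y₀? (Y⊆ x∈))
          e∉F : e ∉ F
          e∉F e∈F = ¬de (member (F⊆F′ e∈F))
          e∈D : e ∈ C ∩ ∁ F
          e∈D = x∈p∩q⁺ (e∈C , x∉p⇒x∈∁p e∉F)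
          Y⊆C : ∀ {y} → y ∈ Y → y ∈ C
          Y⊆C {y} y∈ with y ∈? C
          ... | yes y∈C = y∈C
          ... | no y∉C = contradiction (circuit⇒Dep c e∈C λ x∈ → Sum.map₁
            (λ z → x∈p∪q⁺ (Sum.map₂ (λ x∈Y → ◂⁺ x∈Y (λ { refl → y∉C x∈ })) (x∈p∪q⁻ F Y z))) (C⊆ x∈)) (mn y∈)
          Y⊆D : ∀ {y} → y ∈ Y → y ∈ C ∩ ∁ F
          Y⊆D y∈ = x∈p∩q⁺ (Y⊆C y∈ , x∉p⇒x∈∁p (Y∉F y∈))
          D⊆ : ∀ {x} → x ∈ C ∩ ∁ F → x ∈ Y ⊎ x ≡ e
          D⊆ x∈ with x∈p∩q⁻ C (∁ F) x∈
          ... | x∈C , x∉F with C⊆ x∈C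
          ... | inj₂ eq = inj₂ eq
          ... | inj₁ z with x∈p∪q⁻ F Y z
          ... | inj₁ x∈F = contradiction x∈F (x∈∁p⇒x∉p x∉F)
          ... | inj₂ x∈Y = inj₁ x∈Y
          f∈Y : f ∈ Y
          f∈Y with f ∈? Y
          ... | yes f∈ = f∈
          -- Without f the set Y would lie in F′, whose closure avoids e.
          ... | no f∉ = contradiction (Dep-mono (λ x∈ → [ F⊆F′ , old ]′ (x∈p∪q⁻ F Y x∈)) dY) ¬de
            where
            old : ∀ {x} → x ∈ Y → x ∈ F′
            old x∈ with ▸⁻ (proj₁ (∈-comprehension⁻ Y₀? (Y⊆ x∈)))
            ... | inj₁ x∈F′ = x∈F′
            ... | inj₂ refl = contradiction x∈ f∉
          -- If a competing circuit contains e, any element it misses could be dropped from Y. If it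
          -- avoids e, its element h depends on F and the rest of Y, so by transitivity h could be
          -- dropped. Both contradict the choice of Y.
          minimal : ∀ D′ → ContrForm F D′ → Nonempty D′ → D′ ⊆ C ∩ ∁ F → C ∩ ∁ F ⊆ D′
          minimal D′ (C′ , c′ , refl) (h , h∈) sub {x} x∈ with x ∈? (C′ ∩ ∁ F)
          ... | yes x∈′ = x∈′
          ... | no x∉′ with e ∈? C′
          ... | yes e∈C′ = contradiction (circuit⇒Dep c′ e∈C′ λ {z} z∈ → where-is z∈ (z ∈? F)) (mn x∈Y)
            where
            x∈Y : x ∈ Y
            x∈Y with D⊆ x∈
            ... | inj₁ y = y
            ... | inj₂ refl = contradiction (x∈p∩q⁺ (e∈C′ , x∉p⇒x∈∁p e∉F)) x∉′
            where-is : ∀ {z} → z ∈ C′ → Dec (z ∈ F) → z ∈ F ∪ (Y ◂ x) ⊎ z ≡ e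
            where-is z∈ (yes z∈F) = inj₁ (x∈p∪q⁺ (inj₁ z∈F))
            where-is z∈ (no z∉F) = Sum.map₁
              (λ z∈Y → x∈p∪q⁺ (inj₂ (◂⁺ z∈Y λ { refl → x∉′ (x∈p∩q⁺ (z∈ , x∉p⇒x∈∁p z∉F)) })))
              (D⊆ (sub (x∈p∩q⁺ (z∈ , x∉p⇒x∈∁p z∉F))))
          ... | no e∉C′ = contradiction (Dep-trans (circuit⇒Dep c′ (proj₁ (x∈p∩q⁻ C′ (∁ F) h∈)) λ {z} z∈ → where-is z∈ (z ∈? F) (z ≟ᶠ h))
                  (Dep-mono (λ {z} z∈ → [ (λ y → ▸ˡ (x∈p∪q⁺ (inj₁ y))) , (λ y → put y (z ≟ᶠ h)) ]′ (x∈p∪q⁻ F Y z∈)) dY)) (mn h∈Y)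
            where
            not-e : ∀ {z} → z ∈ C′ → z ∈ Y ⊎ z ≡ e → z ∈ Y
            not-e z∈ (inj₁ y) = y
            not-e z∈ (inj₂ refl) = contradiction z∈ e∉C′
            h∈Y : h ∈ Y
            h∈Y = not-e (proj₁ (x∈p∩q⁻ C′ (∁ F) h∈)) (D⊆ (sub h∈))
            put : ∀ {z} → z ∈ Y → Dec (z ≡ h) → z ∈ (F ∪ (Y ◂ h)) ▸ h
            put z∈ (yes refl) = ▸ʳ
            put z∈ (no z≢h) = ▸ˡ (x∈p∪q⁺ (inj₂ (◂⁺ z∈ z≢h)))
            where-is : ∀ {z} → z ∈ C′ → Dec (z ∈ F) → Dec (z ≡ h) → z ∈ F ∪ (Y ◂ h) ⊎ z ≡ h
            where-is z∈ _ (yes eq) = inj₂ eq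
            where-is z∈ (yes z∈F) (no _) = inj₁ (x∈p∪q⁺ (inj₁ z∈F))
            where-is z∈ (no z∉F) (no z≢h) = inj₁ (x∈p∪q⁺ (inj₂ (◂⁺ (not-e z∈ (D⊆ (sub (x∈p∩q⁺ (z∈ , x∉p⇒x∈∁p z∉F))))) z≢h)))

    -- M/F consists of exactly two parallel classes, those of e and f: as F is flat, `Dep (F ▸ g) e`
    -- for g outside F means that g and e are parallel in M/F.
    record TwoClasses (F : Subset m) (e f : Fin m) : Set where
      field
        flat : ∀ {g} → Dep F g → g ∈ F
        e∉F  : e ∉ F
        f∉F  : f ∉ F
        e∦f  : ¬ Dep (F ▸ f) e
        f∦e  : ¬ Dep (F ▸ e) f
        two  : ∀ {g} → g ∉ F → Dep (F ▸ g) e ⊎ Dep (F ▸ g) f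

    opaque
      -- F is enlarged to F′ as long as e and f stay outside the closure. By maximality each further
      -- element spans e or f. If f itself spans e, the two are parallel modulo F′ and
      -- `lift-circuit` yields a circuit of M/F; if not, they represent two classes.
      circuit-or-classes : ∀ {F} → Flat F → ∀ {e f} → e ∉ F → f ∉ F → e ≢ f →
        (∃[ D ] (ContrCircuit F D × e ∈ D × f ∈ D)) ⊎ ∃[ F′ ] TwoClasses F′ e f
      circuit-or-classes {F} flat {e} {f} e∉ f∉ e≢f
        with grow (λ Y → ¬? (Dep? Y e) ×-dec ¬? (Dep? Y f))
               {F} ((λ d → e∉ (flat e (Dep⇒InClosure d))) , λ d → f∉ (flat f (Dep⇒InClosure d)))
      ... | F′ , F⊆F′ , (¬de , ¬df) , mx with Dep? (F′ ▸ f) e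
      ... | yes d = inj₁ (lift-circuit F F′ F⊆F′ e f ¬de e≢f d)
      ... | no ¬d = inj₂ (F′ , record
        { flat = flat′ ; e∉F = ¬de ∘ member ; f∉F = ¬df ∘ member ; e∦f = ¬d
        ; f∦e = λ d → ¬d (Dep-exchange d ¬df)
        ; two = two′ })
        where
        flat′ : ∀ {g} → Dep F′ g → g ∈ F′
        flat′ {g} dg with g ∈? F′
        ... | yes g∈ = g∈
        ... | no g∉ = contradiction ((λ d → ¬de (Dep-trans dg d)) , (λ d → ¬df (Dep-trans dg d))) (mx g∉)
        two′ : ∀ {g} → g ∉ F′ → Dep (F′ ▸ g) e ⊎ Dep (F′ ▸ g) f
        two′ {g} g∉ with Dep? (F′ ▸ g) e | Dep? (F′ ▸ g) f
        ... | yes d | _ = inj₁ d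
        ... | no _ | yes d = inj₂ d
        ... | no ¬a | no ¬b = contradiction (¬a , ¬b) (mx g∉)

      -- Unbreakability is never decided: each F, e and f gives either the required circuit or two
      -- classes, which `classify` turns into an outcome.
      unbreakable-or : {O : Set} → (∀ {F e f} → TwoClasses F e f → O) → Connected → Unbreakable ⊎ O
      unbreakable-or {O} classify conn = Sum.map₁ (λ h → conn , λ F fl e f → h F e f fl)
        (allSubset-or λ F → allFin-or λ e → allFin-or λ f → pointwise F e f)
        where
        Dep-flat? : ∀ F → Dec (∀ e → Dep F e → e ∈ F)
        Dep-flat? F = all? λ e → Dep? F e →-dec (e ∈? F)
        pointwise : ∀ F e f → (Flat F → e ∉ F → f ∉ F → e ≢ f → ∃[ D ] (ContrCircuit F D × e ∈ D × f ∈ D)) ⊎ O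
        pointwise F e f with Dep-flat? F | e ∈? F | f ∈? F | e ≟ᶠ f
        ... | no ¬fl | _ | _ | _ = inj₁ λ fl → ⊥-elim (¬fl λ e d → fl e (Dep⇒InClosure d))
        ... | yes fl | yes e∈ | _ | _ = inj₁ λ _ e∉ → contradiction e∈ e∉
        ... | yes fl | no e∉ | yes f∈ | _ = inj₁ λ _ _ f∉ → contradiction f∈ f∉
        ... | yes fl | no e∉ | no f∉ | yes eq = inj₁ λ _ _ _ ≢ → contradiction eq ≢
        ... | yes fl | no e∉ | no f∉ | no e≢f with circuit-or-classes {F} (λ e c → fl e (InClosure⇒Dep c)) e∉ f∉ e≢f
        ... | inj₁ D = inj₁ λ _ _ _ _ → D
        ... | inj₂ (F′ , tc) = inj₂ (classify tc)

      -- Modulo the intersection F, a circuit through both classes has no third element, for that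
      -- would be parallel to one of the two. Together with F it would then put e₂ into the closure
      -- of H₁.
      breakable : (H₁ H₂ : Subset m) → (∀ {e} → Dep H₁ e → e ∈ H₁) → (∀ {e} → Dep H₂ e → e ∈ H₂) →
        (∀ {e} → e ∈ H₁ ⊎ e ∈ H₂) → (∃[ e ] e ∉ H₁) → (∃[ e ] e ∉ H₂) →
        (∀ {e f} → e ∉ H₁ → f ∉ H₁ → Dep ((H₁ ∩ H₂) ▸ f) e) → (∀ {e f} → e ∉ H₂ → f ∉ H₂ → Dep ((H₁ ∩ H₂) ▸ f) e) →
        ¬ Unbreakable
      breakable H₁ H₂ fl₁ fl₂ cover (e₂ , e₂∉) (e₁ , e₁∉) par₁ par₂ (_ , unb) = absurd (unb F flatF e₁ e₂ (e₁∉ ∘ proj₂ ∘ x∈p∩q⁻ H₁ H₂) (e₂∉ ∘ proj₁ ∘ x∈p∩q⁻ H₁ H₂) e₁≢e₂)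
        where
        F : Subset m
        F = H₁ ∩ H₂
        e₁∈ : e₁ ∈ H₁
        e₁∈ = [ id , (λ z → contradiction z e₁∉) ]′ cover
        e₁≢e₂ : e₁ ≢ e₂
        e₁≢e₂ refl = e₂∉ e₁∈
        flatF : Flat F
        flatF g c = x∈p∩q⁺ (fl₁ (Dep-mono (proj₁ ∘ x∈p∩q⁻ H₁ H₂) (InClosure⇒Dep c)) , fl₂ (Dep-mono (proj₂ ∘ x∈p∩q⁻ H₁ H₂) (InClosure⇒Dep c)))
        -- Two parallel elements of D already form a circuit of M/F, so D has no third element.
        small : ∀ {D a b z} → (∀ D′ → ContrForm F D′ → Nonempty D′ → D′ ⊆ D → D ⊆ D′) →
          a ∈ D → b ∈ D → Dep (F ▸ b) a → a ∉ F → a ≢ b → z ∈ D → z ≢ a → z ≢ b → ⊥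
        small {D} {a} {b} mn a∈ b∈ d a∉F a≢b z∈ z≢a z≢b with Dep⇒circuit (λ a∈′ → [ a∉F , a≢b ]′ (▸⁻ a∈′)) d
        ... | S , s , a∈S , S⊆ =
          [ z≢a , z≢b ]′ (in-S (mn (S ∩ ∁ F) (S , s , refl) (a , x∈p∩q⁺ (a∈S , x∉p⇒x∈∁p a∉F)) sub z∈))
          where
          in-S : ∀ {y} → y ∈ S ∩ ∁ F → y ≡ a ⊎ y ≡ b
          in-S y∈ with x∈p∩q⁻ S (∁ F) y∈
          ... | y∈S , y∉F with S⊆ y∈S
          ... | inj₂ eq = inj₁ eq
          ... | inj₁ w with ▸⁻ w
          ... | inj₁ y∈F = contradiction y∈F (x∈∁p⇒x∉p y∉F)
          ... | inj₂ eq = inj₂ eq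
          sub : S ∩ ∁ F ⊆ D
          sub y∈ with in-S y∈
          ... | inj₁ refl = a∈
          ... | inj₂ refl = b∈
        absurd : ∃[ D ] (ContrCircuit F D × e₁ ∈ D × e₂ ∈ D) → ⊥
        absurd (D , ((C , c , refl) , _ , mn) , e₁∈D , e₂∈D) with any? (λ x → x ∈? D ×-dec (¬? (x ≟ᶠ e₁) ×-dec ¬? (x ≟ᶠ e₂)))
        ... | no none = e₂∉ (fl₁ (circuit⇒Dep c (proj₁ (x∈p∩q⁻ C (∁ F) e₂∈D)) λ {x} x∈ → pos x∈ (x ≟ᶠ e₁) (x ≟ᶠ e₂) (x ∈? F)))
          where
          pos : ∀ {x} → x ∈ C → Dec (x ≡ e₁) → Dec (x ≡ e₂) → Dec (x ∈ F) → x ∈ H₁ ⊎ x ≡ e₂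
          pos x∈ (yes refl) _ _ = inj₁ e₁∈
          pos x∈ (no _) (yes eq) _ = inj₂ eq
          pos x∈ (no _) (no _) (yes x∈F) = inj₁ (proj₁ (x∈p∩q⁻ H₁ H₂ x∈F))
          pos x∈ (no a) (no b) (no x∉F) = contradiction (_ , x∈p∩q⁺ (x∈ , x∉p⇒x∈∁p x∉F) , a , b) none
        ... | yes (x , x∈D , x≢e₁ , x≢e₂) with x ∈? H₁ | x ∈? H₂
        ... | yes a | yes b = x∈∁p⇒x∉p (proj₂ (x∈p∩q⁻ C (∁ F) x∈D)) (x∈p∩q⁺ (a , b))
        ... | no x∉ | _ = small mn e₂∈D x∈D (par₁ e₂∉ x∉) (e₂∉ ∘ proj₁ ∘ x∈p∩q⁻ H₁ H₂) (x≢e₂ ∘ sym) e₁∈D e₁≢e₂ (x≢e₁ ∘ sym)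
        ... | yes _ | no x∉ = small mn e₁∈D x∈D (par₂ e₁∉ x∉) (e₁∉ ∘ proj₂ ∘ x∈p∩q⁻ H₁ H₂) (x≢e₁ ∘ sym) e₂∈D (e₁≢e₂ ∘ sym) (x≢e₂ ∘ sym)

    -- Hyperplanes

    record Respects (X : Subset m) (W : Fin n → Set) : Set where
      constructor respects
      field
        at-ends : ∀ {e} → e ∈ X → (W (src e) → W (tgt e)) × (W (tgt e) → W (src e))
    open Respects

    R-respects : ∀ {X W} → Respects X W → ∀ {u v} → R X u v → W u → W v
    R-respects h rfl w = w
    R-respects h (cns {e} e∈ j r) w with joins-unique (joins-ends e) j
    ... | inj₁ (refl , refl) = R-respects h r (proj₁ (at-ends h e∈) w)
    ... | inj₂ (refl , refl) = R-respects h r (proj₂ (at-ends h e∈) w)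

    opaque
      -- Maximality speaks of A and dependence of X; it is enough that A contains the component of e
      -- in X, as the whole cycle lies there.
      chord-unbalanced : ∀ {A X e} → e ∉ X → R X (src e) (tgt e) → ¬ Bal A e →
        (∀ {f} → f ∈ X → R X (src e) (src f) → f ∈ A) →
        ∃[ C ] (E C ⊆ X ▸ e × cls (E C) ≢ bal × src e ∈ V C × (∀ {x} → x ∈ V C → R X (src e) x))
      chord-unbalanced {A} {X} {e} e∉ r ¬b h with chord-cycle e∉ r
      ... | C , e∈C , C⊆ , near = C , C⊆ , (λ k → ¬b (C , e∈C , (λ f∈ → move f∈ (▸⁻ (C⊆ f∈))) , k)) , src∈V C e∈C , near
        where
        move : ∀ {f} → f ∈ E C → f ∈ X ⊎ f ≡ e → f ∈ A ▸ e
        move f∈ (inj₁ f∈X) = ▸ˡ (h f∈X (near (src∈V C f∈)))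
        move f∈ (inj₂ refl) = ▸ʳ

    chord-Bal : ∀ {X e} → R X (src e) (tgt e) → (∀ C → E C ⊆ X ▸ e → (∀ {x} → x ∈ V C → R X (src e) x) → cls (E C) ≡ bal) → Dep X e
    chord-Bal {X} {e} r h with e ∈? X
    ... | yes e∈ = member e∈
    ... | no e∉ with chord-cycle e∉ r
    ... | C , e∈C , C⊆ , near = by-bal (C , e∈C , C⊆ , h C C⊆ near)

    opaque
      unbalanced-outside : ∀ {A} → Balanced A → ∀ C → cls (E C) ≢ bal → ∃[ e ] (e ∈ E C × e ∉ A)
      unbalanced-outside {A} b C ≢b with any? (λ e → e ∈? E C ×-dec ¬? (e ∈? A))
      ... | yes r = r
      ... | no none = contradiction (b C λ {e} e∈ → inA e∈ (e ∈? A)) ≢b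
        where
        inA : ∀ {e} → e ∈ E C → Dec (e ∈ A) → e ∈ A
        inA e∈ (yes e∈A) = e∈A
        inA e∈ (no e∉A) = contradiction (_ , e∈ , e∉A) none

    balanced-flat : ∀ {A e} → MaxBalanced ⊤ A → Dep A e → e ∈ A
    balanced-flat {A} {e} mb d with e ∈? A
    ... | yes e∈ = e∈
    ... | no e∉ with d
    ... | member e∈ = e∈
    ... | by-bal b = contradiction b (MaxBalanced.¬Bal mb ∈⊤ e∉)
    ... | by-full _ (inj₁ (C , sub , k)) = contradiction (trans (sym k) (MaxBalanced.balanced mb C sub)) lft≢bal
    ... | by-full _ (inj₂ f) = contradiction f (¬FAt-BalAt (Balanced⇒BalAt (MaxBalanced.balanced mb)))
    ... | by-frames f _ = contradiction f (¬FAt-BalAt (Balanced⇒BalAt (MaxBalanced.balanced mb)))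

    module _ {W : Fin n → Set} (W? : ∀ v → Dec (W v)) where
      private
        uncut? : ∀ e → Dec ((W (src e) × W (tgt e)) ⊎ (¬ W (src e) × ¬ W (tgt e)))
        uncut? e = (W? (src e) ×-dec W? (tgt e)) ⊎-dec (¬? (W? (src e)) ×-dec ¬? (W? (tgt e)))

      -- The complement of the edge cut around W.
      uncut : Subset m
      uncut = comprehension uncut?

      uncut⁺ : ∀ {e} → (W (src e) × W (tgt e)) ⊎ (¬ W (src e) × ¬ W (tgt e)) → e ∈ uncut
      uncut⁺ = ∈-comprehension⁺ uncut?

      uncut-respects : Respects uncut W
      uncut-respects = respects λ e∈ → case (∈-comprehension⁻ uncut? e∈)
        where
        case : ∀ {e} → (W (src e) × W (tgt e)) ⊎ (¬ W (src e) × ¬ W (tgt e)) → (W (src e) → W (tgt e)) × (W (tgt e) → W (src e))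
        case (inj₁ (s , t)) = (λ _ → t) , (λ _ → s)
        case (inj₂ (¬s , ¬t)) = (λ s → contradiction s ¬s) , (λ t → contradiction t ¬t)

      uncut∁-respects : Respects uncut (¬_ ∘ W)
      uncut∁-respects = respects λ e∈ →
        (λ ¬s t → ¬s (proj₂ (at-ends uncut-respects e∈) t)) , (λ ¬t s → ¬t (proj₁ (at-ends uncut-respects e∈) s))

      cut-ends : ∀ {e} → ((W (src e) × W (tgt e)) ⊎ (¬ W (src e) × ¬ W (tgt e)) → ⊥) → ∃[ u ] ∃[ v ] (Joins G e u v × W u × ¬ W v)
      cut-ends {e} ¬un with W? (src e) | W? (tgt e)
      ... | yes s | yes t = contradiction (inj₁ (s , t)) ¬un
      ... | yes s | no t = _ , _ , joins-ends e , s , t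
      ... | no s | yes t = _ , _ , flipJ (joins-ends e) , t , s
      ... | no s | no t = contradiction (inj₂ (s , t)) ¬un

      -- The ends of a cut edge are in different components of `uncut`, so only frame cycles on both
      -- sides could make it dependent.
      uncut-flat : (∀ C D → cls (E C) ≡ frm → cls (E D) ≡ frm → (∀ {x} → x ∈ V C → W x) → (∀ {x} → x ∈ V D → ¬ W x) → ⊥) →
        ∀ {e} → Dep uncut e → e ∈ uncut
      uncut-flat h {e} d with W? (src e) | W? (tgt e)
      ... | yes s | yes t = uncut⁺ (inj₁ (s , t))
      ... | no s | no t = uncut⁺ (inj₂ (s , t))
      uncut-flat h (member e∈) | yes s | no t = e∈
      uncut-flat h (by-bal b) | yes s | no t = contradiction (R-respects uncut-respects (Bal-chord b) s) t
      uncut-flat h (by-full r _) | yes s | no t = contradiction (R-respects uncut-respects r s) t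
      uncut-flat h (by-frames (C , C⊆ , kC , x , x∈ , rx) (D , D⊆ , kD , y , y∈ , ry)) | yes s | no t =
        ⊥-elim (h C D kC kD (λ z∈ → R-respects uncut-respects (R-trans rx (cycle-connected C C⊆ x∈ z∈)) s)
          (λ z∈ → R-respects uncut∁-respects (R-trans ry (cycle-connected D D⊆ y∈ z∈)) t))
      uncut-flat h (member e∈) | no s | yes t = e∈
      uncut-flat h (by-bal b) | no s | yes t = contradiction (R-respects uncut-respects (R-sym (Bal-chord b)) t) s
      uncut-flat h (by-full r _) | no s | yes t = contradiction (R-respects uncut-respects (R-sym r) t) s
      uncut-flat h (by-frames (D , D⊆ , kD , y , y∈ , ry) (C , C⊆ , kC , x , x∈ , rx)) | no s | yes t =
        ⊥-elim (h C D kC kD (λ z∈ → R-respects uncut-respects (R-trans rx (cycle-connected C C⊆ x∈ z∈)) t)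
          (λ z∈ → R-respects uncut∁-respects (R-trans ry (cycle-connected D D⊆ y∈ z∈)) s))

      -- The flats used next to a frame cycle: W is kept balanced by restricting to A, and
      -- everything off W, where the frame cycle lies, is retained.
      module Semi (A : Subset m) where
        private
          semi? : ∀ e → Dec ((W (src e) × W (tgt e) × e ∈ A) ⊎ (¬ W (src e) × ¬ W (tgt e)))
          semi? e = (W? (src e) ×-dec (W? (tgt e) ×-dec e ∈? A)) ⊎-dec (¬? (W? (src e)) ×-dec ¬? (W? (tgt e)))

        semi : Subset m
        semi = comprehension semi?

        semi⁺ : ∀ {e} → (W (src e) × W (tgt e) × e ∈ A) ⊎ (¬ W (src e) × ¬ W (tgt e)) → e ∈ semi
        semi⁺ = ∈-comprehension⁺ semi?

        semi⁻ : ∀ {e} → e ∈ semi → (W (src e) × W (tgt e) × e ∈ A) ⊎ (¬ W (src e) × ¬ W (tgt e))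
        semi⁻ = ∈-comprehension⁻ semi?

        semi-A : ∀ {e} → e ∈ semi → W (src e) → e ∈ A
        semi-A e∈ s with semi⁻ e∈
        ... | inj₁ (_ , _ , e∈A) = e∈A
        ... | inj₂ (¬s , _) = contradiction s ¬s

        semi-respects : Respects semi W
        semi-respects = respects λ e∈ → case (semi⁻ e∈)
          where
          case : ∀ {e} → (W (src e) × W (tgt e) × e ∈ A) ⊎ (¬ W (src e) × ¬ W (tgt e)) →
            (W (src e) → W (tgt e)) × (W (tgt e) → W (src e))
          case (inj₁ (s , t , _)) = (λ _ → t) , (λ _ → s)
          case (inj₂ (¬s , ¬t)) = (λ s → contradiction s ¬s) , (λ t → contradiction t ¬t)

        semi∉ : ∀ {e} → e ∉ semi → (W (src e) × W (tgt e) × e ∉ A) ⊎ ∃[ u ] ∃[ v ] (Joins G e u v × W u × ¬ W v)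
        semi∉ {e} e∉ with W? (src e) | W? (tgt e)
        ... | yes s | yes t = inj₁ (s , t , λ e∈A → e∉ (semi⁺ (inj₁ (s , t , e∈A))))
        ... | yes s | no t = inj₂ (_ , _ , joins-ends e , s , t)
        ... | no s | yes t = inj₂ (_ , _ , flipJ (joins-ends e) , t , s)
        ... | no s | no t = contradiction (semi⁺ (inj₂ (s , t))) e∉

        -- An unbalanced cycle through e inside W would be disjoint both from the frame cycle and from any
        -- lift cycle outside W, so it could be of neither kind.
        semi-flat : Balanced A → (∀ {e} → W (src e) → W (tgt e) → e ∉ A → ¬ Bal A e × R semi (src e) (tgt e)) →
          (D₀ : Cycle G) → cls (E D₀) ≡ frm → (∀ {x} → x ∈ V D₀ → ¬ W x) → ∀ {e} → Dep semi e → e ∈ semi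
        semi-flat bA hyp D₀ k₀ out {e} d with e ∈? semi
        ... | yes e∈ = e∈
        ... | no e∉ with semi∉ e∉
        ... | inj₂ (u , v , j , wu , ¬wv) = ⊥-elim (by-type d)
          where
          ¬r : ¬ R semi (src e) (tgt e)
          ¬r r with joins-unique (joins-ends e) j
          ... | inj₁ (refl , refl) = ¬wv (R-respects semi-respects r wu)
          ... | inj₂ (refl , refl) = ¬wv (R-respects semi-respects (R-sym r) wu)
          noF : ∀ {u} → W u → ¬ FAt semi u
          noF wu (C , C⊆ , k , x , x∈ , rx) = frm≢bal (trans (sym k) (bA C λ f∈ →
            semi-A (C⊆ f∈) (R-respects semi-respects (R-trans rx (cycle-connected C C⊆ x∈ (src∈V C f∈))) wu)))
          by-type : Dep semi e → ⊥
          by-type (member e∈) = e∉ e∈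
          by-type (by-bal b) = ¬r (Bal-chord b)
          by-type (by-full r _) = ¬r r
          by-type (by-frames f f′) with joins-unique (joins-ends e) j
          ... | inj₁ (refl , refl) = noF wu f
          ... | inj₂ (refl , refl) = noF wu f′
        ... | inj₁ (s , t , e∉A) with hyp s t e∉A
        ... | ¬b , r with chord-unbalanced {A} e∉ r ¬b (λ f∈ r′ → semi-A f∈ (R-respects semi-respects r′ s))
        ... | C , C⊆ , unb , s∈C , near = ⊥-elim (by-type d)
          where
          inW : ∀ {x} → x ∈ V C → W x
          inW x∈ = R-respects semi-respects (near x∈) s
          kC : cls (E C) ≡ frm
          kC with kind-cases C unb
          ... | inj₂ k = k
          ... | inj₁ k = ⊥-elim (lf-disjoint C D₀ k k₀ λ x∈ x∈′ → out x∈′ (inW x∈))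
          insideA : ∀ D → E D ⊆ semi → ∀ {x} → x ∈ V D → W x → cls (E D) ≡ bal
          insideA D D⊆ x∈ wx = bA D λ f∈ → semi-A (D⊆ f∈) (R-respects semi-respects (cycle-connected D D⊆ x∈ (src∈V D f∈)) wx)
          noF : ¬ FAt semi (src e)
          noF (D , D⊆ , k , x , x∈ , rx) = frm≢bal (trans (sym k) (insideA D D⊆ x∈ (R-respects semi-respects rx s)))
          by-type : Dep semi e → ⊥
          by-type (member e∈) = e∉ e∈
          by-type (by-bal (D , e∈ , D⊆ , k)) = ¬b (D , e∈ , (λ f∈ → move f∈ (▸⁻ (D⊆ f∈))) , k)
            where
            move : ∀ {f} → f ∈ E D → f ∈ semi ⊎ f ≡ e → f ∈ A ▸ e
            move f∈ (inj₁ f∈′) = ▸ˡ (semi-A f∈′ (R-respects semi-respects (cycle-R D e∈ D⊆ (src∈V D e∈) (src∈V D f∈)) s))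
            move f∈ (inj₂ refl) = ▸ʳ
          by-type (by-full _ (inj₂ f)) = noF f
          by-type (by-frames f _) = noF f
          by-type (by-full _ (inj₁ (D , D⊆ , k))) = lf-disjoint D C k kC λ x∈ x∈C →
            lft≢bal (trans (sym k) (insideA D D⊆ x∈ (inW x∈C)))

    module _ {W : Fin n → Set} (W? : ∀ v → Dec (W v)) {M N : Subset m} (bM : Balanced M) (bN : Balanced N)
      (M∉ : ∀ {k} → k ∈ M → ¬ W (src k) × ¬ W (tgt k)) (N∈ : ∀ {k} → k ∈ N → W (src k) × W (tgt k)) where

      ∪-respects : Respects (M ∪ N) W
      ∪-respects = respects λ k∈ → [ (λ z → (λ w → contradiction w (proj₁ (M∉ z))) , (λ w → contradiction w (proj₂ (M∉ z))))
                                   , (λ z → (λ _ → proj₂ (N∈ z)) , (λ _ → proj₁ (N∈ z))) ]′ (x∈p∪q⁻ M N k∈)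

      ∪-balanced : Balanced (M ∪ N)
      ∪-balanced C C⊆ with cycle-edge C
      ... | d , d∈ with W? (src d)
      ... | yes w = bN C λ q∈ → [ (λ z → contradiction (reach q∈) (proj₁ (M∉ z))) , id ]′ (x∈p∪q⁻ M N (C⊆ q∈))
        where
        reach : ∀ {q} → q ∈ E C → W (src q)
        reach q∈ = R-respects ∪-respects (cycle-connected C C⊆ (src∈V C d∈) (src∈V C q∈)) w
      ... | no ¬w = bM C λ q∈ → [ id , (λ z → contradiction (reach q∈ (proj₁ (N∈ z))) ¬w) ]′ (x∈p∪q⁻ M N (C⊆ q∈))
        where
        reach : ∀ {q} → q ∈ E C → W (src q) → W (src d)
        reach q∈ = R-respects ∪-respects (cycle-connected C C⊆ (src∈V C q∈) (src∈V C d∈))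

    -- Vertex partitions and parallel edges

    module Coloured {k : ℕ} (part : Fin n → Fin k) where

      Between : Fin k → Fin k → Fin m → Set
      Between i j e = ∃[ u ] ∃[ v ] (Joins G e u v × part u ≡ i × part v ≡ j)

      Monochrome : Subset m → Set
      Monochrome F = ∀ {e} → e ∈ F → part (src e) ≡ part (tgt e)

      R-mono-part : ∀ {F} → Monochrome F → ∀ {u v} → R F u v → part u ≡ part v
      R-mono-part h rfl = refl
      R-mono-part h (cns {e} e∈ j r) with joins-unique (joins-ends e) j
      ... | inj₁ (refl , refl) = trans (h e∈) (R-mono-part h r)
      ... | inj₂ (refl , refl) = trans (sym (h e∈)) (R-mono-part h r)

      module _ {F : Subset m} (same : ∀ {u v} → part u ≡ part v → R F u v) where

        between-R : ∀ {i j e f} → Between i j e → Between i j f → R (F ▸ f) (src e) (tgt e)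
        between-R {e = e} {f} (u , v , je , pu , pv) (u′ , v′ , jf , pu′ , pv′) with joins-unique (joins-ends e) je
        ... | inj₁ (refl , refl) = R-trans (R-mono ▸ˡ (same (trans pu (sym pu′)))) (R-trans (R-joins ▸ʳ jf) (R-mono ▸ˡ (same (trans pv′ (sym pv)))))
        ... | inj₂ (refl , refl) = R-sym (R-trans (R-mono ▸ˡ (same (trans pu (sym pu′)))) (R-trans (R-joins ▸ʳ jf) (R-mono ▸ˡ (same (trans pv′ (sym pv))))))

        -- The two ways in which f can equip the balanced part i with a frame cycle, where part j
        -- has one: f leads to part j, or f closes an unbalanced cycle inside part i.
        Activating : Fin k → Fin k → Fin m → Set
        Activating i j f = Between i j f ⊎ (part (src f) ≡ i × part (tgt f) ≡ i × f ∉ F × ¬ Bal F f)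

        module _ (mono : Monochrome F) {i j : Fin k} (i≢j : i ≢ j) (D₀ : Cycle G) (D₀⊆ : E D₀ ⊆ F) (k₀ : cls (E D₀) ≡ frm)
          (in-j : ∀ {x} → x ∈ V D₀ → part x ≡ j) where
          private
            d₀ = src∈V D₀ (proj₂ (cycle-edge D₀))

            frame-j : ∀ {v} → part v ≡ j → FAt F v
            frame-j pv = D₀ , D₀⊆ , k₀ , _ , d₀ , same (trans pv (sym (in-j d₀)))

          activated : ∀ {f} → Activating i j f → ∀ {v} → part v ≡ i ⊎ part v ≡ j → FAt (F ▸ f) v
          activated act (inj₂ pv) = FAt-mono ▸ˡ (frame-j pv)
          activated (inj₁ (u , w , jf , pu , pw)) (inj₁ pv) =
            FAt-R (R-trans (R-mono ▸ˡ (same (trans pv (sym pu)))) (R-joins ▸ʳ jf)) (FAt-mono ▸ˡ (frame-j pw))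
          activated (inj₂ (ps , pt , f∉ , ¬b)) (inj₁ pv) with chord-unbalanced f∉ (same (trans ps (sym pt))) ¬b (λ f∈ _ → f∈)
          ... | C , C⊆ , unb , s∈ , near with kind-cases C unb
          ... | inj₂ kC = C , C⊆ , kC , _ , s∈ , R-mono ▸ˡ (same (trans pv (sym ps)))
          -- A lift cycle within part i would be disjoint from D₀, which lies in part j.
          ... | inj₁ kC = ⊥-elim (lf-disjoint C D₀ kC k₀ λ x∈ x∈′ →
                  i≢j (trans (sym ps) (trans (R-mono-part mono (near x∈)) (in-j x∈′))))

          activating-parallel : ∀ {e f} → Activating i j e → Activating i j f → Dep (F ▸ f) e
          activating-parallel {e} (inj₂ (ps , pt , _)) af = by-frames (activated af (inj₁ ps)) (activated af (inj₁ pt))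
          activating-parallel {e} (inj₁ (u , w , je , pu , pw)) af with joins-unique (joins-ends e) je
          ... | inj₁ (refl , refl) = by-frames (activated af (inj₁ pu)) (activated af (inj₂ pw))
          ... | inj₂ (refl , refl) = by-frames (activated af (inj₂ pw)) (activated af (inj₁ pu))

    cells-connected : ∀ {k} (p : Partition n k) {Y : Subset m} (A : Fin k → Subset m) → let open Partition p in
      (∀ i → ConnectedOn G (cell i) (A i)) → (∀ {i e} → e ∈ A i → part (src e) ≡ i → part (tgt e) ≡ i → e ∈ Y) →
      ∀ {u v} → part u ≡ part v → R Y u v
    cells-connected p A conn h {u} {v} eq = connectedOn⇒R (λ e∈ s t → h e∈ (∈-cell⁻ p s) (∈-cell⁻ p t)) (conn (part v))
      (∈-cell⁺ p eq) (∈-cell⁺ p refl)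
      where open Partition p

    -- Graphs missing only a short path

    module NearlyComplete (si : SiCompleteMinusPath G) (3<n : 3 < n) where

      private
        P = proj₁ si

      adj? : ∀ u v → Dec (Adj G u v)
      adj? u v = any? λ e → Joins? e u v

      nonadjacent : ∀ {u v} → u ≢ v → ¬ Adj G u v → PathPair P u v
      nonadjacent {u} {v} u≢v ¬a with pathPair? P u v
      ... | yes p = p
      ... | no ¬p = contradiction (Equivalence.from (proj₂ si u v u≢v) ¬p) ¬a

      adjacent : ∀ {u v} → u ≢ v → ¬ PathPair P u v → Adj G u v
      adjacent {u} {v} u≢v = Equivalence.from (proj₂ si u v u≢v)

      opaque
        -- Connectedness of G in cut form. If no edge crosses the cut, all crossing pairs are
        -- missing. Among four vertices, a 2+2 cut has two disjoint missing pairs and a 1+3 cut has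
        -- three, too many for a path with at most two edges.
        leaving-edge : 3 < n → ∀ {Q : Fin n → Set} (Q? : ∀ x → Dec (Q x)) → ∀ {a b} → Q a → ¬ Q b →
          ∃[ e ] ∃[ u ] ∃[ v ] (Joins G e u v × Q u × ¬ Q v)
        leaving-edge lt {Q} Q? {a} {b} qa ¬qb
          with any? (λ u → any? λ v → Q? u ×-dec (¬? (Q? v) ×-dec adj? u v))
        ... | yes (u , v , qu , ¬qv , e , j) = e , u , v , j , qu , ¬qv
        ... | no none = ⊥-elim (four (fresh lt a b a))
          where
          sep : ∀ {s t} → Q s → ¬ Q t → s ≢ t
          sep qs ¬qt refl = ¬qt qs
          pair : ∀ {s t} → Q s → ¬ Q t → PathPair P s t
          pair qs ¬qt = nonadjacent (sep qs ¬qt) λ a → none (_ , _ , qs , ¬qt , a)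
          two-disjoint : ∀ {s t} → Q s → ¬ Q t → s ≢ a → t ≢ b → ⊥
          two-disjoint qs ¬qt s≢a t≢b with pairs-share P (pair qa ¬qb) (pair qs ¬qt)
          ... | inj₁ eq = s≢a (sym eq)
          ... | inj₂ (inj₁ eq) = sep qa ¬qt eq
          ... | inj₂ (inj₂ (inj₁ eq)) = sep qs ¬qb (sym eq)
          ... | inj₂ (inj₂ (inj₂ eq)) = t≢b (sym eq)
          four : ∃[ c ] (c ≢ a × c ≢ b × c ≢ a) → ⊥
          four (c , c≢a , c≢b , _) with fresh lt a b c
          ... | d , d≢a , d≢b , d≢c with Q? c | Q? d
          ... | yes qc | no ¬qd = two-disjoint qc ¬qd c≢a d≢b
          ... | no ¬qc | yes qd = two-disjoint qd ¬qc d≢a c≢b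
          ... | yes qc | yes qd with three-pairs P (pair qa ¬qb) (pair qc ¬qb) (pair qd ¬qb)
          ... | inj₁ (inj₁ (eq , _)) = c≢a (sym eq)
          ... | inj₁ (inj₂ (eq , _)) = sep qa ¬qb eq
          ... | inj₂ (inj₁ (inj₁ (eq , _))) = d≢a (sym eq)
          ... | inj₂ (inj₁ (inj₂ (eq , _))) = sep qa ¬qb eq
          ... | inj₂ (inj₂ (inj₁ (eq , _))) = d≢c (sym eq)
          ... | inj₂ (inj₂ (inj₂ (eq , _))) = sep qc ¬qb eq
          four (c , c≢a , c≢b , _) | d , d≢a , d≢b , d≢c | no ¬qc | no ¬qd
            with three-pairs P (pair qa ¬qb) (pair qa ¬qc) (pair qa ¬qd)
          ... | inj₁ (inj₁ (_ , eq)) = c≢b (sym eq)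
          ... | inj₁ (inj₂ (eq , _)) = sep qa ¬qc eq
          ... | inj₂ (inj₁ (inj₁ (_ , eq))) = d≢b (sym eq)
          ... | inj₂ (inj₁ (inj₂ (eq , _))) = sep qa ¬qd eq
          ... | inj₂ (inj₂ (inj₁ (_ , eq))) = d≢c (sym eq)
          ... | inj₂ (inj₂ (inj₂ (eq , _))) = sep qa ¬qd eq

        -- The two missing pairs at k use up the missing path.
        common-nonneighbour : ∀ {k u v} → u ≢ v → k ≢ u → k ≢ v → ¬ Adj G k u → ¬ Adj G k v → Adj G u v
        common-nonneighbour {k} {u} {v} u≢v k≢u k≢v ¬ku ¬kv = adjacent u≢v λ p →
          case (three-pairs P (nonadjacent k≢u ¬ku) (nonadjacent k≢v ¬kv) p)
          where
          case : SamePair k u k v ⊎ SamePair k u u v ⊎ SamePair k v u v → ⊥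
          case (inj₁ (inj₁ (_ , eq))) = u≢v eq
          case (inj₁ (inj₂ (eq , _))) = k≢v eq
          case (inj₂ (inj₁ (inj₁ (eq , _)))) = k≢u eq
          case (inj₂ (inj₁ (inj₂ (eq , _)))) = k≢v eq
          case (inj₂ (inj₂ (inj₁ (eq , _)))) = k≢u eq
          case (inj₂ (inj₂ (inj₂ (eq , _)))) = k≢v eq

        disjoint-nonedge : ∀ {a b u v} → u ≢ v → a ≢ b → ¬ Adj G a b → a ≢ u → a ≢ v → b ≢ u → b ≢ v → Adj G u v
        disjoint-nonedge u≢v a≢b ¬ab a≢u a≢v b≢u b≢v = adjacent u≢v λ p →
          [ a≢u , [ a≢v , [ b≢u , b≢v ]′ ]′ ]′ (pairs-share P (nonadjacent a≢b ¬ab) p)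

      -- Outcomes break the matroid

      no-edge : ∀ {k} (p : Partition n k) {a b} → let open Partition p in NoEdgesBetween G (cell a) (cell b) →
        ∀ {e u v} → Joins G e u v → part u ≡ a → part v ≡ b → ⊥
      no-edge p none {e} j pu pv with joins-unique (joins-ends e) j
      ... | inj₁ (refl , refl) = none (e , ∈-crossE⁺ (inj₁ (∈-cell⁺ p pu , ∈-cell⁺ p pv)))
      ... | inj₂ (refl , refl) = none (e , ∈-crossE⁺ (inj₂ (∈-cell⁺ p pv , ∈-cell⁺ p pu)))

      cut-exists : ∀ {k} (p : Partition n k) {i j} → i ≢ j → let open Partition p in
        ∃[ e ] ∃[ u ] ∃[ v ] (Joins G e u v × part u ≡ i × part v ≢ i)
      cut-exists p {i} {j} i≢j = leaving-edge 3<n (λ v → part v ≟ᶠ i) (proj₂ (nonempty i)) λ eq → i≢j (trans (sym eq) (proj₂ (nonempty j)))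
        where open Partition p

      inside-cell : ∀ {k} (p : Partition n k) {i} D → let open Partition p in V D ⊆ cell i → ∀ {f} → f ∈ E D → part (src f) ≡ i × part (tgt f) ≡ i
      inside-cell p D sub f∈ = ∈-cell⁻ p (sub (src∈V D f∈)) , ∈-cell⁻ p (sub (tgt∈V D f∈))

      -- The cells 0 and 1 are not adjacent, so all edges leaving either of them go to cell 2;
      -- removing one of these two bundles gives a flat. One edge of a bundle joins the cells, and
      -- then the lift cycle or global balance makes the rest dependent.
      fromI : OutcomeI G cls → ¬ Unbreakable
      fromI (p , c₀ , c₁ , c₂ , none , alt) = breakable (H 1F) (H 0F) flat₁ flat₀
          cover (missing {1F} {2F} (λ ())) (missing {0F} {2F} (λ ()))
          (λ e∉ f∉ → parallel (btw₁ e∉) (btw₁ f∉)) (λ e∉ f∉ → parallel (btw₀ e∉) (btw₀ f∉))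
        where
        open Partition p
        open Coloured part
        H : Fin 3 → Subset m
        H i = uncut (λ v → part v ≟ᶠ i)
        F = H 1F ∩ H 0F
        missing : ∀ {i j} → i ≢ j → ∃[ e ] e ∉ H i
        missing {i} i≢j with cut-exists p i≢j
        ... | e , u , v , j , pu , ¬pv = e , λ e∈ → ¬pv (R-respects (uncut-respects (λ v → part v ≟ᶠ i)) (R-joins e∈ j) pu)
        cut : ∀ {i e} → e ∉ H i → ∃[ u ] ∃[ v ] (Joins G e u v × part u ≡ i × part v ≢ i)
        cut {i} e∉ = cut-ends (λ v → part v ≟ᶠ i) (λ z → e∉ (uncut⁺ (λ v → part v ≟ᶠ i) z))
        btw₁ : ∀ {e} → e ∉ H 1F → Between 1F 2F e
        btw₁ e∉ with cut e∉
        ... | u , v , j , pu , ¬pv = u , v , j , pu , third (λ pv → no-edge p none (flipJ j) pv pu) ¬pv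
        btw₀ : ∀ {e} → e ∉ H 0F → Between 0F 2F e
        btw₀ e∉ with cut e∉
        ... | u , v , j , pu , ¬pv = u , v , j , pu , third ¬pv (λ pv → no-edge p none j pu pv)
        same-end : ∀ {e a b} → Between a 2F e → Between b 2F e → a ≢ 2F → b ≢ 2F → a ≡ b
        same-end (u , v , j , refl , pv) (u′ , v′ , j′ , refl , pv′) a≢ b≢ with joins-unique j j′
        ... | inj₁ (refl , refl) = refl
        ... | inj₂ (refl , refl) = contradiction pv′ a≢
        cover : ∀ {e} → e ∈ H 1F ⊎ e ∈ H 0F
        cover {e} with e ∈? H 1F | e ∈? H 0F
        ... | yes a | _ = inj₁ a
        ... | no _ | yes b = inj₂ b
        ... | no a | no b = contradiction (same-end (btw₁ a) (btw₀ b) (λ ()) (λ ())) λ ()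
        conn : ∀ i → InducedConnected G (cell i)
        conn 0F = c₀
        conn 1F = c₁
        conn 2F = c₂
        inside : ∀ {i e} → part (src e) ≡ i → part (tgt e) ≡ i → e ∈ F
        inside {i} ps pt = x∈p∩q⁺ (uncut⁺ (λ v → part v ≟ᶠ 1F) (both 1F) , uncut⁺ (λ v → part v ≟ᶠ 0F) (both 0F))
          where
          both : ∀ j → (part _ ≡ j × part _ ≡ j) ⊎ (part _ ≢ j × part _ ≢ j)
          both j with i ≟ᶠ j
          ... | yes refl = inj₁ (ps , pt)
          ... | no i≢j = inj₂ ((λ eq → i≢j (trans (sym ps) eq)) , (λ eq → i≢j (trans (sym pt) eq)))
        same : ∀ {u v} → part u ≡ part v → R F u v
        same = cells-connected p (λ _ → ⊤) conn (λ _ → inside)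
        parallel : ∀ {i j e f} → Between i j e → Between i j f → Dep (F ▸ f) e
        parallel be bf = by-full⊎ alt
          where
          by-full⊎ : (∃[ i ] ContainsCycleOf G cls lft (cell i)) ⊎ AllBalanced G cls → Dep (F ▸ _) _
          by-full⊎ (inj₁ (_ , D , sub , k)) = by-full (between-R same be bf)
            (inj₁ (D , (λ f∈ → ▸ˡ (let s , t = inside-cell p D sub f∈ in inside s t)) , k))
          by-full⊎ (inj₂ all) = chord-Bal (between-R same be bf) (λ C _ _ → all C)
        flat : ∀ i {e} → Dep (H i) e → e ∈ H i
        flat i = uncut-flat (λ v → part v ≟ᶠ i) (clash alt)
          where
          -- The lift cycle stays inside one cell, so it lies on one side of the cut and misses any
          -- frame cycle on the other.
          clash : (∃[ i ] ContainsCycleOf G cls lft (cell i)) ⊎ AllBalanced G cls → ∀ C D → cls (E C) ≡ frm → cls (E D) ≡ frm → (∀ {x} → x ∈ V C → part x ≡ i) → (∀ {x} → x ∈ V D → part x ≢ i) → ⊥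
          clash (inj₂ all) C D kC kD inC outD = frm≢bal (trans (sym kC) (all C))
          clash (inj₁ (l , L , sub , k)) C D kC kD inC outD with l ≟ᶠ i
          ... | yes refl = lf-disjoint L D k kD λ x∈ x∈′ → outD x∈′ (∈-cell⁻ p (sub x∈))
          ... | no l≢i = lf-disjoint L C k kC λ x∈ x∈′ → l≢i (trans (sym (∈-cell⁻ p (sub x∈))) (inC x∈′))
        flat₁ : ∀ {e} → Dep (H 1F) e → e ∈ H 1F
        flat₁ = flat 1F
        flat₀ : ∀ {e} → Dep (H 0F) e → e ∈ H 0F
        flat₀ = flat 0F

      balancing⇒Balanced : ∀ {X} → Balancing G cls X → Balanced (∁ X)
      balancing⇒Balanced (_ , b) C sub = b C λ { (f , f∈) → let a , c = x∈p∩q⁻ (E C) _ f∈ in x∈∁p⇒x∉p (sub a) c }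

      -- The flats are the complements of the balancing sets. Their intersection connects each cell,
      -- so any edge of X₁ joins the ends of every other one, and the cycles so formed avoid X₂ and
      -- are balanced; likewise with the roles exchanged.
      fromII : OutcomeII G cls → ¬ Unbreakable
      fromII (p , c₀ , c₁ , X₁ , X₂ , dis , un , b₁ , b₂) = breakable (∁ X₁) (∁ X₂)
          (flat b₁ in₂ in₁ F₂ cross₁ bal₂) (flat b₂ in₁ in₂ F₁ cross₂ bal₁)
          cover (missing b₁) (missing b₂)
          (λ e∉ f∉ → parallel bal₂ (cross₁ (out e∉)) (cross₁ (out f∉)) (F₂ (out e∉)) (F₂ (out f∉)) (proj₂ ∘ x∈p∩q⁻ (∁ X₁) (∁ X₂)))
          (λ e∉ f∉ → parallel bal₁ (cross₂ (out e∉)) (cross₂ (out f∉)) (F₁ (out e∉)) (F₁ (out f∉)) (proj₁ ∘ x∈p∩q⁻ (∁ X₁) (∁ X₂)))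
        where
        open Partition p
        open Coloured part
        F = ∁ X₁ ∩ ∁ X₂
        bal₁ : Balanced (∁ X₁)
        bal₁ = balancing⇒Balanced b₁
        bal₂ : Balanced (∁ X₂)
        bal₂ = balancing⇒Balanced b₂
        out : ∀ {X : Subset m} {e} → e ∉ ∁ X → e ∈ X
        out {X} {e} e∉ with e ∈? X
        ... | yes e∈ = e∈
        ... | no e∉X = contradiction (x∉p⇒x∈∁p e∉X) e∉
        F₂ : ∀ {e} → e ∈ X₁ → e ∈ ∁ X₂
        F₂ e∈ = x∉p⇒x∈∁p λ e∈′ → dis (_ , x∈p∩q⁺ (e∈ , e∈′))
        F₁ : ∀ {e} → e ∈ X₂ → e ∈ ∁ X₁
        F₁ e∈ = x∉p⇒x∈∁p λ e∈′ → dis (_ , x∈p∩q⁺ (e∈′ , e∈))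
        cross : ∀ {e} → e ∈ X₁ ∪ X₂ → Between 0F 1F e
        cross {e} e∈ with ∈-crossE⁻ (subst (e ∈_) un e∈)
        ... | inj₁ (s , t) = _ , _ , joins-ends e , ∈-cell⁻ p s , ∈-cell⁻ p t
        ... | inj₂ (s , t) = _ , _ , flipJ (joins-ends e) , ∈-cell⁻ p t , ∈-cell⁻ p s
        cross₁ : ∀ {e} → e ∈ X₁ → Between 0F 1F e
        cross₁ e∈ = cross (x∈p∪q⁺ (inj₁ e∈))
        cross₂ : ∀ {e} → e ∈ X₂ → Between 0F 1F e
        cross₂ e∈ = cross (x∈p∪q⁺ (inj₂ e∈))
        mono-out : ∀ {e} → Between 0F 1F e → part (src e) ≢ part (tgt e)
        mono-out {e} (u , v , j , pu , pv) eq with joins-unique (joins-ends e) j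
        ... | inj₁ (refl , refl) = contradiction (trans (sym pu) (trans eq pv)) λ ()
        ... | inj₂ (refl , refl) = contradiction (trans (sym pu) (trans (sym eq) pv)) λ ()
        inside : ∀ {e} → part (src e) ≡ part (tgt e) → e ∈ F
        inside eq = x∈p∩q⁺ (x∉p⇒x∈∁p (λ e∈ → mono-out (cross₁ e∈) eq) , x∉p⇒x∈∁p (λ e∈ → mono-out (cross₂ e∈) eq))
        conn : ∀ i → InducedConnected G (cell i)
        conn 0F = c₀
        conn 1F = c₁
        same : ∀ {u v} → part u ≡ part v → R F u v
        same = cells-connected p (λ _ → ⊤) conn (λ _ s t → inside (trans s (sym t)))
        in₁ : F ⊆ ∁ X₂
        in₁ = proj₂ ∘ x∈p∩q⁻ (∁ X₁) (∁ X₂)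
        in₂ : F ⊆ ∁ X₁
        in₂ = proj₁ ∘ x∈p∩q⁻ (∁ X₁) (∁ X₂)
        cover : ∀ {e} → e ∈ ∁ X₁ ⊎ e ∈ ∁ X₂
        cover {e} with e ∈? X₁
        ... | yes e∈ = inj₂ (F₂ e∈)
        ... | no e∉ = inj₁ (x∉p⇒x∈∁p e∉)
        missing : ∀ {X} → Balancing G cls X → ∃[ e ] e ∉ ∁ X
        missing b@((C , ≢b) , _) with unbalanced-outside (balancing⇒Balanced b) C ≢b
        ... | e , _ , e∉ = e , e∉
        parallel : ∀ {H e f} → Balanced H → Between 0F 1F e → Between 0F 1F f → e ∈ H → f ∈ H → F ⊆ H → Dep (F ▸ f) e
        parallel bH be bf e∈ f∈ F⊆ = chord-Bal (between-R same be bf) (λ C C⊆ _ → bH C (▸-least (▸-least F⊆ f∈) e∈ ∘ C⊆))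
        -- If some e ∈ X were balanced over the complement of X, then all of X would be, and so all of G.
        flat : ∀ {X X′} → Balancing G cls X → F ⊆ ∁ X → F ⊆ ∁ X′ → (∀ {e} → e ∈ X → e ∈ ∁ X′) →
          (∀ {e} → e ∈ X → Between 0F 1F e) → Balanced (∁ X′) → ∀ {e} → Dep (∁ X) e → e ∈ ∁ X
        flat {X} {X′} b@((C , ≢b) , _) F⊆ F⊆′ X⊆ cr bX′ {e} d with e ∈? X
        ... | no e∉ = x∉p⇒x∈∁p e∉
        ... | yes e∈ with d
        ... | member e∈′ = e∈′
        ... | by-full _ (inj₁ (D , sub , k)) = ⊥-elim (lft≢bal (trans (sym k) (balancing⇒Balanced b D sub)))
        ... | by-full _ (inj₂ f) = ⊥-elim (¬FAt-BalAt (Balanced⇒BalAt (balancing⇒Balanced b)) f)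
        ... | by-frames f _ = ⊥-elim (¬FAt-BalAt (Balanced⇒BalAt (balancing⇒Balanced b)) f)
        ... | by-bal bl with maxBalanced ⊤ (λ _ → ∈⊤) (Balanced-▸ (balancing⇒Balanced b) bl)
        ... | A , sub , mb with unbalanced-outside (MaxBalanced.balanced mb) C ≢b
        ... | g , _ , g∉A with chord-cycle (λ g∈ → g∉A (sub (▸-mono F⊆ g∈))) (between-R same (cr (g∈X g∉A)) (cr e∈))
          where
          g∈X : ∀ {g} → g ∉ A → g ∈ X
          g∈X g∉A = out λ g∈ → g∉A (sub (▸ˡ g∈))
        ... | K , g∈K , K⊆ , _ = ⊥-elim (MaxBalanced.¬Bal mb ∈⊤ g∉A (K , g∈K , ▸-mono (sub ∘ ▸-mono F⊆) ∘ K⊆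
            , bX′ K (▸-least (▸-least F⊆′ (X⊆ e∈)) (X⊆ (out λ g∈ → g∉A (sub (▸ˡ g∈)))) ∘ K⊆)))

      -- The flats are H, which omits the crossing edges, and the maximal balanced A. Crossing edges
      -- avoid X, hence lie in A, and are parallel because A is balanced. Why the edges outside A
      -- are parallel is what separates `OutcomeIII` from `OutcomeIV`.
      module TwoCells (p : Partition n 2) {X A : Subset m} (unb : ∃[ C ] cls (E C) ≢ bal)
        (X⊆H : X ⊆ uncut (λ v → Partition.part p v ≟ᶠ 0F)) (conn : ∀ i → ConnectedOn G (Partition.cell p i) (∁ X))
        (X⊆A : ∁ X ⊆ A) (mb : MaxBalanced ⊤ A) where
        open Partition p
        open Coloured part

        W? : ∀ v → Dec (part v ≡ 0F)
        W? v = part v ≟ᶠ 0F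
        H : Subset m
        H = uncut W?
        F : Subset m
        F = H ∩ A

        outside-A : ∀ {e} → e ∉ A → e ∈ X
        outside-A {e} e∉ with e ∈? X
        ... | yes e∈ = e∈
        ... | no e∉X = contradiction (X⊆A (x∉p⇒x∈∁p e∉X)) e∉

        same : ∀ {u v} → part u ≡ part v → R F u v
        same = cells-connected p (λ _ → ∁ X) conn λ e∈ s t → x∈p∩q⁺ (uncut⁺ W? (both s t) , X⊆A e∈)
          where
          both : ∀ {i x y} → part x ≡ i → part y ≡ i → (part x ≡ 0F × part y ≡ 0F) ⊎ (part x ≢ 0F × part y ≢ 0F)
          both {0F} s t = inj₁ (s , t)
          both {1F} s t = inj₂ ((differ s λ ()) , (differ t λ ()))

        H-mono : ∀ {e} → e ∈ H → part (src e) ≡ part (tgt e)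
        H-mono {e} e∈ with part (src e) ≟ᶠ 0F | Respects.at-ends (uncut-respects W?) e∈
        ... | yes s | f , g = trans s (sym (f s))
        ... | no s | f , g = trans (other s) (sym (other (s ∘ g)))

        chord-ends : ∀ {e} → e ∉ A → part (src e) ≡ part (tgt e)
        chord-ends e∉ = H-mono (X⊆H (outside-A e∉))

        new-unbalanced : ∀ {f} → f ∉ A → ∃[ C ] (E C ⊆ F ▸ f × cls (E C) ≢ bal × src f ∈ V C × (∀ {x} → x ∈ V C → part (src f) ≡ part x))
        new-unbalanced f∉ with chord-unbalanced (f∉ ∘ proj₂ ∘ x∈p∩q⁻ H A) (same (chord-ends f∉)) (MaxBalanced.¬Bal mb ∈⊤ f∉) (λ g∈ _ → proj₂ (x∈p∩q⁻ H A g∈))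
        ... | C , C⊆ , unb , s∈ , near = C , C⊆ , unb , s∈ , R-mono-part (H-mono ∘ proj₁ ∘ x∈p∩q⁻ H A) ∘ near

        two-cells : (∀ C D → cls (E C) ≡ frm → cls (E D) ≡ frm → (∀ {x} → x ∈ V C → part x ≡ 0F) → (∀ {x} → x ∈ V D → part x ≢ 0F) → ⊥) →
          (∀ {e f} → e ∉ A → f ∉ A → Dep (F ▸ f) e) → ¬ Unbreakable
        two-cells noFF par = breakable H A (uncut-flat W? noFF) (balanced-flat mb) cover missing₁ missing₂ cross-par par
          where
          cross∈A : ∀ {e} → e ∉ H → e ∈ A
          cross∈A e∉ = X⊆A (x∉p⇒x∈∁p (e∉ ∘ X⊆H))
          btw : ∀ {e} → e ∉ H → Between 0F 1F e
          btw e∉ with cut-ends W? (λ z → e∉ (uncut⁺ W? z))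
          ... | u , v , j , pu , ¬pv = u , v , j , pu , other ¬pv
          cover : ∀ {e} → e ∈ H ⊎ e ∈ A
          cover {e} with e ∈? H
          ... | yes e∈ = inj₁ e∈
          ... | no e∉ = inj₂ (cross∈A e∉)
          missing₁ : ∃[ e ] e ∉ H
          missing₁ with cut-exists p {0F} {1F} (λ ())
          ... | e , u , v , j , pu , ¬pv = e , λ e∈ → ¬pv (R-respects (uncut-respects W?) (R-joins e∈ j) pu)
          missing₂ : ∃[ e ] e ∉ A
          missing₂ with unbalanced-outside (MaxBalanced.balanced mb) (proj₁ unb) (proj₂ unb)
          ... | e , _ , e∉ = e , e∉
          cross-par : ∀ {e f} → e ∉ H → f ∉ H → Dep (F ▸ f) e
          cross-par e∉ f∉ = chord-Bal (between-R same (btw e∉) (btw f∉)) λ C C⊆ _ →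
            MaxBalanced.balanced mb C (▸-least (▸-least (proj₂ ∘ x∈p∩q⁻ H A) (cross∈A f∉)) (cross∈A e∉) ∘ C⊆)

        -- All edges outside A lie in cell 0, where any of them closes an unbalanced cycle that
        -- makes the others dependent. A frame cycle off cell 0 would avoid X and be balanced.
        one-sided : (∀ {e} → e ∈ X → part (src e) ≡ 0F) → ¬ Unbreakable
        one-sided X₀ = two-cells noFF par
          where
          noFF : ∀ C D → cls (E C) ≡ frm → cls (E D) ≡ frm → (∀ {x} → x ∈ V C → part x ≡ 0F) → (∀ {x} → x ∈ V D → part x ≢ 0F) → ⊥
          noFF _ D _ k _ out = frm≢bal (trans (sym k) (MaxBalanced.balanced mb D λ f∈ → X⊆A (x∉p⇒x∈∁p λ f∈X → out (src∈V D f∈) (X₀ f∈X))))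
          par : ∀ {e f} → e ∉ A → f ∉ A → Dep (F ▸ f) e
          par e∉ f∉ with new-unbalanced f∉
          ... | C , C⊆ , unb , s∈ , _ = by-full (R-mono ▸ˡ (same (chord-ends e∉)))
            (UnbAt⇒Full (C , C⊆ , unb , _ , s∈ , R-mono ▸ˡ (same (trans (X₀ (outside-A e∉)) (sym (X₀ (outside-A f∉)))))))

        -- An unbalanced cycle inside one cell misses the lift cycle of the other, so it is itself a
        -- lift cycle and acts on both cells at once.
        lifted : (∀ i → ∃[ L ] (cls (E L) ≡ lft × (∀ {x} → x ∈ V L → part x ≢ i))) → ¬ Unbreakable
        lifted opposite = two-cells noFF par
          where
          noFF : ∀ C D → cls (E C) ≡ frm → cls (E D) ≡ frm → (∀ {x} → x ∈ V C → part x ≡ 0F) → (∀ {x} → x ∈ V D → part x ≢ 0F) → ⊥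
          noFF C _ k _ inside _ with opposite 0F
          ... | L , kL , off = lf-disjoint L C kL k λ x∈ x∈′ → off x∈ (inside x∈′)
          par : ∀ {e f} → e ∉ A → f ∉ A → Dep (F ▸ f) e
          par {e} {f} e∉ f∉ with new-unbalanced f∉
          ... | C , C⊆ , unb , s∈ , near with kind-cases C unb
          ... | inj₁ k = by-full (R-mono ▸ˡ (same (chord-ends e∉))) (inj₁ (C , C⊆ , k))
          ... | inj₂ k with opposite (part (src f))
          ... | L , kL , off = ⊥-elim (lf-disjoint L C kL k λ x∈ x∈′ → off x∈ (sym (near x∈′)))

      fromIII : OutcomeIII G cls → ¬ Unbreakable
      -- X may be larger than a minimal balancing set; extending its complement to a maximal
      -- balanced set gives a flat.
      fromIII (p , X , b , X⊆ , c₀ , c₁) with maxBalanced ⊤ (λ _ → ∈⊤) (balancing⇒Balanced b)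
      ... | A , X⊆A , mb = TwoCells.one-sided p (proj₁ b) (λ e∈ → uncut⁺ (λ v → part v ≟ᶠ 0F) (inj₁ (X₀ e∈))) conn X⊆A mb (proj₁ ∘ X₀)
        where
        open Partition p
        X₀ : ∀ {e} → e ∈ X → part (src e) ≡ 0F × part (tgt e) ≡ 0F
        X₀ e∈ with s , t ← ∈-inducedE⁻ (X⊆ e∈) = ∈-cell⁻ p s , ∈-cell⁻ p t
        conn : ∀ i → ConnectedOn G (cell i) (∁ X)
        conn 0F = c₀
        conn 1F = proj₁ c₁ , λ u v u∈ v∈ → avoid (proj₂ c₁ u v u∈ v∈)
          where
          avoid : ∀ {u v} → Reach G (cell 1F) ⊤ u v → Reach G (cell 1F) (∁ X) u v
          avoid here = here
          avoid (step {e = e} r _ j x∈) = step (avoid r) (x∉p⇒x∈∁p λ e∈ → off e∈) j x∈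
            where
            off : e ∈ X → ⊥
            off e∈ with joins-unique (joins-ends e) j
            ... | inj₁ (refl , refl) = contradiction (trans (sym (proj₂ (X₀ e∈))) (∈-cell⁻ p x∈)) λ ()
            ... | inj₂ (refl , refl) = contradiction (trans (sym (proj₁ (X₀ e∈))) (∈-cell⁻ p x∈)) λ ()

      fromIV : OutcomeIV G cls → ¬ Unbreakable
      fromIV (p , X , b , X⊆ , c₀ , c₁ , (L₀ , L₀⊆ , k₀) , (L₁ , L₁⊆ , k₁)) with maxBalanced ⊤ (λ _ → ∈⊤) (balancing⇒Balanced b)
      ... | A , X⊆A , mb = TwoCells.lifted p (proj₁ b) X⊆H (λ { 0F → c₀ ; 1F → c₁ }) X⊆A mb opposite
        where
        open Partition p
        X⊆H : X ⊆ uncut (λ v → part v ≟ᶠ 0F)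
        X⊆H e∈ with x∈p∪q⁻ (inducedE G (cell 0F)) (inducedE G (cell 1F)) (X⊆ e∈)
        ... | inj₁ z with s , t ← ∈-inducedE⁻ z = uncut⁺ (λ v → part v ≟ᶠ 0F) (inj₁ (∈-cell⁻ p s , ∈-cell⁻ p t))
        ... | inj₂ z with s , t ← ∈-inducedE⁻ z = uncut⁺ (λ v → part v ≟ᶠ 0F) (inj₂
            ((differ (∈-cell⁻ p s) λ ()) , (differ (∈-cell⁻ p t) λ ())))
        opposite : ∀ i → ∃[ L ] (cls (E L) ≡ lft × (∀ {x} → x ∈ V L → part x ≢ i))
        opposite 0F = L₁ , k₁ , λ x∈ eq → contradiction (trans (sym (∈-cell⁻ p (L₁⊆ x∈))) eq) λ ()
        opposite 1F = L₀ , k₀ , λ x∈ eq → contradiction (trans (sym (∈-cell⁻ p (L₀⊆ x∈))) eq) λ ()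

      R-map : ∀ {X Y} → (∀ {e} → e ∈ X → R Y (src e) (tgt e)) → ∀ {u v} → R X u v → R Y u v
      R-map h rfl = rfl
      R-map h (cns {e} e∈ j r) with joins-unique (joins-ends e) j
      ... | inj₁ (refl , refl) = R-trans (h e∈) (R-map h r)
      ... | inj₂ (refl , refl) = R-trans (R-sym (h e∈)) (R-map h r)

      module FrameCell (p : Partition n 3) (A : Subset m) (bA : Balanced A)
        (D₀ : Cycle G) (k₀ : cls (E D₀) ≡ frm) (D₀⊆ : V D₀ ⊆ Partition.cell p 2F) where
        open Partition p
        open Coloured part

        in₂ : ∀ {x} → x ∈ V D₀ → part x ≡ 2F
        in₂ x∈ = ∈-cell⁻ p (D₀⊆ x∈)

        module _ {F : Subset m} (mono : Monochrome F) (same : ∀ {u v} → part u ≡ part v → R F u v)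
          (D₀⊆F : E D₀ ⊆ F) {i : Fin 3} (i≢2 : i ≢ 2F) (F-A : ∀ {f} → f ∈ F → part (src f) ≡ i → f ∈ A) where

          Bal-cell : ∀ {e} → part (src e) ≡ i → Bal F e → Bal A e
          Bal-cell {e} ps (C , e∈ , C⊆ , k) = C , e∈ , (λ f∈ → move f∈ (▸⁻ (C⊆ f∈))) , k
            where
            move : ∀ {f} → f ∈ E C → f ∈ F ⊎ f ≡ e → f ∈ A ▸ e
            move f∈ (inj₁ f∈F) = ▸ˡ (F-A f∈F (trans (sym (R-mono-part mono (cycle-R C e∈ C⊆ (src∈V C e∈) (src∈V C f∈)))) ps))
            move f∈ (inj₂ refl) = ▸ʳ

          chord-activating : ∀ {e} → part (src e) ≡ i → part (tgt e) ≡ i → e ∉ A → ¬ Bal A e → Activating same i 2F e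
          chord-activating ps pt e∉ ¬b = inj₂ (ps , pt , (λ e∈ → e∉ (F-A e∈ ps)) , ¬b ∘ Bal-cell ps)

          frame-parallel : ∀ {e f} → Activating same i 2F e → Activating same i 2F f → Dep (F ▸ f) e
          frame-parallel = activating-parallel same mono i≢2 D₀ D₀⊆F k₀ in₂

      off-frame? : (p : Partition n 3) → let open Partition p in ∀ e → Dec (part (src e) ≡ part (tgt e) × part (src e) ≢ 2F)
      off-frame? p e = part (src e) ≟ᶠ part (tgt e) ×-dec ¬? (part (src e) ≟ᶠ 2F)
        where open Partition p

      private
        -- `K i` omits exactly the edges from cell i to the frame cell and the chords of cell i
        -- outside A; each of these activates cell i. The intersection keeps a maximal balanced set
        -- in cells 0 and 1 and the whole frame cell.
        V-breakable : ∀ p {A} → let open Partition p in MaxBalanced (comprehension (off-frame? p)) A → (∀ i → InducedConnected G (cell i)) →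
          NoEdgesBetween G (cell 0F) (cell 1F) → (D₀ : Cycle G) → V D₀ ⊆ cell 2F → cls (E D₀) ≡ frm → ¬ Unbreakable
        V-breakable p {A} mb conn none D₀ D₀⊆ k₀ = breakable (K 1F) (K 0F) (flat (λ ())) (flat (λ ())) cover
            (missing {1F} (λ ())) (missing {0F} (λ ()))
            (λ e∉ f∉ → frame-parallel mono same D₀⊆F (λ ()) (F-A 1F (proj₁ ∘ x∈p∩q⁻ (K 1F) (K 0F))) (act₁ e∉) (act₁ f∉))
            (λ e∉ f∉ → frame-parallel mono same D₀⊆F (λ ()) (F-A 0F (proj₂ ∘ x∈p∩q⁻ (K 1F) (K 0F))) (act₀ e∉) (act₀ f∉))
          where
          open Partition p
          open Coloured part
          Z? = off-frame? p
          Z = comprehension Z?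
          open FrameCell p A (MaxBalanced.balanced mb) D₀ k₀ D₀⊆
          W? : ∀ i v → Dec (part v ≡ i)
          W? i v = part v ≟ᶠ i
          K : Fin 3 → Subset m
          K i = Semi.semi (W? i) A
          F = K 1F ∩ K 0F
          A⊆K : ∀ i {e} → e ∈ A → e ∈ K i
          A⊆K i {e} e∈ with ∈-comprehension⁻ Z? (MaxBalanced.A⊆X mb e∈) | part (src e) ≟ᶠ i
          ... | eq , _ | yes ps = Semi.semi⁺ (W? i) A (inj₁ (ps , trans (sym eq) ps , e∈))
          ... | eq , _ | no ¬ps = Semi.semi⁺ (W? i) A (inj₂ (¬ps , λ pt → ¬ps (trans eq pt)))
          two⊆K : ∀ {i e} → i ≢ 2F → part (src e) ≡ 2F → part (tgt e) ≡ 2F → e ∈ K i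
          two⊆K {i} i≢2 ps pt = Semi.semi⁺ (W? i) A (inj₂ ((λ eq → i≢2 (trans (sym eq) ps)) , (λ eq → i≢2 (trans (sym eq) pt))))
          F-A : ∀ i → F ⊆ K i → ∀ {f} → f ∈ F → part (src f) ≡ i → f ∈ A
          F-A i sub f∈ ps = Semi.semi-A (W? i) A (sub f∈) ps
          D₀⊆F : E D₀ ⊆ F
          D₀⊆F f∈ with s , t ← inside-cell p D₀ D₀⊆ f∈ = x∈p∩q⁺ (two⊆K (λ ()) s t , two⊆K (λ ()) s t)
          respect : ∀ i {e} → e ∈ K i → (part (src e) ≡ i → part (tgt e) ≡ i) × (part (tgt e) ≡ i → part (src e) ≡ i)
          respect i = Respects.at-ends (Semi.semi-respects (W? i) A)
          mono : Monochrome F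
          mono {e} e∈ with x∈p∩q⁻ (K 1F) (K 0F) e∈
          ... | e₁ , e₀ with part (src e) ≟ᶠ 0F | part (src e) ≟ᶠ 1F
          ... | yes s | _ = trans s (sym (proj₁ (respect 0F e₀) s))
          ... | no _ | yes s = trans s (sym (proj₁ (respect 1F e₁) s))
          ... | no s₀ | no s₁ = trans (third s₀ s₁) (sym (third (s₀ ∘ proj₂ (respect 0F e₀)) (s₁ ∘ proj₂ (respect 1F e₁))))
          mono? : ∀ e → Dec (part (src e) ≡ part (tgt e))
          mono? e = part (src e) ≟ᶠ part (tgt e)
          same : ∀ {u v} → part u ≡ part v → R F u v
          same eq = R-map linked (cells-connected p {comprehension mono?} (λ _ → ⊤) conn
              (λ _ s t → ∈-comprehension⁺ mono? (trans s (sym t))) eq)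
            where
            linked : ∀ {e} → e ∈ comprehension mono? → R F (src e) (tgt e)
            linked {e} e∈ with part (src e) ≟ᶠ 2F
            ... | yes s = R-edge (x∈p∩q⁺ (two⊆K (λ ()) s (trans (sym (∈-comprehension⁻ mono? e∈)) s) , two⊆K (λ ()) s (trans (sym (∈-comprehension⁻ mono? e∈)) s)))
            ... | no s = R-mono (λ a → x∈p∩q⁺ (A⊆K 1F a , A⊆K 0F a)) (MaxBalanced.spans-edge mb (∈-comprehension⁺ Z? (∈-comprehension⁻ mono? e∈ , s)))
          Z∋ : ∀ {i e} → i ≢ 2F → part (src e) ≡ i → part (tgt e) ≡ i → e ∈ Z
          Z∋ i≢2 s t = ∈-comprehension⁺ Z? (trans s (sym t) , λ eq → i≢2 (trans (sym s) eq))
          flat : ∀ {i} → i ≢ 2F → ∀ {e} → Dep (K i) e → e ∈ K i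
          flat {i} i≢2 = Semi.semi-flat (W? i) A (MaxBalanced.balanced mb)
            (λ s t e∉ → MaxBalanced.¬Bal mb (Z∋ i≢2 s t) e∉ , R-mono (A⊆K i) (MaxBalanced.spans-edge mb (Z∋ i≢2 s t)))
            D₀ k₀ (λ x∈ eq → i≢2 (trans (sym eq) (in₂ x∈)))
          missing : ∀ {i} → i ≢ 2F → ∃[ e ] e ∉ K i
          missing {i} i≢2 with cut-exists p i≢2
          ... | e , u , v , j , pu , ¬pv = e , λ e∈ → ¬pv (R-respects (Semi.semi-respects (W? i) A) (R-joins e∈ j) pu)
          act₁ : ∀ {e} → e ∉ K 1F → Activating same 1F 2F e
          act₁ e∉ with Semi.semi∉ (W? 1F) A e∉
          ... | inj₁ (s , t , e∉A) = chord-activating mono same D₀⊆F (λ ()) (F-A 1F (proj₁ ∘ x∈p∩q⁻ (K 1F) (K 0F))) s t e∉A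
                  (MaxBalanced.¬Bal mb (Z∋ (λ ()) s t) e∉A)
          ... | inj₂ (u , v , j , pu , ¬pv) = inj₁ (u , v , j , pu , third (λ pv → no-edge p none (flipJ j) pv pu) ¬pv)
          act₀ : ∀ {e} → e ∉ K 0F → Activating same 0F 2F e
          act₀ e∉ with Semi.semi∉ (W? 0F) A e∉
          ... | inj₁ (s , t , e∉A) = chord-activating mono same D₀⊆F (λ ()) (F-A 0F (proj₂ ∘ x∈p∩q⁻ (K 1F) (K 0F))) s t e∉A
                  (MaxBalanced.¬Bal mb (Z∋ (λ ()) s t) e∉A)
          ... | inj₂ (u , v , j , pu , ¬pv) = inj₁ (u , v , j , pu , third ¬pv (λ pv → no-edge p none j pu pv))
          touch : ∀ {i e} → Activating same i 2F e → ¬ (part (src e) ≢ i × part (tgt e) ≢ i)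
          touch (inj₂ (s , _)) (¬s , _) = ¬s s
          touch {e = e} (inj₁ (u , v , j , pu , _)) (¬s , ¬t) with joins-unique (joins-ends e) j
          ... | inj₁ (refl , refl) = ¬s pu
          ... | inj₂ (refl , refl) = ¬t pu
          touch′ : ∀ {e} → Activating same 1F 2F e → part (src e) ≢ 0F × part (tgt e) ≢ 0F
          touch′ (inj₂ (s , t , _)) = (differ s λ ()) , (differ t λ ())
          touch′ {e} (inj₁ (u , v , j , pu , pv)) with joins-unique (joins-ends e) j
          ... | inj₁ (refl , refl) = (differ pu λ ()) , (differ pv λ ())
          ... | inj₂ (refl , refl) = (differ pv λ ()) , (differ pu λ ())
          cover : ∀ {e} → e ∈ K 1F ⊎ e ∈ K 0F
          cover {e} with e ∈? K 1F | e ∈? K 0F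
          ... | yes a | _ = inj₁ a
          ... | no _ | yes b = inj₂ b
          ... | no a | no b = contradiction (touch′ (act₁ a)) (touch (act₀ b))

      fromV : OutcomeV G cls → ¬ Unbreakable
      fromV (p , c₀ , c₁ , c₂ , none , D₀ , D₀⊆ , k₀) with maxBalanced (comprehension (off-frame? p)) (λ x∈ → contradiction x∈ ∉⊥) ∅-balanced
      ... | A , _ , mb = V-breakable p mb (λ { 0F → c₀ ; 1F → c₁ ; 2F → c₂ }) none D₀ D₀⊆ k₀

      private
        -- Cell 1 is adjacent to cell 0 only, and X avoids it, so A contains all its edges. `H₁`
        -- omits the edges between these cells; `H₂` omits what activates cell 0, namely its edges
        -- to the frame cell and its chords outside A.
        III'-breakable : (p : Partition n 3) {X A : Subset m} → let open Partition p in ∁ X ⊆ A → MaxBalanced ⊤ A → X ⊆ inducedE G (cell 0F ∪ cell 2F) →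
          InducedMinusConnected G (cell 0F) X → InducedConnected G (cell 1F) → InducedMinusConnected G (cell 2F) X →
          (D₀ : Cycle G) → V D₀ ⊆ cell 2F → cls (E D₀) ≡ frm → NoEdgesBetween G (cell 1F) (cell 2F) → ¬ Unbreakable
        III'-breakable p {X} {A} X⊆A mb X⊆ c₀ c₁ c₂ D₀ D₀⊆ k₀ none = breakable H₁ H₂ flat₁ flat₂ cover missing₁ missing₂
            cross-par (λ e∉ f∉ → frame-parallel mono same D₀⊆F (λ ()) F-A (act e∉) (act f∉))
          where
          open Partition p
          open Coloured part
          open FrameCell p A (MaxBalanced.balanced mb) D₀ k₀ D₀⊆
          W₁? : ∀ v → Dec (part v ≡ 1F)
          W₁? v = part v ≟ᶠ 1F
          W₂? : ∀ v → Dec (part v ≢ 2F)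
          W₂? v = ¬? (part v ≟ᶠ 2F)
          H₁ = Semi.semi W₁? A
          H₂ = Semi.semi W₂? A
          F = H₁ ∩ H₂
          X≢1 : ∀ {e} → e ∈ X → part (src e) ≢ 1F × part (tgt e) ≢ 1F
          X≢1 e∈ with ∈-inducedE⁻ (X⊆ e∈)
          ... | s , t = off s , off t
            where
            off : ∀ {v} → v ∈ cell 0F ∪ cell 2F → part v ≢ 1F
            off v∈ eq with x∈p∪q⁻ (cell 0F) (cell 2F) v∈
            ... | inj₁ z = contradiction (trans (sym (∈-cell⁻ p z)) eq) λ ()
            ... | inj₂ z = contradiction (trans (sym (∈-cell⁻ p z)) eq) λ ()
          A∌ : ∀ {e} → e ∉ A → part (src e) ≢ 1F × part (tgt e) ≢ 1F
          A∌ {e} e∉ with e ∈? X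
          ... | yes e∈ = X≢1 e∈
          ... | no e∉X = contradiction (X⊆A (x∉p⇒x∈∁p e∉X)) e∉
          A∋ : ∀ {e} → part (src e) ≡ 1F ⊎ part (tgt e) ≡ 1F → e ∈ A
          A∋ {e} h with e ∈? A
          ... | yes e∈ = e∈
          ... | no e∉ = contradiction h λ { (inj₁ s) → proj₁ (A∌ e∉) s ; (inj₂ t) → proj₂ (A∌ e∉) t }
          inF : ∀ {i e} → part (src e) ≡ i → part (tgt e) ≡ i → i ≡ 2F ⊎ e ∈ A → e ∈ F
          inF {0F} s t (inj₂ a) = x∈p∩q⁺ (Semi.semi⁺ W₁? A (inj₂ ((differ s λ ()) , (differ t λ ())))
            , Semi.semi⁺ W₂? A (inj₁ ((differ s λ ()) , (differ t λ ()) , a)))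
          inF {1F} s t (inj₂ a) = x∈p∩q⁺ (Semi.semi⁺ W₁? A (inj₁ (s , t , a))
            , Semi.semi⁺ W₂? A (inj₁ ((differ s λ ()) , (differ t λ ()) , a)))
          inF {2F} s t _ = x∈p∩q⁺ (Semi.semi⁺ W₁? A (inj₂ ((differ s λ ()) , (differ t λ ())))
            , Semi.semi⁺ W₂? A (inj₂ ((λ ¬s → ¬s s) , (λ ¬t → ¬t t))))
          D₀⊆F : E D₀ ⊆ F
          D₀⊆F f∈ with s , t ← inside-cell p D₀ D₀⊆ f∈ = inF s t (inj₁ refl)
          respect₁ : ∀ {e} → e ∈ H₁ → (part (src e) ≡ 1F → part (tgt e) ≡ 1F) × (part (tgt e) ≡ 1F → part (src e) ≡ 1F)
          respect₁ = Respects.at-ends (Semi.semi-respects W₁? A)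
          respect₂ : ∀ {e} → e ∈ H₂ → (part (src e) ≢ 2F → part (tgt e) ≢ 2F) × (part (tgt e) ≢ 2F → part (src e) ≢ 2F)
          respect₂ = Respects.at-ends (Semi.semi-respects W₂? A)
          zeroth : ∀ {i : Fin 3} → i ≢ 1F → i ≢ 2F → i ≡ 0F
          zeroth {0F} _ _ = refl
          zeroth {1F} a _ = contradiction refl a
          zeroth {2F} _ a = contradiction refl a
          not-not-2 : ∀ {v} → ¬ part v ≢ 2F → part v ≡ 2F
          not-not-2 {v} ¬¬ with part v ≟ᶠ 2F
          ... | yes eq = eq
          ... | no ne = contradiction ne ¬¬
          mono : Monochrome F
          mono {e} e∈ with x∈p∩q⁻ H₁ H₂ e∈
          ... | e₁ , e₂ with part (src e) ≟ᶠ 1F | part (src e) ≟ᶠ 2F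
          ... | yes s | _ = trans s (sym (proj₁ (respect₁ e₁) s))
          ... | no _ | yes s = trans s (sym (not-not-2 λ t → proj₂ (respect₂ e₂) t s))
          ... | no s₁ | no s₂ = trans (zeroth s₁ s₂) (sym (zeroth (s₁ ∘ proj₂ (respect₁ e₁)) (proj₁ (respect₂ e₂) s₂)))
          via : Fin 3 → Subset m
          via 0F = ∁ X
          via 1F = ⊤
          via 2F = ∁ X
          conn : ∀ i → ConnectedOn G (cell i) (via i)
          conn 0F = c₀
          conn 1F = c₁
          conn 2F = c₂
          same : ∀ {u v} → part u ≡ part v → R F u v
          same = cells-connected p via conn place
            where
            place : ∀ {i e} → e ∈ via i → part (src e) ≡ i → part (tgt e) ≡ i → e ∈ F
            place {0F} e∈ s t = inF s t (inj₂ (X⊆A e∈))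
            place {1F} e∈ s t = inF s t (inj₂ (A∋ (inj₁ s)))
            place {2F} e∈ s t = inF s t (inj₁ refl)
          F-A : ∀ {f} → f ∈ F → part (src f) ≡ 0F → f ∈ A
          F-A f∈ s = Semi.semi-A W₂? A (proj₂ (x∈p∩q⁻ H₁ H₂ f∈)) (differ s λ ())
          flat₁ : ∀ {e} → Dep H₁ e → e ∈ H₁
          flat₁ = Semi.semi-flat W₁? A (MaxBalanced.balanced mb) (λ s _ e∉ → contradiction (A∋ (inj₁ s)) e∉)
            D₀ k₀ (λ x∈ eq → contradiction (trans (sym (in₂ x∈)) eq) λ ())
          flat₂ : ∀ {e} → Dep H₂ e → e ∈ H₂
          flat₂ = Semi.semi-flat W₂? A (MaxBalanced.balanced mb)
            (λ s t e∉ → MaxBalanced.¬Bal mb ∈⊤ e∉ , R-mono (proj₂ ∘ x∈p∩q⁻ H₁ H₂)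
              (same (trans (zeroth (proj₁ (A∌ e∉)) s) (sym (zeroth (proj₂ (A∌ e∉)) t)))))
            D₀ k₀ (λ x∈ ¬2 → ¬2 (in₂ x∈))
          cross : ∀ {e} → e ∉ H₁ → Between 1F 0F e
          cross e∉ with Semi.semi∉ W₁? A e∉
          ... | inj₁ (s , _ , e∉A) = contradiction (A∋ (inj₁ s)) e∉A
          ... | inj₂ (u , v , j , pu , ¬pv) = u , v , j , pu , zeroth ¬pv (λ pv → no-edge p none j pu pv)
          ends : ∀ {e} → Between 1F 0F e → e ∈ A × part (src e) ≢ 2F × part (tgt e) ≢ 2F
          ends {e} (u , v , j , pu , pv) with joins-unique (joins-ends e) j
          ... | inj₁ (refl , refl) = A∋ (inj₁ pu) , (differ pu λ ()) , (differ pv λ ())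
          ... | inj₂ (refl , refl) = A∋ (inj₂ pu) , (differ pv λ ()) , (differ pu λ ())
          cross∈H₂ : ∀ {e} → e ∉ H₁ → e ∈ H₂
          cross∈H₂ e∉ with a , s , t ← ends (cross e∉) = Semi.semi⁺ W₂? A (inj₁ (s , t , a))
          cover : ∀ {e} → e ∈ H₁ ⊎ e ∈ H₂
          cover {e} with e ∈? H₁
          ... | yes e∈ = inj₁ e∈
          ... | no e∉ = inj₂ (cross∈H₂ e∉)
          missing₁ : ∃[ e ] e ∉ H₁
          missing₁ with cut-exists p {1F} {0F} (λ ())
          ... | e , u , v , j , pu , ¬pv = e , λ e∈ → ¬pv (R-respects (Semi.semi-respects W₁? A) (R-joins e∈ j) pu)
          missing₂ : ∃[ e ] e ∉ H₂
          missing₂ with cut-exists p {2F} {0F} (λ ())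
          ... | e , u , v , j , pu , ¬pv = e , λ e∈ → R-respects (Semi.semi-respects W₂? A) (R-joins e∈ (flipJ j)) ¬pv pu
          cross-par : ∀ {e f} → e ∉ H₁ → f ∉ H₁ → Dep (F ▸ f) e
          -- The cycle cannot reach cell 2, as e and f run between cells 1 and 0; off cell 2 all of
          -- `H₂` lies in A, so the cycle is balanced.
          cross-par {e} {f} e∉ f∉ = chord-Bal (between-R same (cross e∉) (cross f∉)) λ C C⊆ near →
            MaxBalanced.balanced mb C λ g∈ → ▸-least {X = H₂ ∩ A} (proj₂ ∘ x∈p∩q⁻ H₂ A) (proj₁ (ends (cross e∉))) (move (near (src∈V C g∈)) (▸⁻ (C⊆ g∈)))
            where
            resp : ∀ {x y} → R (F ▸ f) x y → R H₂ x y
            resp = R-mono (▸-least (proj₂ ∘ x∈p∩q⁻ H₁ H₂) (cross∈H₂ f∉))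
            move : ∀ {g} → R (F ▸ f) (src e) (src g) → g ∈ F ▸ f ⊎ g ≡ e → g ∈ (H₂ ∩ A) ▸ e
            move r (inj₂ refl) = ▸ʳ
            move r (inj₁ g∈) = ▸ˡ (x∈p∩q⁺ (g∈H₂ , Semi.semi-A W₂? A g∈H₂ (R-respects (Semi.semi-respects W₂? A) (resp r) (proj₁ (proj₂ (ends (cross e∉)))))))
              where g∈H₂ = ▸-least (proj₂ ∘ x∈p∩q⁻ H₁ H₂) (cross∈H₂ f∉) g∈
          act : ∀ {e} → e ∉ H₂ → Activating same 0F 2F e
          act e∉ with Semi.semi∉ W₂? A e∉
          ... | inj₁ (s , t , e∉A) = chord-activating mono same D₀⊆F (λ ()) F-A (zeroth (proj₁ (A∌ e∉A)) s) (zeroth (proj₂ (A∌ e∉A)) t) e∉A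
                  (MaxBalanced.¬Bal mb ∈⊤ e∉A)
          ... | inj₂ (u , v , j , ¬pu , ¬¬pv) = inj₁ (u , v , j , zeroth (λ pu → no-edge p none j pu (not-not-2 ¬¬pv)) ¬pu , not-not-2 ¬¬pv)

      fromIII' : OutcomeIII' G cls → ¬ Unbreakable
      fromIII' (p , X , b , X⊆ , c₀ , c₁ , c₂ , (D₀ , D₀⊆ , k₀) , none) with maxBalanced ⊤ (λ _ → ∈⊤) (balancing⇒Balanced b)
      ... | A , X⊆A , mb = III'-breakable p X⊆A mb X⊆ c₀ c₁ c₂ D₀ D₀⊆ k₀ none

      -- Parallel classes modulo a flat

      module _ {F : Subset m} where

        parallel-sym : ∀ {g h} → (∀ {x} → Dep F x → x ∈ F) → h ∉ F → Dep (F ▸ g) h → Dep (F ▸ h) g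
        parallel-sym flat h∉ d = Dep-exchange d (h∉ ∘ flat)

        parallel-trans : ∀ {g h k} → Dep (F ▸ g) h → Dep (F ▸ h) k → Dep (F ▸ g) k
        parallel-trans d d′ = Dep-trans d (Dep-mono (▸-mono ▸ˡ) d′)

        swap : ∀ {e f} → TwoClasses F e f → TwoClasses F f e
        swap tc = record { flat = flat ; e∉F = f∉F ; f∉F = e∉F ; e∦f = f∦e ; f∦e = e∦f ; two = λ g∉ → Sum.swap (two g∉) }
          where open TwoClasses tc

        -- Non-parallel elements lie in different classes, so they can serve as representatives.
        -- This gives access to edges in a convenient position.
        rebase : ∀ {e f e′ f′} → TwoClasses F e f → e′ ∉ F → f′ ∉ F → ¬ Dep (F ▸ f′) e′ → TwoClasses F e′ f′
        rebase {e} {f} {e′} {f′} tc e′∉ f′∉ ¬d = record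
          { flat = flat ; e∉F = e′∉ ; f∉F = f′∉ ; e∦f = ¬d ; f∦e = ¬d ∘ parallel-sym flat f′∉ ; two = λ g∉ → choose (two e′∉) (two f′∉) (two g∉) }
          where
          open TwoClasses tc
          back : ∀ {g h x} → x ∉ F → Dep (F ▸ g) x → Dep (F ▸ h) x → Dep (F ▸ g) h
          back x∉ d d′ = parallel-trans d (parallel-sym flat x∉ d′)
          choose : ∀ {g} → Dep (F ▸ e′) e ⊎ Dep (F ▸ e′) f → Dep (F ▸ f′) e ⊎ Dep (F ▸ f′) f → Dep (F ▸ g) e ⊎ Dep (F ▸ g) f →
            Dep (F ▸ g) e′ ⊎ Dep (F ▸ g) f′
          choose (inj₁ a) (inj₁ b) _ = contradiction (back e∉F b a) ¬d
          choose (inj₂ a) (inj₂ b) _ = contradiction (back f∉F b a) ¬d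
          choose (inj₁ a) (inj₂ b) (inj₁ c) = inj₁ (back e∉F c a)
          choose (inj₁ a) (inj₂ b) (inj₂ c) = inj₂ (back f∉F c b)
          choose (inj₂ a) (inj₁ b) (inj₁ c) = inj₂ (back e∉F c b)
          choose (inj₂ a) (inj₁ b) (inj₂ c) = inj₁ (back f∉F c a)

        -- If only the addition of g joins the ends of h, the connecting walk crosses g, so h links
        -- the same two components as g.
        ends-match : ∀ {g h x y} → Joins G g x y → ¬ R F (src h) (tgt h) → R (F ▸ g) (src h) (tgt h) →
          ∃[ x′ ] ∃[ y′ ] (Joins G h x′ y′ × R F x x′ × R F y y′)
        ends-match {g} {h} j ¬r r with R-▸ r | joins-unique (joins-ends g) j
        ... | inj₁ r′ | _ = contradiction r′ ¬r
        ... | inj₂ (inj₁ (a , b)) | inj₁ (refl , refl) = _ , _ , joins-ends h , R-sym a , b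
        ... | inj₂ (inj₁ (a , b)) | inj₂ (refl , refl) = _ , _ , flipJ (joins-ends h) , b , R-sym a
        ... | inj₂ (inj₂ (a , b)) | inj₁ (refl , refl) = _ , _ , flipJ (joins-ends h) , b , R-sym a
        ... | inj₂ (inj₂ (a , b)) | inj₂ (refl , refl) = _ , _ , joins-ends h , R-sym a , b

        joins-R : ∀ {e x y} → Joins G e x y → R F (src e) (tgt e) → R F x y
        joins-R {e} j r with joins-unique (joins-ends e) j
        ... | inj₁ (refl , refl) = r
        ... | inj₂ (refl , refl) = R-sym r

      -- Flats with at least three components

      module Parts (F : Subset m) (a b : Fin n) where

        part₃ : Fin n → Fin 3
        part₃ v with R? F a v | R? F b v
        ... | yes _ | _ = 0F
        ... | no _ | yes _ = 1F
        ... | no _ | no _ = 2F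

        part₃-view : ∀ v → (R F a v × part₃ v ≡ 0F) ⊎ (¬ R F a v × R F b v × part₃ v ≡ 1F) ⊎ (¬ R F a v × ¬ R F b v × part₃ v ≡ 2F)
        part₃-view v with R? F a v | R? F b v
        ... | yes r | _ = inj₁ (r , refl)
        ... | no ¬r | yes r = inj₂ (inj₁ (¬r , r , refl))
        ... | no ¬r | no ¬r′ = inj₂ (inj₂ (¬r , ¬r′ , refl))

        in-0 : ∀ {v} → R F a v → part₃ v ≡ 0F
        in-0 {v} r with part₃-view v
        ... | inj₁ (_ , eq) = eq
        ... | inj₂ (inj₁ (¬r , _)) = contradiction r ¬r
        ... | inj₂ (inj₂ (¬r , _)) = contradiction r ¬r

        in-1 : ∀ {v} → ¬ R F a b → R F b v → part₃ v ≡ 1F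
        in-1 {v} ¬ab r with part₃-view v
        ... | inj₁ (r′ , _) = contradiction (R-trans r′ (R-sym r)) ¬ab
        ... | inj₂ (inj₁ (_ , _ , eq)) = eq
        ... | inj₂ (inj₂ (_ , ¬r , _)) = contradiction r ¬r

        in-2 : ∀ {v} → ¬ R F a v → ¬ R F b v → part₃ v ≡ 2F
        in-2 {v} ¬r ¬r′ with part₃-view v
        ... | inj₁ (r , _) = contradiction r ¬r
        ... | inj₂ (inj₁ (_ , r , _)) = contradiction r ¬r′
        ... | inj₂ (inj₂ (_ , _ , eq)) = eq

        out-0 : ∀ {v} → part₃ v ≡ 0F → R F a v
        out-0 {v} eq with part₃-view v
        ... | inj₁ (r , _) = r
        ... | inj₂ (inj₁ (_ , _ , eq′)) = contradiction (trans (sym eq) eq′) λ ()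
        ... | inj₂ (inj₂ (_ , _ , eq′)) = contradiction (trans (sym eq) eq′) λ ()

        out-1 : ∀ {v} → part₃ v ≡ 1F → R F b v
        out-1 {v} eq with part₃-view v
        ... | inj₁ (_ , eq′) = contradiction (trans (sym eq) eq′) λ ()
        ... | inj₂ (inj₁ (_ , r , _)) = r
        ... | inj₂ (inj₂ (_ , _ , eq′)) = contradiction (trans (sym eq) eq′) λ ()

        out-2 : ∀ {v} → part₃ v ≡ 2F → ¬ R F a v × ¬ R F b v
        out-2 {v} eq with part₃-view v
        ... | inj₁ (_ , eq′) = contradiction (trans (sym eq) eq′) λ ()
        ... | inj₂ (inj₁ (_ , _ , eq′)) = contradiction (trans (sym eq) eq′) λ ()
        ... | inj₂ (inj₂ (¬r , ¬r′ , _)) = ¬r , ¬r′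

        module _ (¬ab : ¬ R F a b) {c : Fin n} (¬ac : ¬ R F a c) (¬bc : ¬ R F b c) where

          partition₃ : Partition n 3
          partition₃ = record { part = part₃ ; nonempty = λ { 0F → a , in-0 rfl ; 1F → b , in-1 ¬ab rfl ; 2F → c , in-2 ¬ac ¬bc } }

          open Partition partition₃ using (cell)

          connected-0 : ∀ {A} → F ⊆ A → ConnectedOn G (cell 0F) A
          connected-0 sub = R⇒connectedOn sub (∈-cell⁺ partition₃ (in-0 rfl))
            (λ u∈ r → ∈-cell⁺ partition₃ (in-0 (R-trans (out-0 (∈-cell⁻ partition₃ u∈)) r)))
            (λ u∈ v∈ → R-trans (R-sym (out-0 (∈-cell⁻ partition₃ u∈))) (out-0 (∈-cell⁻ partition₃ v∈)))

          connected-1 : ∀ {A} → F ⊆ A → ConnectedOn G (cell 1F) A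
          connected-1 sub = R⇒connectedOn sub (∈-cell⁺ partition₃ (in-1 ¬ab rfl))
            (λ u∈ r → ∈-cell⁺ partition₃ (in-1 ¬ab (R-trans (out-1 (∈-cell⁻ partition₃ u∈)) r)))
            (λ u∈ v∈ → R-trans (R-sym (out-1 (∈-cell⁻ partition₃ u∈))) (out-1 (∈-cell⁻ partition₃ v∈)))

          connected-2 : ∀ {A} → F ⊆ A → (∀ {v} → R F a v ⊎ R F b v ⊎ R F c v) → ConnectedOn G (cell 2F) A
          connected-2 sub all = R⇒connectedOn sub (∈-cell⁺ partition₃ (in-2 ¬ac ¬bc))
            (λ u∈ r → let ¬au , ¬bu = out-2 (∈-cell⁻ partition₃ u∈) in
              ∈-cell⁺ partition₃ (in-2 (λ r′ → ¬au (R-trans r′ (R-sym r))) (λ r′ → ¬bu (R-trans r′ (R-sym r)))))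
            (λ u∈ v∈ → R-trans (R-sym (in-c u∈)) (in-c v∈))
            where
            in-c : ∀ {u} → u ∈ cell 2F → R F c u
            in-c {u} u∈ with out-2 (∈-cell⁻ partition₃ u∈) | all {u}
            ... | ¬au , ¬bu | inj₁ r = contradiction r ¬au
            ... | ¬au , ¬bu | inj₂ (inj₁ r) = contradiction r ¬bu
            ... | ¬au , ¬bu | inj₂ (inj₂ r) = r

          no-edges-01 : (∀ {e x y} → Joins G e x y → R F a x → R F b y → ⊥) → NoEdgesBetween G (cell 0F) (cell 1F)
          no-edges-01 h (e , e∈) with ∈-crossE⁻ e∈
          ... | inj₁ (s , t) = h (joins-ends e) (out-0 (∈-cell⁻ partition₃ s)) (out-1 (∈-cell⁻ partition₃ t))
          ... | inj₂ (s , t) = h (flipJ (joins-ends e)) (out-0 (∈-cell⁻ partition₃ t)) (out-1 (∈-cell⁻ partition₃ s))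

      -- The hypothesis `par-R` isolates what is proved differently for flats with a lift cycle and
      -- for balanced flats.
      module ThreeComponents {F : Subset m} {e f : Fin m} (tc : TwoClasses F e f) (bridge : ¬ R F (src e) (tgt e))
        {t : Fin n} (¬at : ¬ R F (src e) t) (¬bt : ¬ R F (tgt e) t)
        (par-R : ∀ {k h} → k ∉ F → h ∉ F → ¬ R F (src h) (tgt h) → Dep (F ▸ k) h → R (F ▸ k) (src h) (tgt h)) where
        open TwoClasses tc

        private
          inside? : ∀ v → Dec (R F (src e) v ⊎ R F (tgt e) v)
          inside? v = R? F (src e) v ⊎-dec R? F (tgt e) v

        -- Two edges at the component of x, which also contains w: e leads to the component of y and
        -- g to that of z. The orientation of e is chosen so that g attaches to the component of x.
        record Star : Set where
          field
            {y x w z} : Fin n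
            {g}       : Fin m
            je  : Joins G e y x
            jg  : Joins G g w z
            xw  : R F x w
            g∉F : g ∉ F
            ¬yx : ¬ R F y x
            ¬yz : ¬ R F y z
            ¬xz : ¬ R F x z

        star : Star
        star with leaving-edge 3<n inside? (inj₁ rfl) [ ¬at , ¬bt ]′
        ... | g , u , z , j , inj₁ ru , ¬z = record
          { je = flipJ (joins-ends e) ; jg = j ; xw = ru ; g∉F = λ g∈ → ¬z (inj₁ (R-trans ru (R-joins g∈ j)))
          ; ¬yx = bridge ∘ R-sym ; ¬yz = ¬z ∘ inj₂ ; ¬xz = ¬z ∘ inj₁ }
        ... | g , u , z , j , inj₂ ru , ¬z = record
          { je = joins-ends e ; jg = j ; xw = ru ; g∉F = λ g∈ → ¬z (inj₂ (R-trans ru (R-joins g∈ j)))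
          ; ¬yx = bridge ; ¬yz = ¬z ∘ inj₁ ; ¬xz = ¬z ∘ inj₂ }

        open Star star public

        bridge-g : ¬ R F (src g) (tgt g)
        bridge-g r = ¬xz (R-trans xw (joins-R jg r))

        tc′ : TwoClasses F e g
        tc′ = rebase tc e∉F g∉F not-parallel
          where
          not-parallel : ¬ Dep (F ▸ g) e
          not-parallel d with ends-match jg bridge (par-R g∉F e∉F bridge d)
          ... | x′ , y′ , j , _ , r with joins-unique je j
          ... | inj₁ (refl , refl) = ¬xz (R-sym r)
          ... | inj₂ (refl , refl) = ¬yz (R-sym r)

        -- e and g link different pairs of components, so they represent both classes, and each edge
        -- outside F links the pair of e or the pair of g. This leaves room for no fourth component
        -- and for no edge between y and z.
        edge-position : ∀ {k p q} → k ∉ F → Joins G k p q →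
          ((R F p y × R F q x) ⊎ (R F p x × R F q y)) ⊎ ((R F p w × R F q z) ⊎ (R F p z × R F q w))
        edge-position k∉ jk with TwoClasses.two tc′ k∉
        ... | inj₁ d with ends-match jk bridge (par-R k∉ e∉F bridge d)
        ... | x′ , y′ , j , r , r′ with joins-unique je j
        ... | inj₁ (refl , refl) = inj₁ (inj₁ (r , r′))
        ... | inj₂ (refl , refl) = inj₁ (inj₂ (r , r′))
        edge-position k∉ jk | inj₂ d with ends-match jk bridge-g (par-R k∉ g∉F bridge-g d)
        ... | x′ , y′ , j , r , r′ with joins-unique jg j
        ... | inj₁ (refl , refl) = inj₂ (inj₁ (r , r′))
        ... | inj₂ (refl , refl) = inj₂ (inj₂ (r , r′))

        everything : ∀ {v} → R F y v ⊎ R F z v ⊎ R F x v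
        everything {v} with R? F y v ⊎-dec (R? F z v ⊎-dec R? F x v)
        ... | yes r = r
        ... | no ¬r with leaving-edge 3<n (λ v → R? F y v ⊎-dec (R? F z v ⊎-dec R? F x v)) (inj₁ rfl) ¬r
        ... | k , p , q , jk , Qp , ¬Qq = ⊥-elim (¬Qq (Qq (edge-position k∉ jk)))
          where
          k∉ : k ∉ F
          k∉ k∈ = ¬Qq (Sum.map step′ (Sum.map step′ step′) Qp)
            where
            step′ : ∀ {c} → R F c p → R F c q
            step′ r = R-trans r (R-joins k∈ jk)
          Qq : ((R F p y × R F q x) ⊎ (R F p x × R F q y)) ⊎ ((R F p w × R F q z) ⊎ (R F p z × R F q w)) → R F y q ⊎ R F z q ⊎ R F x q
          Qq (inj₁ (inj₁ (_ , r))) = inj₂ (inj₂ (R-sym r))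
          Qq (inj₁ (inj₂ (_ , r))) = inj₁ (R-sym r)
          Qq (inj₂ (inj₁ (_ , r))) = inj₂ (inj₁ (R-sym r))
          Qq (inj₂ (inj₂ (_ , r))) = inj₂ (inj₂ (R-trans xw (R-sym r)))

        no-edge-yz : ∀ {k p q} → Joins G k p q → R F y p → R F z q → ⊥
        no-edge-yz {k} jk rp rq with k ∈? F
        ... | yes k∈ = ¬yz (R-trans rp (R-trans (R-joins k∈ jk) (R-sym rq)))
        ... | no k∉ with edge-position k∉ jk
        ... | inj₁ (inj₁ (_ , r)) = ¬xz (R-sym (R-trans rq r))
        ... | inj₁ (inj₂ (_ , r)) = ¬yz (R-sym (R-trans rq r))
        ... | inj₂ (inj₁ (r , _)) = ¬yx (R-trans rp (R-trans r (R-sym xw)))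
        ... | inj₂ (inj₂ (r , _)) = ¬yz (R-trans rp r)

        open Parts F y z

        part-R : ∀ {u v} → R F u v → part₃ u ≡ part₃ v
        part-R {u} {v} r with part₃-view u
        ... | inj₁ (a , eq) = trans eq (sym (in-0 (R-trans a r)))
        ... | inj₂ (inj₁ (_ , b , eq)) = trans eq (sym (in-1 ¬yz (R-trans b r)))
        ... | inj₂ (inj₂ (a , b , eq)) = trans eq (sym (in-2 (λ a′ → a (R-trans a′ (R-sym r))) (λ b′ → b (R-trans b′ (R-sym r)))))

        outcomeI : HasL F ⊎ AllBalanced G cls → OutcomeI G cls
        outcomeI alt = p , connected-0 ¬yz ¬yx (¬xz ∘ R-sym) (λ _ → ∈⊤) , connected-1 ¬yz ¬yx (¬xz ∘ R-sym) (λ _ → ∈⊤)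
          , connected-2 ¬yz ¬yx (¬xz ∘ R-sym) (λ _ → ∈⊤) everything
          , no-edges-01 ¬yz ¬yx (¬xz ∘ R-sym) no-edge-yz , Sum.map₁ locate alt
          where
          p = partition₃ ¬yz ¬yx (¬xz ∘ R-sym)
          locate : HasL F → ∃[ i ] ContainsCycleOf G cls lft (Partition.cell p i)
          locate (D , D⊆ , k) with cycle-edge D
          ... | d , d∈ = part₃ (src d) , D , (λ x∈ → ∈-cell⁺ p (part-R (cycle-connected D D⊆ x∈ (src∈V D d∈)))) , k

      -- Flats with a lift cycle

      liftCase : ∀ {F e f} → TwoClasses F e f → HasL F → OutcomeI G cls
      liftCase {F} {e} {f} tc L@(D , D⊆ , kD) = pick (R? F (src e) (src f)) (R? F (tgt e) (src f)) (R? F (src e) (tgt f)) (R? F (tgt e) (tgt f))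
        where
        open TwoClasses tc
        bridge : ∀ {k} → k ∉ F → ¬ R F (src k) (tgt k)
        bridge k∉ r = k∉ (flat (by-full r (inj₁ L)))
        -- Two frame cycles both meet the lift cycle, which joins them up.
        par-R : ∀ {k h} → k ∉ F → h ∉ F → ¬ R F (src h) (tgt h) → Dep (F ▸ k) h → R (F ▸ k) (src h) (tgt h)
        par-R _ _ _ (member h∈) = R-edge h∈
        par-R _ _ _ (by-bal b) = Bal-chord b
        par-R _ _ _ (by-full r _) = r
        par-R _ _ _ (by-frames (A , A⊆ , kA , x , x∈ , rx) (B , B⊆ , kB , y , y∈ , ry))
          with lf-meet D A kD kA | lf-meet D B kD kB
        ... | u , u∈ | v , v∈ with x∈p∩q⁻ (V D) (V A) u∈ | x∈p∩q⁻ (V D) (V B) v∈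
        ... | uD , uA | vD , vB = R-trans rx (R-trans (cycle-connected A A⊆ x∈ uA) (R-trans (cycle-connected D (▸ˡ ∘ D⊆) uD vD)
              (R-sym (R-trans ry (cycle-connected B B⊆ y∈ vB)))))
        parallel : R (F ▸ f) (src e) (tgt e) → ⊥
        parallel r = e∦f (by-full r (inj₁ (HasL-mono ▸ˡ L)))
        -- If both ends of f lay in the components of the ends of e, then f, a bridge like e, would
        -- link the same pair and be parallel to e through the lift cycle. So an end of f lies in a
        -- third component.
        pick : Dec (R F (src e) (src f)) → Dec (R F (tgt e) (src f)) → Dec (R F (src e) (tgt f)) → Dec (R F (tgt e) (tgt f)) → OutcomeI G cls
        pick (no a) (no b) _ _ = ThreeComponents.outcomeI tc (bridge e∉F) a b par-R (inj₁ L)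
        pick _ _ (no a) (no b) = ThreeComponents.outcomeI tc (bridge e∉F) a b par-R (inj₁ L)
        pick (yes a) _ (yes b) _ = ⊥-elim (bridge f∉F (R-trans (R-sym a) b))
        pick _ (yes a) _ (yes b) = ⊥-elim (bridge f∉F (R-trans (R-sym a) b))
        pick (yes a) _ _ (yes b) = ⊥-elim (parallel (R-trans (R-mono ▸ˡ a) (R-trans (R-edge ▸ʳ) (R-sym (R-mono ▸ˡ b)))))
        pick _ (yes a) (yes b) _ = ⊥-elim (parallel (R-trans (R-mono ▸ˡ b) (R-trans (R-sym (R-edge ▸ʳ)) (R-sym (R-mono ▸ˡ a)))))

      -- Balanced flats

      module BalancedCase {F : Subset m} (bF : Balanced F) (flat : ∀ {g} → Dep F g → g ∈ F) where

        balanced-Dep : ∀ {Y h} → Balanced Y → Dep Y h → h ∉ Y → Bal Y h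
        balanced-Dep bY (member h∈) h∉ = contradiction h∈ h∉
        balanced-Dep bY (by-bal b) _ = b
        balanced-Dep bY (by-full _ (inj₁ (C , sub , k))) _ = contradiction (trans (sym k) (bY C sub)) lft≢bal
        balanced-Dep bY (by-full _ (inj₂ f)) _ = contradiction f (¬FAt-BalAt (Balanced⇒BalAt bY))
        balanced-Dep bY (by-frames f _) _ = contradiction f (¬FAt-BalAt (Balanced⇒BalAt bY))

        ¬Bal-F : ∀ {h} → h ∉ F → ¬ Bal F h
        ¬Bal-F h∉ b = h∉ (flat (by-bal b))

        -- F with a bridge g stays balanced, so a parallel chord h would close a balanced cycle
        -- through g; this cycle would join the ends of g over F.
        bridge-chord : ∀ {g h} → ¬ R F (src g) (tgt g) → h ∉ F → R F (src h) (tgt h) → ¬ Dep (F ▸ g) h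
        bridge-chord {g} {h} ¬rg h∉ rh d with h ∈? (F ▸ g)
        ... | yes h∈ with ▸⁻ h∈
        ... | inj₁ h∈F = h∉ h∈F
        ... | inj₂ refl = ¬rg rh
        bridge-chord {g} {h} ¬rg h∉ rh d | no h∉′ with balanced-Dep (Balanced-bridge bF ¬rg) d h∉′
        ... | b@(C , h∈C , C⊆ , k) = ¬rg (R-▸-chord rh (cycle-R C g∈C C⊆′ (src∈V C g∈C) (tgt∈V C g∈C)))
          where
          g∈C : g ∈ E C
          g∈C = Bal-drop (¬Bal-F h∉) b
          C⊆′ : E C ⊆ F ▸ h ▸ g
          C⊆′ f∈ with ▸⁻ (C⊆ f∈)
          ... | inj₂ refl = ▸ˡ ▸ʳ
          ... | inj₁ f∈′ = ▸-mono ▸ˡ f∈′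

        -- A chord k is not parallel to the bridge h. With a bridge k the set `F ▸ k` is balanced,
        -- and there dependence means a balanced cycle.
        par-R : ∀ {k h} → k ∉ F → h ∉ F → ¬ R F (src h) (tgt h) → Dep (F ▸ k) h → R (F ▸ k) (src h) (tgt h)
        par-R {k} {h} k∉ h∉ ¬rh d with R? F (src k) (tgt k)
        ... | yes rk = contradiction (parallel-sym flat h∉ d) (bridge-chord ¬rh k∉ rk)
        ... | no ¬rk with h ∈? (F ▸ k)
        ... | yes h∈ = R-edge h∈
        ... | no h∉′ = Bal-chord (balanced-Dep (Balanced-bridge bF ¬rk) d h∉′)

        -- An edge parallel to a bridge g closes a balanced cycle over `F ▸ g`, and a maximal
        -- balanced set contains every edge closing one.
        class-balanced : ∀ {Y} → Balanced Y → F ⊆ Y → ∃[ A ] (MaxBalanced ⊤ A × Y ⊆ A ×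
          (∀ {g h} → g ∈ Y → ¬ R F (src g) (tgt g) → Dep (F ▸ g) h → h ∈ A))
        class-balanced {Y} bY F⊆Y with maxBalanced ⊤ (λ _ → ∈⊤) bY
        ... | A , Y⊆A , mb = A , mb , Y⊆A , absorbed
          where
          absorbed : ∀ {g h} → g ∈ Y → ¬ R F (src g) (tgt g) → Dep (F ▸ g) h → h ∈ A
          absorbed {g} {h} g∈ ¬rg d with h ∈? A
          ... | yes h∈ = h∈
          ... | no h∉ = contradiction (Bal-mono (▸-least (Y⊆A ∘ F⊆Y) (Y⊆A g∈))
                  (balanced-Dep (Balanced-bridge bF ¬rg) d (λ h∈ → h∉ (▸-least (Y⊆A ∘ F⊆Y) (Y⊆A g∈) h∈)))) (MaxBalanced.¬Bal mb ∈⊤ h∉)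

        -- F with the bridges e and g is balanced, and every other edge is parallel to one of them,
        -- so a maximal balanced extension contains all edges.
        three : ∀ {e f} → TwoClasses F e f → ¬ R F (src e) (tgt e) → ∀ {t} → ¬ R F (src e) t → ¬ R F (tgt e) t → OutcomeI G cls
        three {e} tc ¬re ¬at ¬bt = outcomeI (inj₂ all)
          where
          open ThreeComponents tc ¬re ¬at ¬bt par-R
          bY : Balanced (F ▸ e ▸ g)
          bY = Balanced-bridge (Balanced-bridge bF ¬re) ¬rg
            where
            ¬rg : ¬ R (F ▸ e) (src g) (tgt g)
            ¬rg r with ends-match je bridge-g r
            ... | x′ , y′ , j , r₁ , r₂ with joins-unique jg j
            ... | inj₁ (refl , refl) = ¬xz r₂
            ... | inj₂ (refl , refl) = ¬yz r₁
          all : AllBalanced G cls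
          all C with class-balanced bY (▸ˡ ∘ ▸ˡ)
          ... | A , mb , Y⊆A , absorb = MaxBalanced.balanced mb C λ {k} _ → inA k
            where
            inA : ∀ k → k ∈ A
            inA k with k ∈? F
            ... | yes k∈ = Y⊆A (▸ˡ (▸ˡ k∈))
            ... | no k∉ with TwoClasses.two tc′ k∉
            ... | inj₁ d = absorb (▸ˡ ▸ʳ) ¬re (parallel-sym flat (TwoClasses.e∉F tc′) d)
            ... | inj₂ d = absorb ▸ʳ bridge-g (parallel-sym flat g∉F d)

        private
          class? : ∀ c g → Dec (g ∉ F × Dep (F ▸ g) c)
          class? c g = ¬? (g ∈? F) ×-dec Dep? (F ▸ g) c

        class : Fin m → Subset m
        class c = comprehension (class? c)

        class⁺ : ∀ {c g} → g ∉ F → Dep (F ▸ g) c → g ∈ class c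
        class⁺ {c} g∉ d = ∈-comprehension⁺ (class? c) (g∉ , d)

        class⁻ : ∀ {c g} → g ∈ class c → g ∉ F × Dep (F ▸ g) c
        class⁻ {c} = ∈-comprehension⁻ (class? c)

        F⊆∁class : ∀ {c} → F ⊆ ∁ (class c)
        F⊆∁class g∈ = x∉p⇒x∈∁p λ g∈′ → proj₁ (class⁻ g∈′) g∈

        module TwoComponents {e f : Fin m} (tc : TwoClasses F e f) (¬re : ¬ R F (src e) (tgt e))
          (a b : Fin n) (¬ab : ¬ R F a b) (all : ∀ v → R F a v ⊎ R F b v) where
          open TwoClasses tc hiding (flat)

          part₂ : Fin n → Fin 2
          part₂ v with R? F a v
          ... | yes _ = 0F
          ... | no _ = 1F

          in-0 : ∀ {v} → R F a v → part₂ v ≡ 0F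
          in-0 {v} r with R? F a v
          ... | yes _ = refl
          ... | no ¬r = contradiction r ¬r

          in-1 : ∀ {v} → R F b v → part₂ v ≡ 1F
          in-1 {v} r with R? F a v
          ... | yes r′ = contradiction (R-trans r′ (R-sym r)) ¬ab
          ... | no _ = refl

          out-0 : ∀ {v} → part₂ v ≡ 0F → R F a v
          out-0 {v} eq with R? F a v
          ... | yes r = r
          out-0 () | no _

          out-1 : ∀ {v} → part₂ v ≡ 1F → R F b v
          out-1 {v} eq with R? F a v | all v
          out-1 () | yes _ | _
          ... | no ¬r | inj₁ r = contradiction r ¬r
          ... | no _ | inj₂ r = r

          p : Partition n 2
          p = record { part = part₂ ; nonempty = λ { 0F → a , in-0 rfl ; 1F → b , in-1 rfl } }

          open Partition p using (cell)

          connected-0 : ∀ {A} → F ⊆ A → ConnectedOn G (cell 0F) A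
          connected-0 sub = R⇒connectedOn sub (∈-cell⁺ p (in-0 rfl))
            (λ u∈ r → ∈-cell⁺ p (in-0 (R-trans (out-0 (∈-cell⁻ p u∈)) r)))
            (λ u∈ v∈ → R-trans (R-sym (out-0 (∈-cell⁻ p u∈))) (out-0 (∈-cell⁻ p v∈)))

          connected-1 : ∀ {A} → F ⊆ A → ConnectedOn G (cell 1F) A
          connected-1 sub = R⇒connectedOn sub (∈-cell⁺ p (in-1 rfl))
            (λ u∈ r → ∈-cell⁺ p (in-1 (R-trans (out-1 (∈-cell⁻ p u∈)) r)))
            (λ u∈ v∈ → R-trans (R-sym (out-1 (∈-cell⁻ p u∈))) (out-1 (∈-cell⁻ p v∈)))

          bridge-crosses : ∀ {g} → ¬ R F (src g) (tgt g) → (src g ∈ cell 0F × tgt g ∈ cell 1F) ⊎ (src g ∈ cell 1F × tgt g ∈ cell 0F)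
          bridge-crosses {g} ¬r with all (src g) | all (tgt g)
          ... | inj₁ s | inj₁ t = contradiction (R-trans (R-sym s) t) ¬r
          ... | inj₁ s | inj₂ t = inj₁ (∈-cell⁺ p (in-0 s) , ∈-cell⁺ p (in-1 t))
          ... | inj₂ s | inj₁ t = inj₂ (∈-cell⁺ p (in-1 s) , ∈-cell⁺ p (in-0 t))
          ... | inj₂ s | inj₂ t = contradiction (R-trans (R-sym s) t) ¬r

          class-of-bridge : ∀ {c g} → c ∉ F → ¬ R F (src c) (tgt c) → g ∈ class c → ¬ R F (src g) (tgt g)
          class-of-bridge c∉ ¬rc g∈ rg with class⁻ g∈
          ... | g∉ , d = bridge-chord ¬rc g∉ rg (parallel-sym flat c∉ d)

          -- The complement of one class is F and the other class, which is balanced as soon as its members are bridges.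
          class-balancing : ∀ {c d} → TwoClasses F c d → ¬ R F (src d) (tgt d) → ∀ C → Empty (E C ∩ class c) → cls (E C) ≡ bal
          class-balancing {c} {d} tc₁ ¬rd C avoid with class-balanced (Balanced-bridge bF ¬rd) ▸ˡ
          ... | A , mb , Y⊆A , absorb = MaxBalanced.balanced mb C λ {k} k∈ → inA k∈ (k ∈? F)
            where
            inA : ∀ {k} → k ∈ E C → Dec (k ∈ F) → k ∈ A
            inA k∈ (yes k∈F) = Y⊆A (▸ˡ k∈F)
            inA k∈ (no k∉) with TwoClasses.two tc₁ k∉
            ... | inj₁ x = contradiction (_ , x∈p∩q⁺ (k∈ , class⁺ k∉ x)) avoid
            ... | inj₂ x = absorb ▸ʳ ¬rd (parallel-sym flat (TwoClasses.f∉F tc₁) x)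

          crossing-path : ∀ {g h} → ¬ R F (src g) (tgt g) → ¬ R F (src h) (tgt h) → R (F ▸ h) (src g) (tgt g)
          crossing-path {g} {h} ¬rg ¬rh with all (src g) | all (tgt g) | all (src h) | all (tgt h)
          ... | inj₁ s | inj₁ t | _ | _ = contradiction (R-trans (R-sym s) t) ¬rg
          ... | inj₂ s | inj₂ t | _ | _ = contradiction (R-trans (R-sym s) t) ¬rg
          ... | inj₁ _ | inj₂ _ | inj₁ s | inj₁ t = contradiction (R-trans (R-sym s) t) ¬rh
          ... | inj₁ _ | inj₂ _ | inj₂ s | inj₂ t = contradiction (R-trans (R-sym s) t) ¬rh
          ... | inj₂ _ | inj₁ _ | inj₁ s | inj₁ t = contradiction (R-trans (R-sym s) t) ¬rh
          ... | inj₂ _ | inj₁ _ | inj₂ s | inj₂ t = contradiction (R-trans (R-sym s) t) ¬rh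
          ... | inj₁ x | inj₂ y | inj₁ s | inj₂ t = R-trans (R-mono ▸ˡ (R-trans (R-sym x) s)) (R-trans (R-edge ▸ʳ) (R-mono ▸ˡ (R-trans (R-sym t) y)))
          ... | inj₁ x | inj₂ y | inj₂ s | inj₁ t = R-trans (R-mono ▸ˡ (R-trans (R-sym x) t)) (R-trans (R-sym (R-edge ▸ʳ)) (R-mono ▸ˡ (R-trans (R-sym s) y)))
          ... | inj₂ x | inj₁ y | inj₂ s | inj₁ t = R-trans (R-mono ▸ˡ (R-trans (R-sym x) s)) (R-trans (R-edge ▸ʳ) (R-mono ▸ˡ (R-trans (R-sym t) y)))
          ... | inj₂ x | inj₁ y | inj₁ s | inj₂ t = R-trans (R-mono ▸ˡ (R-trans (R-sym x) t)) (R-trans (R-sym (R-edge ▸ʳ)) (R-mono ▸ˡ (R-trans (R-sym s) y)))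

          bothBridges : ¬ R F (src f) (tgt f) → OutcomeII G cls
          bothBridges ¬rf = p , connected-0 (λ _ → ∈⊤) , connected-1 (λ _ → ∈⊤) , class e , class f , disjoint
            , ⊆-antisym (λ g∈ → [ fwd (class-of-bridge e∉F ¬re) , fwd (class-of-bridge f∉F ¬rf) ]′ (x∈p∪q⁻ (class e) (class f) g∈)) bwd
            , (unbalanced , class-balancing tc ¬rf) , (unbalanced , class-balancing (swap tc) ¬re)
            where
            disjoint : Empty (class e ∩ class f)
            disjoint (g , g∈) with x∈p∩q⁻ (class e) (class f) g∈
            ... | g₁ , g₂ = f∦e (parallel-trans (parallel-sym flat e∉F (proj₂ (class⁻ g₁))) (proj₂ (class⁻ g₂)))
            fwd : ∀ {c g} → (g ∈ class c → ¬ R F (src g) (tgt g)) → g ∈ class c → g ∈ crossE G (cell 0F) (cell 1F)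
            fwd h g∈ = ∈-crossE⁺ (bridge-crosses (h g∈))
            bwd : crossE G (cell 0F) (cell 1F) ⊆ class e ∪ class f
            bwd {g} g∈ = x∈p∪q⁺ (Sum.map (class⁺ g∉) (class⁺ g∉) (two g∉))
              where
              g∉ : g ∉ F
              g∉ g∈F with ∈-crossE⁻ g∈
              ... | inj₁ (s , t) = ¬ab (R-trans (out-0 (∈-cell⁻ p s)) (R-trans (R-edge g∈F) (R-sym (out-1 (∈-cell⁻ p t)))))
              ... | inj₂ (s , t) = ¬ab (R-trans (out-0 (∈-cell⁻ p t)) (R-trans (R-sym (R-edge g∈F)) (R-sym (out-1 (∈-cell⁻ p s)))))
            unbalanced : ∃[ C ] cls (E C) ≢ bal
            -- Adding f turns e into a chord; not being parallel to f, it closes an unbalanced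
            -- cycle.
            unbalanced with chord-unbalanced {F ▸ f} {F ▸ f} (e∦f ∘ member) (crossing-path ¬re ¬rf) (e∦f ∘ by-bal) (λ g∈ _ → g∈)
            ... | C , _ , unb , _ = C , unb

          module _ (rf : R F (src f) (tgt f)) where

            class-chord : ∀ {g} → g ∈ class f → R F (src g) (tgt g)
            class-chord {g} g∈ with R? F (src g) (tgt g)
            ... | yes r = r
            ... | no ¬r = contradiction (proj₂ (class⁻ g∈)) (bridge-chord ¬r f∉F rf)

            balancing : Balancing G cls (class f)
            balancing with chord-unbalanced {F} f∉F rf (¬Bal-F f∉F) (λ g∈ _ → g∈)
            ... | C , _ , unb , _ = (C , unb) , class-balancing (swap tc) ¬re

            oneSided : (∀ {g} → g ∈ class f → R F a (src g)) → OutcomeIII G cls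
            oneSided h = p , class f , balancing
              , (λ g∈ → ∈-inducedE⁺ (∈-cell⁺ p (in-0 (h g∈))) (∈-cell⁺ p (in-0 (R-trans (h g∈) (class-chord g∈)))))
              , connected-0 F⊆∁class , connected-1 (λ _ → ∈⊤)

            -- g and h are parallel although they lie in different components. Of the reasons for g
            -- to depend on `F ▸ h`, only a lift cycle acts across components, and it passes through
            -- h because F is balanced.
            lift-cycle : ∀ {g h} → g ∈ class f → h ∈ class f → ¬ R F (src g) (src h) →
              ∃[ L ] (cls (E L) ≡ lft × (∀ {x} → x ∈ V L → R F (src h) x))
            lift-cycle {g} {h} g∈ h∈ ¬r = by-type (parallel-trans (proj₂ (class⁻ h∈)) (parallel-sym flat f∉F (proj₂ (class⁻ g∈))))
              where
              rh : R F (src h) (tgt h)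
              rh = class-chord h∈
              through-h : ∀ {L} → E L ⊆ F ▸ h → cls (E L) ≢ bal → h ∈ E L
              through-h {L} L⊆ unb with cycle-▸ L L⊆
              ... | inj₁ L⊆F = contradiction (bF L L⊆F) unb
              ... | inj₂ h∈L = h∈L
              noF : ¬ FAt (F ▸ h) (src g)
              noF (D , D⊆ , k , x , x∈ , rx) = ¬r (R-▸-chord rh (R-trans rx (cycle-connected D D⊆ x∈ (src∈V D
                (through-h {D} D⊆ (λ b → frm≢bal (trans (sym k) b)))))))
              by-type : Dep (F ▸ h) g → ∃[ L ] (cls (E L) ≡ lft × (∀ {x} → x ∈ V L → R F (src h) x))
              by-type (member g∈′) with ▸⁻ g∈′
              ... | inj₁ g∈F = contradiction g∈F (proj₁ (class⁻ g∈))
              ... | inj₂ refl = contradiction rfl ¬r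
              by-type (by-bal bl@(C , g∈C , C⊆ , _)) = contradiction
                (R-▸-chord rh (cycle-R C g∈C C⊆ (src∈V C g∈C) (src∈V C (Bal-drop (¬Bal-F (proj₁ (class⁻ g∈))) bl)))) ¬r
              by-type (by-full _ (inj₁ (L , L⊆ , k))) = L , k , λ x∈ → cycle-R L h∈L L⊆ (src∈V L h∈L) x∈
                where h∈L = through-h {L} L⊆ (λ b → lft≢bal (trans (sym k) b))
              by-type (by-full _ (inj₂ fr)) = contradiction fr noF
              by-type (by-frames fr _) = contradiction fr noF

            twoSided : ∀ {g h} → g ∈ class f → R F a (src g) → h ∈ class f → R F b (src h) → OutcomeIV G cls
            twoSided {g} {h} g∈ rg h∈ rh with lift-cycle h∈ g∈ (λ r → ¬ab (R-trans rg (R-sym (R-trans rh r))))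
                                            | lift-cycle g∈ h∈ (λ r → ¬ab (R-trans (R-trans rg r) (R-sym rh)))
            ... | L , k , near | L′ , k′ , near′ = p , class f , balancing , sub , connected-0 F⊆∁class , connected-1 F⊆∁class
              , (L , (λ x∈ → ∈-cell⁺ p (in-0 (R-trans rg (near x∈)))) , k)
              , (L′ , (λ x∈ → ∈-cell⁺ p (in-1 (R-trans rh (near′ x∈)))) , k′)
              where
              sub : class f ⊆ inducedE G (cell 0F) ∪ inducedE G (cell 1F)
              sub {x} x∈ with all (src x)
              ... | inj₁ r = x∈p∪q⁺ (inj₁ (∈-inducedE⁺ (∈-cell⁺ p (in-0 r)) (∈-cell⁺ p (in-0 (R-trans r (class-chord x∈))))))
              ... | inj₂ r = x∈p∪q⁺ (inj₂ (∈-inducedE⁺ (∈-cell⁺ p (in-1 r)) (∈-cell⁺ p (in-1 (R-trans r (class-chord x∈))))))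

        BalancedOutcome : Set
        BalancedOutcome = OutcomeI G cls ⊎ OutcomeII G cls ⊎ OutcomeIII G cls ⊎ OutcomeIV G cls

        with-bridge : ∀ {e f} → TwoClasses F e f → ¬ R F (src e) (tgt e) → BalancedOutcome
        with-bridge {e} {f} tc ¬re with any? (λ t → ¬? (R? F (src e) t) ×-dec ¬? (R? F (tgt e) t))
        ... | yes (t , ¬at , ¬bt) = inj₁ (three tc ¬re ¬at ¬bt)
        ... | no none = decide (R? F (src f) (tgt f))
          where
          all : ∀ v → R F (src e) v ⊎ R F (tgt e) v
          all v with R? F (src e) v | R? F (tgt e) v
          ... | yes r | _ = inj₁ r
          ... | no _ | yes r = inj₂ r
          ... | no ¬a | no ¬b = contradiction (v , ¬a , ¬b) none
          ¬re′ : ¬ R F (tgt e) (src e)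
          ¬re′ = ¬re ∘ R-sym
          decide : Dec (R F (src f) (tgt f)) → BalancedOutcome
          decide (no ¬rf) = inj₂ (inj₁ (TwoComponents.bothBridges tc ¬re (src e) (tgt e) ¬re all ¬rf))
          decide (yes rf) with any? (λ g → g ∈? class f ×-dec R? F (src e) (src g)) | any? (λ g → g ∈? class f ×-dec R? F (tgt e) (src g))
          ... | yes (g , g∈ , rg) | yes (h , h∈ , rh) =
            inj₂ (inj₂ (inj₂ (TwoComponents.twoSided tc ¬re (src e) (tgt e) ¬re all rf g∈ rg h∈ rh)))
          ... | _ | no none′ = inj₂ (inj₂ (inj₁ (TwoComponents.oneSided tc ¬re (src e) (tgt e) ¬re all rf
            λ {g} g∈ → [ id , (λ r → contradiction (g , g∈ , r) none′) ]′ (all (src g)))))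
          -- The whole class lies on the side of `tgt e`, so the sides are exchanged: `OutcomeIII`
          -- places the balancing set in its first cell.
          ... | no none′ | _ = inj₂ (inj₂ (inj₁ (TwoComponents.oneSided tc ¬re (tgt e) (src e) ¬re′ (Sum.swap ∘ all) rf
            λ {g} g∈ → [ (λ r → contradiction (g , g∈ , r) none′) , id ]′ (all (src g)))))

        -- One of e and f is a bridge. If both are chords and F joins all vertices, the unbalanced
        -- cycle closed by f makes e dependent; if F does not, an edge leaving a component is a
        -- bridge and would have to be parallel to a chord.
        balancedCase : ∀ {e f} → TwoClasses F e f → BalancedOutcome
        balancedCase {e} {f} tc with R? F (src e) (tgt e) | R? F (src f) (tgt f)
        ... | no ¬re | _ = with-bridge tc ¬re
        ... | yes _ | no ¬rf = with-bridge (swap tc) ¬rf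
        ... | yes re | yes rf with any? (λ v → ¬? (R? F (src e) v))
          where open TwoClasses tc hiding (flat)
        ... | no none = contradiction (same-class (chord-unbalanced {F} f∉F rf (¬Bal-F f∉F) (λ g∈ _ → g∈))) e∦f
          where
          open TwoClasses tc hiding (flat)
          all : ∀ v → R F (src e) v
          all v with R? F (src e) v
          ... | yes r = r
          ... | no ¬r = contradiction (v , ¬r) none
          same-class : ∃[ C ] (E C ⊆ F ▸ f × cls (E C) ≢ bal × src f ∈ V C × (∀ {x} → x ∈ V C → R F (src f) x)) → Dep (F ▸ f) e
          same-class (C , C⊆ , unb , s∈ , _) = by-full (R-mono ▸ˡ re) (UnbAt⇒Full (C , C⊆ , unb , _ , s∈ , R-mono ▸ˡ (all (src f))))
        ... | yes (v , ¬r) with leaving-edge 3<n (R? F (src e)) rfl ¬r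
        ... | g , u , w , j , ru , ¬rw = ⊥-elim ([ not-parallel e∉F re , not-parallel f∉F rf ]′ (two g∉))
          where
          open TwoClasses tc hiding (flat)
          g∉ : g ∉ F
          g∉ g∈ = ¬rw (R-trans ru (R-joins g∈ j))
          not-parallel : ∀ {h} → h ∉ F → R F (src h) (tgt h) → ¬ Dep (F ▸ g) h
          not-parallel = bridge-chord (λ r → ¬rw (R-trans ru (joins-R j r)))

      -- Flats with frame cycles but no lift cycle

      Span : Subset m → Fin n → Fin n → Set
      Span F v x = R F v x ⊎ FAt F x

      -- Adding h to F makes the component of v unbalanced.
      Act : Subset m → Fin n → Fin m → Set
      Act F v h = (R F (src h) (tgt h) × R F v (src h)) ⊎ ∃[ x ] ∃[ y ] (Joins G h x y × R F v x × FAt F y)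

      module _ (F : Subset m) where
        private
          unframed? : ∀ k → Dec (¬ FAt F (src k) × ¬ FAt F (tgt k))
          unframed? k = ¬? (FAt? F (src k)) ×-dec ¬? (FAt? F (tgt k))
          framed? : ∀ k → Dec (FAt F (src k) × FAt F (tgt k))
          framed? k = FAt? F (src k) ×-dec FAt? F (tgt k)
          balancedPart? : ∀ k → Dec (k ∈ F × ¬ FAt F (src k))
          balancedPart? k = k ∈? F ×-dec ¬? (FAt? F (src k))

        unframed framed balancedPart : Subset m
        unframed = comprehension unframed?
        framed = comprehension framed?
        balancedPart = comprehension balancedPart?

        unframed⁺ : ∀ {k} → ¬ FAt F (src k) → ¬ FAt F (tgt k) → k ∈ unframed
        unframed⁺ s t = ∈-comprehension⁺ unframed? (s , t)

        unframed⁻ : ∀ {k} → k ∈ unframed → ¬ FAt F (src k) × ¬ FAt F (tgt k)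
        unframed⁻ = ∈-comprehension⁻ unframed?

        framed⁺ : ∀ {k} → FAt F (src k) → FAt F (tgt k) → k ∈ framed
        framed⁺ s t = ∈-comprehension⁺ framed? (s , t)

        framed⁻ : ∀ {k} → k ∈ framed → FAt F (src k) × FAt F (tgt k)
        framed⁻ = ∈-comprehension⁻ framed?

        balancedPart⁺ : ∀ {k} → k ∈ F → ¬ FAt F (src k) → k ∈ balancedPart
        balancedPart⁺ s t = ∈-comprehension⁺ balancedPart? (s , t)

        balancedPart⁻ : ∀ {k} → k ∈ balancedPart → k ∈ F × ¬ FAt F (src k)
        balancedPart⁻ = ∈-comprehension⁻ balancedPart?

        -- A frame cycle would make its own component one with a frame cycle, and lift cycles are
        -- excluded.
        balancedPart-balanced : ¬ HasL F → Balanced balancedPart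
        balancedPart-balanced ¬L C C⊆ with bal? (cls (E C))
        ... | yes b = b
        ... | no unb with kind-cases C unb | cycle-edge C
        ... | inj₁ k | _ = ⊥-elim (¬L (C , proj₁ ∘ balancedPart⁻ ∘ C⊆ , k))
        ... | inj₂ k | d , d∈ = ⊥-elim (proj₂ (balancedPart⁻ (C⊆ d∈)) (C , proj₁ ∘ balancedPart⁻ ∘ C⊆ , k , _ , src∈V C d∈ , rfl))

        balancedPart⊆unframed : balancedPart ⊆ unframed
        balancedPart⊆unframed k∈ = let k∈F , ¬u = balancedPart⁻ k∈ in unframed⁺ ¬u λ u → ¬u (FAt-R (R-edge k∈F) u)

        R-balancedPart : ∀ {a b} → ¬ FAt F a → R F a b → R balancedPart a b
        R-balancedPart ¬u rfl = rfl
        R-balancedPart ¬u (cns {k} k∈ j r) = cns (balancedPart⁺ k∈ ¬us) j (R-balancedPart (λ u → ¬u (FAt-R (R-joins k∈ j) u)) r)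
          where
          ¬us : ¬ FAt F (src k)
          ¬us u with joins-unique (joins-ends k) j
          ... | inj₁ (refl , refl) = ¬u u
          ... | inj₂ (refl , refl) = ¬u (FAt-R (R-joins k∈ j) u)

      module _ {F : Subset m} (flat : ∀ {g} → Dep F g → g ∈ F) (¬L : ¬ HasL F)
        (D₀ : Cycle G) (D₀⊆ : E D₀ ⊆ F) (k₀ : cls (E D₀) ≡ frm) where

        D₀-U : ∀ {x} → x ∈ V D₀ → FAt F x
        D₀-U x∈ = D₀ , D₀⊆ , k₀ , _ , x∈ , rfl

        not-both-U : ∀ {h x y} → h ∉ F → Joins G h x y → FAt F x → FAt F y → ⊥
        not-both-U {h} h∉ j ux uy with joins-unique (joins-ends h) j
        ... | inj₁ (refl , refl) = h∉ (flat (by-frames ux uy))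
        ... | inj₂ (refl , refl) = h∉ (flat (by-frames uy ux))

        ¬Bal-F : ∀ {h} → h ∉ F → ¬ Bal F h
        ¬Bal-F h∉ b = h∉ (flat (by-bal b))

        Act-ends : ∀ {v h x y} → Act F v h → Joins G h x y → (R F v x ⊎ FAt F x) × (R F v y ⊎ FAt F y)
        Act-ends {h = h} (inj₁ (r , rv)) j with joins-unique (joins-ends h) j
        ... | inj₁ (refl , refl) = inj₁ rv , inj₁ (R-trans rv r)
        ... | inj₂ (refl , refl) = inj₁ (R-trans rv r) , inj₁ rv
        Act-ends (inj₂ (x′ , y′ , j′ , rv , uy)) j with joins-unique j′ j
        ... | inj₁ (refl , refl) = inj₁ rv , inj₂ uy
        ... | inj₂ (refl , refl) = inj₂ uy , inj₁ rv

        module _ {v : Fin n} (¬Uv : ¬ FAt F v) where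

          U-apart : ∀ {x} → R F v x → ¬ FAt F x
          U-apart r u = ¬Uv (FAt-R r u)

          Act-touches : ∀ {h x y} → Act F v h → Joins G h x y → R F v x ⊎ R F v y
          Act-touches act j with Act-ends act j
          ... | inj₁ r , _ = inj₁ r
          ... | inj₂ _ , inj₁ r = inj₂ r
          Act-touches {h} (inj₁ (r , rv)) j | inj₂ ux , inj₂ uy with joins-unique (joins-ends h) j
          ... | inj₁ (refl , refl) = inj₁ rv
          ... | inj₂ (refl , refl) = inj₂ rv
          Act-touches (inj₂ (x′ , y′ , j′ , rv , _)) j | inj₂ ux , inj₂ uy with joins-unique j′ j
          ... | inj₁ (refl , refl) = inj₁ rv
          ... | inj₂ (refl , refl) = inj₂ rv

          ends⇒Act : ∀ {h} → h ∉ F → (R F v (src h) ⊎ FAt F (src h)) → (R F v (tgt h) ⊎ FAt F (tgt h)) → Act F v h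
          ends⇒Act h∉ (inj₁ r) (inj₁ r′) = inj₁ (R-trans (R-sym r) r′ , r)
          ends⇒Act {h} h∉ (inj₁ r) (inj₂ u) = inj₂ (_ , _ , joins-ends h , r , u)
          ends⇒Act {h} h∉ (inj₂ u) (inj₁ r) = inj₂ (_ , _ , flipJ (joins-ends h) , r , u)
          ends⇒Act {h} h∉ (inj₂ u) (inj₂ u′) = ⊥-elim (not-both-U h∉ (joins-ends h) u u′)

          module _ {g : Fin m} (g∉ : g ∉ F) (act : Act F v g) where

            -- An edge to a frame component imports a frame cycle; a chord closes an unbalanced
            -- cycle near v, which misses D₀ and so is a frame cycle.
            frame-reach : ∀ {x} → R F v x ⊎ FAt F x → FAt (F ▸ g) x
            frame-reach (inj₂ u) = FAt-mono ▸ˡ u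
            frame-reach (inj₁ r) = by-type act
              where
              by-type : Act F v g → FAt (F ▸ g) _
              by-type (inj₂ (x′ , y′ , j , rv , uy)) =
                FAt-R (R-trans (R-mono ▸ˡ (R-trans (R-sym r) rv)) (R-joins ▸ʳ j)) (FAt-mono ▸ˡ uy)
              by-type (inj₁ (rg , rv)) with chord-unbalanced {F} g∉ rg (¬Bal-F g∉) (λ f∈ _ → f∈)
              ... | C , C⊆ , unb , s∈ , near with kind-cases C unb
              ... | inj₂ k = C , C⊆ , k , _ , s∈ , R-mono ▸ˡ (R-trans (R-sym r) rv)
              ... | inj₁ k = ⊥-elim (lf-disjoint C D₀ k k₀ λ x∈ x∈′ → U-apart (R-trans rv (near x∈)) (D₀-U x∈′))

            both-active : ∀ {h} → Act F v h → Dep (F ▸ g) h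
            both-active {h} act′ with Act-ends act′ (joins-ends h)
            ... | s , t = by-frames (frame-reach s) (frame-reach t)

            private
              -- A lift cycle through g would lie in the component of v and miss D₀.
              no-L : ¬ HasL (F ▸ g)
              no-L (D , D⊆ , k) with cycle-▸ D D⊆
              ... | inj₁ D⊆F = ¬L (D , D⊆F , k)
              ... | inj₂ g∈ = lf-disjoint D D₀ k k₀ λ x∈ x∈′ → off (R-trans (R-sym (cycle-R D g∈ D⊆ (src∈V D g∈) x∈)) rfl) x∈ x∈′
                where
                rg : R F (src g) (tgt g)
                rg = cycle-R D g∈ D⊆ (src∈V D g∈) (tgt∈V D g∈)
                off : ∀ {x} → R F x (src g) → x ∈ V D → x ∈ V D₀ → ⊥
                off r x∈ x∈′ with Act-touches act (joins-ends g)
                ... | inj₁ rv = U-apart (R-trans rv (R-sym r)) (D₀-U x∈′)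
                ... | inj₂ rv = U-apart (R-trans (R-trans rv (R-sym rg)) (R-sym r)) (D₀-U x∈′)

              back : ∀ {x z} → R F x z → R F v z ⊎ FAt F z → R F v x ⊎ FAt F x
              back r = Sum.map (λ rv → R-trans rv (R-sym r)) (FAt-R r)

              frame-back : ∀ {x} → FAt (F ▸ g) x → R F v x ⊎ FAt F x
              frame-back (D , D⊆ , k , z , z∈ , rz) with Act-ends act (joins-ends g) | R-▸ rz
              ... | s , t | inj₂ (inj₁ (r , _)) = back r s
              ... | s , t | inj₂ (inj₂ (r , _)) = back r t
              ... | s , t | inj₁ r with cycle-▸ D D⊆
              ... | inj₁ D⊆F = inj₂ (D , D⊆F , k , z , z∈ , r)
              ... | inj₂ g∈ = back (R-trans r (cycle-R D g∈ D⊆ z∈ (src∈V D g∈))) s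

              connected-ends : ∀ {h} → h ∉ F → ¬ R F (src h) (tgt h) → R (F ▸ g) (src h) (tgt h) → Act F v h
              connected-ends h∉ ¬rh r with R-▸ r | Act-ends act (joins-ends g)
              ... | inj₁ rh | _ = contradiction rh ¬rh
              ... | inj₂ (inj₁ (a , b)) | s , t = ends⇒Act h∉ (back a s) (back (R-sym b) t)
              ... | inj₂ (inj₂ (a , b)) | s , t = ends⇒Act h∉ (back a t) (back (R-sym b) s)

            -- The converse of `both-active`, so that `Act F v` describes a whole parallel class:
            -- every new connection or frame cycle due to g reaches only the component of v and the
            -- frame components.
            active-class : ∀ {h} → h ∉ F → Dep (F ▸ g) h → Act F v h
            active-class {h} h∉ (by-frames s t) = ends⇒Act h∉ (frame-back s) (frame-back t)
            active-class {h} h∉ (by-full r (inj₁ L)) = ⊥-elim (no-L L)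
            active-class {h} h∉ (member h∈) with ▸⁻ h∈
            ... | inj₁ h∈F = contradiction h∈F h∉
            ... | inj₂ refl = act
            active-class {h} h∉ (by-full r (inj₂ f)) with R? F (src h) (tgt h)
            ... | no ¬rh = connected-ends h∉ ¬rh r
            ... | yes rh = ends⇒Act h∉ (frame-back f) (back (R-sym rh) (frame-back f))
            active-class {h} h∉ (by-bal b@(C , h∈C , C⊆ , _)) with R? F (src h) (tgt h)
            ... | no ¬rh = connected-ends h∉ ¬rh (Bal-chord b)
            ... | yes rh = ends⇒Act h∉ (back to-g at-g) (back (R-trans (R-sym rh) to-g) at-g)
              where
              g∈C : g ∈ E C
              g∈C = Bal-drop (¬Bal-F h∉) b
              C⊆′ : E C ⊆ F ▸ h ▸ g
              C⊆′ f∈ with ▸⁻ (C⊆ f∈)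
              ... | inj₂ refl = ▸ˡ ▸ʳ
              ... | inj₁ f∈′ = ▸-mono ▸ˡ f∈′
              to-g : R F (src h) (src g)
              to-g = R-▸-chord rh (cycle-R C g∈C C⊆′ (src∈V C h∈C) (src∈V C g∈C))
              at-g : R F v (src g) ⊎ FAt F (src g)
              at-g = proj₁ (Act-ends act (joins-ends g))

        module _ {g x y} (jg : Joins G g x y) (¬Ux : ¬ FAt F x) (¬Uy : ¬ FAt F y) (¬xy : ¬ R F x y) where

          private
            bridge : ¬ R F (src g) (tgt g)
            bridge r = ¬xy (joins-R jg r)
            ¬U-ends : ¬ FAt F (src g) × ¬ FAt F (tgt g)
            ¬U-ends with joins-unique (joins-ends g) jg
            ... | inj₁ (refl , refl) = ¬Ux , ¬Uy
            ... | inj₂ (refl , refl) = ¬Uy , ¬Ux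
            old : ∀ D → E D ⊆ F ▸ g → E D ⊆ F
            old D D⊆ with cycle-▸ D D⊆
            ... | inj₁ D⊆F = D⊆F
            ... | inj₂ g∈ = contradiction (cycle-R D g∈ D⊆ (src∈V D g∈) (tgt∈V D g∈)) bridge
            frame-back : ∀ {z} → FAt (F ▸ g) z → FAt F z
            frame-back (D , D⊆ , k , w , w∈ , rw) with R-▸ rw
            ... | inj₁ r = D , old D D⊆ , k , w , w∈ , r
            ... | inj₂ (inj₁ (_ , r)) = contradiction (D , (λ {f} → old D D⊆ {f}) , k , w , w∈ , r) (proj₂ ¬U-ends)
            ... | inj₂ (inj₂ (_ , r)) = contradiction (D , (λ {f} → old D D⊆ {f}) , k , w , w∈ , r) (proj₁ ¬U-ends)

          -- g is a bridge between components without frame cycles: it closes no cycle and gives no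
          -- component a frame cycle. Balanced cycles remain as the only reason for another edge to
          -- depend on it.
          merge-Bal : ∀ {h} → h ∉ F → Dep (F ▸ g) h → h ≡ g ⊎ Bal (F ▸ g) h
          merge-Bal h∉ (member h∈) with ▸⁻ h∈
          ... | inj₁ h∈F = contradiction h∈F h∉
          ... | inj₂ eq = inj₁ eq
          merge-Bal h∉ (by-bal b) = inj₂ b
          merge-Bal h∉ (by-full _ (inj₁ (D , D⊆ , k))) = ⊥-elim (¬L (D , old D D⊆ , k))
          merge-Bal {h} h∉ (by-frames s t) = ⊥-elim (not-both-U h∉ (joins-ends h) (frame-back s) (frame-back t))
          merge-Bal {h} h∉ (by-full r (inj₂ s)) with R-▸ r
          ... | inj₁ rh = ⊥-elim (not-both-U h∉ (joins-ends h) (frame-back s) (FAt-R (R-sym rh) (frame-back s)))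
          ... | inj₂ (inj₁ (a , _)) = ⊥-elim (proj₁ ¬U-ends (FAt-R (R-sym a) (frame-back s)))
          ... | inj₂ (inj₂ (a , _)) = ⊥-elim (proj₂ ¬U-ends (FAt-R (R-sym a) (frame-back s)))

          merge-class : ∀ {h} → h ∉ F → Dep (F ▸ g) h → ∃[ x′ ] ∃[ y′ ] (Joins G h x′ y′ × R F x x′ × R F y y′)
          merge-class {h} h∉ d with merge-Bal h∉ d
          ... | inj₁ refl = _ , _ , jg , rfl , rfl
          ... | inj₂ b@(C , h∈C , C⊆ , _) = ends-match jg ¬rh (Bal-chord b)
            where
            C⊆′ : E C ⊆ F ▸ h ▸ g
            C⊆′ f∈ with ▸⁻ (C⊆ f∈)
            ... | inj₂ refl = ▸ˡ ▸ʳ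
            ... | inj₁ f∈′ = ▸-mono ▸ˡ f∈′
            ¬rh : ¬ R F (src h) (tgt h)
            ¬rh rh = bridge (R-▸-chord rh (cycle-R C g∈C C⊆′ (src∈V C g∈C) (tgt∈V C g∈C)))
              where g∈C = Bal-drop (¬Bal-F h∉) b

          merge-frame : ∀ {z w} → R (F ▸ g) z w → FAt F w → FAt F z
          merge-frame r u = frame-back (FAt-R r (FAt-mono ▸ˡ u))

          merge-absorbed : ∀ {Z M h} → MaxBalanced Z M → (∀ {q} → q ∈ F → ¬ FAt F (src q) → q ∈ M) → g ∈ M →
            h ∈ Z → ¬ FAt F (src h) → h ∉ F → Dep (F ▸ g) h → h ∈ M
          merge-absorbed {Z} {M} {h} mb F-M g∈M h∈Z ¬Us h∉ d with h ∈? M | merge-Bal h∉ d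
          ... | yes h∈ | _ = h∈
          ... | no _ | inj₁ refl = g∈M
          ... | no h∉M | inj₂ (C , h∈C , C⊆ , kC) =
            contradiction (C , h∈C , (λ {q} q∈ → move q∈ (▸⁻ (C⊆ q∈))) , kC) (MaxBalanced.¬Bal mb h∈Z h∉M)
            where
            move : ∀ {q} → q ∈ E C → q ∈ F ▸ g ⊎ q ≡ h → q ∈ M ▸ h
            move q∈ (inj₂ refl) = ▸ʳ
            move q∈ (inj₁ q∈′) with ▸⁻ q∈′
            ... | inj₂ refl = ▸ˡ g∈M
            ... | inj₁ q∈F = ▸ˡ (F-M q∈F λ u → ¬Us (merge-frame (cycle-R C h∈C C⊆ (src∈V C h∈C) (src∈V C q∈)) u))

        -- Let U be the union of the components with frame cycles. The active edges at a component
        -- K₁ outside U are mutually parallel, so U and K₁ do not cover all vertices, for otherwise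
        -- e and f would be parallel. An edge g leaving U and an edge h leaving the union of U and
        -- K₁ represent the two classes; whether h starts in U or in K₁ decides between `OutcomeV`
        -- and `OutcomeIII'`.
        frameCase : ∀ {e f} → TwoClasses F e f → OutcomeIII' G cls ⊎ OutcomeV G cls
        frameCase {e} {f} tc with leaving-edge 3<n (FAt? F) (D₀-U (src∈V D₀ (proj₂ (cycle-edge D₀)))) (proj₂ outside-U)
          where
          outside-U : ∃[ b ] ¬ FAt F b
          outside-U with FAt? F (src e) | FAt? F (tgt e)
          ... | yes s | yes t = ⊥-elim (not-both-U (TwoClasses.e∉F tc) (joins-ends e) s t)
          ... | yes _ | no t = _ , t
          ... | no s | _ = _ , s
        ... | g , u₁ , v₁ , jg , Uu₁ , ¬Uv₁ = first (any? λ t → ¬? (S? t))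
          where
          open TwoClasses tc hiding (flat)
          g∉ : g ∉ F
          g∉ g∈ = ¬Uv₁ (FAt-R (R-sym (R-joins g∈ jg)) Uu₁)
          act-g : Act F v₁ g
          act-g = inj₂ (v₁ , u₁ , flipJ jg , rfl , Uu₁)
          S? : ∀ v → Dec (Span F v₁ v)
          S? v = R? F v₁ v ⊎-dec FAt? F v
          S-R : ∀ {x y} → R F x y → Span F v₁ x → Span F v₁ y
          S-R r = Sum.map (λ r′ → R-trans r′ r) (FAt-R (R-sym r))
          first : Dec (∃[ t ] ¬ Span F v₁ t) → OutcomeIII' G cls ⊎ OutcomeV G cls
          first (no none) = contradiction (both-active ¬Uv₁ f∉F (active f f∉F) (active e e∉F)) e∦f
            where
            all : ∀ v → Span F v₁ v
            all v with S? v
            ... | yes s = s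
            ... | no ¬s = contradiction (v , ¬s) none
            active : ∀ k → k ∉ F → Act F v₁ k
            active k k∉ = ends⇒Act ¬Uv₁ k∉ (all (src k)) (all (tgt k))
          first (yes (t , ¬St)) with leaving-edge 3<n S? (inj₁ rfl) ¬St
          ... | h , x , v₂ , jh , Sx , ¬Sv₂ = second Sx
            where
            h∉ : h ∉ F
            h∉ h∈ = ¬Sv₂ (S-R (R-joins h∈ jh) Sx)
            ¬v₁v₂ : ¬ R F v₁ v₂
            ¬v₁v₂ r = ¬Sv₂ (inj₁ r)
            ¬Uv₂ : ¬ FAt F v₂
            ¬Uv₂ u = ¬Sv₂ (inj₂ u)
            tc′ : TwoClasses F h g
            -- h leads out of U and K₁, so it is not active at v₁ and hence not parallel to g.
            tc′ = rebase tc h∉ g∉ λ d → ¬Sv₂ (proj₂ (Act-ends (active-class ¬Uv₁ g∉ act-g h∉ d) jh))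
            class-of : ∀ {k} → k ∉ F → Dep (F ▸ h) k ⊎ Act F v₁ k
            class-of k∉ with TwoClasses.two tc′ k∉
            ... | inj₁ d = inj₁ (parallel-sym flat h∉ d)
            ... | inj₂ d = inj₂ (active-class ¬Uv₁ g∉ act-g k∉ (parallel-sym flat g∉ d))
            d₀ : Fin n
            d₀ = src (proj₁ (cycle-edge D₀))
            Ud₀ : FAt F d₀
            Ud₀ = D₀-U (src∈V D₀ (proj₂ (cycle-edge D₀)))
            ¬v₁d₀ : ¬ R F v₁ d₀
            ¬v₁d₀ r = U-apart ¬Uv₁ r Ud₀
            ¬v₂d₀ : ¬ R F v₂ d₀
            ¬v₂d₀ r = U-apart ¬Uv₂ r Ud₀
            open Parts F v₁ v₂
            p : Partition n 3
            p = partition₃ ¬v₁v₂ ¬v₁d₀ ¬v₂d₀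
            open Partition p using (cell)

            -- `spread` has a different reason in each of the two cases. It keeps the edges parallel
            -- to h inside U and the components of v₁ and v₂, which therefore exhaust the vertices.
            module _ (spread : ∀ {k x′ y′} → k ∉ F → Joins G k x′ y′ → Dep (F ▸ h) k → Span F v₁ y′ ⊎ R F v₂ y′) where

              everything : ∀ v → Span F v₁ v ⊎ R F v₂ v
              everything v with S? v ⊎-dec R? F v₂ v
              ... | yes r = r
              ... | no ¬r with leaving-edge 3<n (λ v → S? v ⊎-dec R? F v₂ v) (inj₁ (inj₁ rfl)) ¬r
              ... | k , x′ , y′ , jk , Qx , ¬Qy = ⊥-elim (¬Qy ([ spread k∉ jk , (λ act → inj₁ (proj₂ (Act-ends act jk))) ]′ (class-of k∉)))
                where
                k∉ : k ∉ F
                k∉ k∈ = ¬Qy (Sum.map (S-R (R-joins k∈ jk)) (λ r → R-trans r (R-joins k∈ jk)) Qx)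

              cell₂-U : ∀ {v} → v ∈ cell 2F → FAt F v
              cell₂-U {v} v∈ with out-2 (∈-cell⁻ p v∈) | everything v
              ... | ¬a , ¬b | inj₁ (inj₁ r) = contradiction r ¬a
              ... | ¬a , ¬b | inj₁ (inj₂ u) = u
              ... | ¬a , ¬b | inj₂ r = contradiction r ¬b

            U-cell₂ : ∀ {v} → FAt F v → v ∈ cell 2F
            U-cell₂ u = ∈-cell⁺ p (in-2 (λ r → U-apart ¬Uv₁ r u) (λ r → U-apart ¬Uv₂ r u))

            D₀-cell : ContainsCycleOf G cls frm (cell 2F)
            D₀-cell = D₀ , (λ x∈ → U-cell₂ (D₀-U x∈)) , k₀

            -- Here h is active at v₂, so every edge outside F is active at v₁ or at v₂; such an
            -- edge never links the components of v₁ and v₂.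
            attached : FAt F x → OutcomeV G cls
            attached Ux = p , connected-0 ¬v₁v₂ ¬v₁d₀ ¬v₂d₀ (λ _ → ∈⊤) , connected-1 ¬v₁v₂ ¬v₁d₀ ¬v₂d₀ (λ _ → ∈⊤)
              , ((d₀ , U-cell₂ Ud₀) , complete) , no-edges-01 ¬v₁v₂ ¬v₁d₀ ¬v₂d₀ none , D₀-cell
              where
              act-h : Act F v₂ h
              act-h = inj₂ (v₂ , x , flipJ jh , rfl , Ux)
              none : ∀ {k a b} → Joins G k a b → R F v₁ a → R F v₂ b → ⊥
              none {k} jk ra rb with k ∈? F
              ... | yes k∈ = ¬v₁v₂ (R-trans ra (R-trans (R-joins k∈ jk) (R-sym rb)))
              ... | no k∉ with class-of k∉
              ... | inj₂ act = ¬Sv₂ (S-R (R-sym rb) (proj₂ (Act-ends act jk)))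
              ... | inj₁ d with proj₁ (Act-ends (active-class ¬Uv₂ h∉ act-h k∉ d) jk)
              ... | inj₁ r = ¬v₁v₂ (R-trans ra (R-sym r))
              ... | inj₂ u = U-apart ¬Uv₁ ra u
              spread : ∀ {k x′ y′} → k ∉ F → Joins G k x′ y′ → Dep (F ▸ h) k → Span F v₁ y′ ⊎ R F v₂ y′
              spread k∉ jk d with proj₂ (Act-ends (active-class ¬Uv₂ h∉ act-h k∉ d) jk)
              ... | inj₁ r = inj₂ r
              ... | inj₂ u = inj₁ (inj₂ u)
              complete : ∀ u v → u ∈ cell 2F → v ∈ cell 2F → Reach G (cell 2F) ⊤ u v
              complete u v u∈ v∈ with u ≟ᶠ v
              ... | yes refl = here
              -- v₁ and v₂ form a missing pair outside U. Missing pairs share a vertex, so no pair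
              -- inside U is missing.
              ... | no u≢v with disjoint-nonedge {v₁} {v₂} u≢v (λ { refl → ¬v₁v₂ rfl }) (λ { (k , jk) → none jk rfl rfl })
                      (λ { refl → ¬Uv₁ (cell₂-U spread u∈) }) (λ { refl → ¬Uv₁ (cell₂-U spread v∈) })
                      (λ { refl → ¬Uv₂ (cell₂-U spread u∈) }) (λ { refl → ¬Uv₂ (cell₂-U spread v∈) })
              ... | k , jk = step here ∈⊤ jk v∈

            -- The component of v₂ is attached to that of v₁ only. The balancing set is the
            -- complement of M and N, maximal balanced sets off U and inside U. M is grown from the
            -- balanced part of F with h, so it absorbs the class of h and with it all edges at the
            -- component of v₂.
            merged : R F v₁ x → OutcomeIII' G cls
            merged rx with maxBalanced (unframed F) base⊆ base-balanced | maxBalanced (framed F) (λ x∈ → contradiction x∈ ∉⊥) ∅-balanced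
              where
              ¬xv₂ : ¬ R F x v₂
              ¬xv₂ r = ¬v₁v₂ (R-trans rx r)
              base-balanced : Balanced (balancedPart F ▸ h)
              base-balanced = Balanced-bridge (balancedPart-balanced F ¬L) λ r → ¬xv₂ (joins-R jh (R-mono (proj₁ ∘ balancedPart⁻ F) r))
              base⊆ : balancedPart F ▸ h ⊆ unframed F
              base⊆ = ▸-least (balancedPart⊆unframed F) (not-U (joins-unique (joins-ends h) jh))
                where
                not-U : (src h ≡ x × tgt h ≡ v₂) ⊎ (src h ≡ v₂ × tgt h ≡ x) → h ∈ unframed F
                not-U (inj₁ (a , b)) = unframed⁺ F (subst (¬_ ∘ FAt F) (sym a) (U-apart ¬Uv₁ rx)) (subst (¬_ ∘ FAt F) (sym b) ¬Uv₂)
                not-U (inj₂ (a , b)) = unframed⁺ F (subst (¬_ ∘ FAt F) (sym a) ¬Uv₂) (subst (¬_ ∘ FAt F) (sym b) (U-apart ¬Uv₁ rx))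
            ... | M , base⊆M , mbM | N , _ , mbN =
                p , ∁ A , ((D₀ , λ b → frm≢bal (trans (sym k₀) b)) , λ C avoid → balanced-A C λ {k} k∈ → in-A {C} avoid k∈ (k ∈? A))
              , (λ {k} k∈ → X⊆ k∈) , conn₀ , connected-1 ¬v₁v₂ ¬v₁d₀ ¬v₂d₀ (λ _ → ∈⊤) , conn₂ , D₀-cell , none
              where
              ¬Ux : ¬ FAt F x
              ¬Ux = U-apart ¬Uv₁ rx
              ¬xv₂ : ¬ R F x v₂
              ¬xv₂ r = ¬v₁v₂ (R-trans rx r)

              merge-ends : ∀ {k a b} → k ∉ F → Joins G k a b → Dep (F ▸ h) k → (R F v₁ a × R F v₂ b) ⊎ (R F v₂ a × R F v₁ b)
              merge-ends k∉ jk d with merge-class jh ¬Ux ¬Uv₂ ¬xv₂ k∉ d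
              ... | x′ , y′ , j , r₁ , r₂ with joins-unique j jk
              ... | inj₁ (refl , refl) = inj₁ (R-trans rx r₁ , r₂)
              ... | inj₂ (refl , refl) = inj₂ (r₂ , R-trans rx r₁)

              spread : ∀ {k x′ y′} → k ∉ F → Joins G k x′ y′ → Dep (F ▸ h) k → Span F v₁ y′ ⊎ R F v₂ y′
              spread k∉ jk d with merge-ends k∉ jk d
              ... | inj₁ (_ , r) = inj₂ r
              ... | inj₂ (_ , r) = inj₁ (inj₁ r)

              not-active : ∀ {k a b} → Joins G k a b → R F v₂ a → ¬ Act F v₁ k
              not-active jk ra act = ¬Sv₂ (S-R (R-sym ra) (proj₁ (Act-ends act jk)))

              at-v₂ : ∀ {k a b} → k ∉ F → Joins G k a b → R F v₂ a → Dep (F ▸ h) k × R F v₁ b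
              at-v₂ k∉ jk ra with class-of k∉
              ... | inj₂ act = contradiction act (not-active jk ra)
              ... | inj₁ d with merge-ends k∉ jk d
              ... | inj₁ (r , _) = contradiction (R-trans r (R-sym ra)) ¬v₁v₂
              ... | inj₂ (_ , r) = d , r

              no-K₂U : ∀ {k a b} → Joins G k a b → R F v₂ a → FAt F b → ⊥
              no-K₂U {k} jk ra ub with k ∈? F
              ... | yes k∈ = U-apart ¬Uv₂ (R-trans ra (R-joins k∈ jk)) ub
              ... | no k∉ = U-apart ¬Uv₁ (proj₂ (at-v₂ k∉ jk ra)) ub

              none : NoEdgesBetween G (cell 1F) (cell 2F)
              none (k , k∈) with ∈-crossE⁻ k∈
              ... | inj₁ (s , t) = no-K₂U (joins-ends k) (out-1 (∈-cell⁻ p s)) (cell₂-U spread t)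
              ... | inj₂ (s , t) = no-K₂U (flipJ (joins-ends k)) (out-1 (∈-cell⁻ p t)) (cell₂-U spread s)

              A : Subset m
              A = M ∪ N
              M∉ : ∀ {k} → k ∈ M → ¬ FAt F (src k) × ¬ FAt F (tgt k)
              M∉ k∈ = unframed⁻ F (MaxBalanced.A⊆X mbM k∈)
              N∈ : ∀ {k} → k ∈ N → FAt F (src k) × FAt F (tgt k)
              N∈ k∈ = framed⁻ F (MaxBalanced.A⊆X mbN k∈)
              balanced-A : Balanced A
              balanced-A = ∪-balanced (FAt? F) (MaxBalanced.balanced mbM) (MaxBalanced.balanced mbN) M∉ N∈
              in-A : ∀ {C} → Empty (E C ∩ ∁ A) → ∀ {k} → k ∈ E C → Dec (k ∈ A) → k ∈ A
              in-A avoid k∈ (yes k∈A) = k∈A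
              in-A avoid k∈ (no k∉) = contradiction (_ , x∈p∩q⁺ (k∈ , x∉p⇒x∈∁p k∉)) avoid
              F-M : ∀ {q} → q ∈ F → ¬ FAt F (src q) → q ∈ M
              F-M q∈ ¬u = base⊆M (▸ˡ (balancedPart⁺ F q∈ ¬u))
              class⊆M : ∀ {k} → k ∉ F → Dep (F ▸ h) k → k ∈ M
              class⊆M {k} k∉ d = merge-absorbed jh ¬Ux ¬Uv₂ ¬xv₂ mbM F-M (base⊆M ▸ʳ) (unframed⁺ F (proj₁ ¬U-ends) (proj₂ ¬U-ends)) (proj₁ ¬U-ends) k∉ d
                where
                ¬U-ends : ¬ FAt F (src k) × ¬ FAt F (tgt k)
                ¬U-ends with merge-ends k∉ (joins-ends k) d
                ... | inj₁ (r , r′) = U-apart ¬Uv₁ r , U-apart ¬Uv₂ r′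
                ... | inj₂ (r , r′) = U-apart ¬Uv₂ r , U-apart ¬Uv₁ r′
              K₂-in-M : ∀ {k a b} → Joins G k a b → R F v₂ a → k ∈ M
              K₂-in-M {k} jk ra with k ∈? F
              ... | no k∉ = class⊆M k∉ (proj₁ (at-v₂ k∉ jk ra))
              ... | yes k∈ = F-M k∈ ¬u
                where
                ¬u : ¬ FAt F (src k)
                ¬u u with joins-unique (joins-ends k) jk
                ... | inj₁ (refl , refl) = U-apart ¬Uv₂ ra u
                ... | inj₂ (refl , refl) = U-apart ¬Uv₂ (R-trans ra (R-joins k∈ jk)) u
              X⊆ : ∀ {k} → k ∈ ∁ A → k ∈ inducedE G (cell 0F ∪ cell 2F)
              X⊆ {k} k∈ = ∈-inducedE⁺ (off (joins-ends k)) (off (flipJ (joins-ends k)))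
                where
                off : ∀ {a b} → Joins G k a b → a ∈ cell 0F ∪ cell 2F
                off {a} jk with part₃-view a
                ... | inj₁ (_ , eq) = x∈p∪q⁺ (inj₁ (∈-cell⁺ p eq))
                ... | inj₂ (inj₁ (_ , r , _)) = contradiction (x∈p∪q⁺ (inj₁ (K₂-in-M jk r))) (x∈∁p⇒x∉p k∈)
                ... | inj₂ (inj₂ (_ , _ , eq)) = x∈p∪q⁺ (inj₂ (∈-cell⁺ p eq))
              A⊆∁∁A : A ⊆ ∁ (∁ A)
              A⊆∁∁A k∈ = x∉p⇒x∈∁p λ k∈′ → x∈∁p⇒x∉p k∈′ k∈
              conn₀ : ConnectedOn G (cell 0F) (∁ (∁ A))
              conn₀ = R⇒connectedOn {Y = balancedPart F} (λ k∈ → A⊆∁∁A (x∈p∪q⁺ (inj₁ (base⊆M (▸ˡ k∈))))) (∈-cell⁺ p (in-0 rfl))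
                (λ u∈ r → ∈-cell⁺ p (in-0 (R-trans (out-0 (∈-cell⁻ p u∈)) (R-mono (proj₁ ∘ balancedPart⁻ F) r))))
                (λ u∈ v∈ → R-balancedPart F (U-apart ¬Uv₁ (out-0 (∈-cell⁻ p u∈))) (R-trans (R-sym (out-0 (∈-cell⁻ p u∈))) (out-0 (∈-cell⁻ p v∈))))
              conn₂ : ConnectedOn G (cell 2F) (∁ (∁ A))
              conn₂ = R⇒connectedOn {Y = N} (λ k∈ → A⊆∁∁A (x∈p∪q⁺ (inj₂ k∈))) (U-cell₂ Ud₀)
                (λ u∈ r → U-cell₂ (R-respects {W = FAt F} (respects λ k∈ → (λ _ → proj₂ (N∈ k∈)) , (λ _ → proj₁ (N∈ k∈))) r (cell₂-U spread u∈)))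
                complete
                where
                complete : ∀ {a b} → a ∈ cell 2F → b ∈ cell 2F → R N a b
                complete {a} {b} a∈ b∈ with a ≟ᶠ b
                ... | yes refl = rfl
                -- v₂ is adjacent to neither a nor b, which uses up the missing path, so a and b are
                -- adjacent; N, being maximal balanced, joins the ends of every edge inside U.
                ... | no a≢b with common-nonneighbour {v₂} a≢b (λ { refl → ¬Uv₂ (cell₂-U spread a∈) }) (λ { refl → ¬Uv₂ (cell₂-U spread b∈) })
                        (λ { (k , jk) → no-K₂U jk rfl (cell₂-U spread a∈) }) (λ { (k , jk) → no-K₂U jk rfl (cell₂-U spread b∈) })
                ... | k , jk with joins-unique (joins-ends k) jk
                ... | inj₁ (refl , refl) = MaxBalanced.spans-edge mbN (framed⁺ F (cell₂-U spread a∈) (cell₂-U spread b∈))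
                ... | inj₂ (refl , refl) = R-sym (MaxBalanced.spans-edge mbN (framed⁺ F (cell₂-U spread b∈) (cell₂-U spread a∈)))

            second : Span F v₁ x → OutcomeIII' G cls ⊎ OutcomeV G cls
            second (inj₁ rx) = inj₁ (merged rx)
            second (inj₂ Ux) = inj₂ (attached Ux)

      -- The equivalence

      Outcome : Set
      Outcome = OutcomeI G cls ⊎ OutcomeII G cls ⊎ OutcomeIII G cls ⊎ OutcomeIII' G cls ⊎ OutcomeIV G cls ⊎ OutcomeV G cls

      -- F may contain both lift and frame cycles. Lift cycles are tested first, so the frame case
      -- may assume that there are none.
      classify : ∀ {F e f} → TwoClasses F e f → Outcome
      classify {F} tc with hasL? F | anyCycle? (λ E _ → E ⊆ F × cls E ≡ frm) (λ E _ → E ⊆? F ×-dec kind≟ (cls E) frm)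
      ... | yes L | _ = inj₁ (liftCase tc L)
      ... | no ¬L | yes (D , D⊆ , k) =
        [ (λ o → inj₂ (inj₂ (inj₂ (inj₁ o)))) , (λ o → inj₂ (inj₂ (inj₂ (inj₂ (inj₂ o))))) ]′
          (frameCase (TwoClasses.flat tc) ¬L D D⊆ k tc)
      ... | no ¬L | no ¬F =
        [ inj₁ , [ (λ o → inj₂ (inj₁ o)) , [ (λ o → inj₂ (inj₂ (inj₁ o))) , (λ o → inj₂ (inj₂ (inj₂ (inj₂ (inj₁ o))))) ]′ ]′ ]′
          (BalancedCase.balancedCase bF (TwoClasses.flat tc) tc)
        where
        bF : Balanced F
        bF C sub with bal? (cls (E C))
        ... | yes b = b
        ... | no unb with kind-cases C unb
        ... | inj₁ k = ⊥-elim (¬L (C , sub , k))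
        ... | inj₂ k = ⊥-elim (¬F (C , sub , k))

      breakable⇔ : Connected → ((¬ Unbreakable) ⇔ Outcome)
      breakable⇔ conn = mk⇔
        (λ ¬unb → [ (λ unb → contradiction unb ¬unb) , id ]′ (unbreakable-or classify conn))
        [ fromI , [ fromII , [ fromIII , [ fromIII' , [ fromIV , fromV ]′ ]′ ]′ ]′ ]′

theorem6p3 : ∀ {n m : ℕ} (G : Graph n m) (cls : Subset m → Kind) →
    QuasiBiased G cls → SiCompleteMinusPath G → 3 < n →
    Matroid.Connected (Circuit G cls) →
    ((¬ Matroid.Unbreakable (Circuit G cls)) ⇔
    (OutcomeI G cls ⊎ OutcomeII G cls ⊎ OutcomeIII G cls ⊎ OutcomeIII' G cls ⊎
    OutcomeIV G cls ⊎ OutcomeV G cls))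
theorem6p3 G cls qb si 3<n conn = GraphTheory.QuasiGraphic.NearlyComplete.breakable⇔ G cls qb si 3<n conn
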